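{- There exists a distance-approximation algorithm for induced $C_4$-freeness whose query complexity is $\exp(\mathrm{poly}(1/\varepsilon))$.
   Context: Graphs are finite, simple and undirected; the input graph $G=(V,E)$ has $n=|V|$ vertices. The distance between two graphs $G=(V,E)$ and $G'=(V,E')$ is $\Delta(G,G')=(|E\setminus E'|+|E'\setminus E|)/n^2$, and for a graph property $\mathcal{P}$, $\Delta(G,\mathcal{P})=\min_{G'\in\mathcal{P}}\Delta(G,G')$. A distance-approximation algorithm for $\mathcal{P}$ is a randomized algorithm that, for every graph $G$ and every $\varepsilon\in(0,1)$, given $\varepsilon$ and query access to the adjacency matrix of $G$, outputs $\hat\Delta$ with $|\hat\Delta-\Delta(G,\mathcal{P})|\le\varepsilon$ with probability at least $2/3$; its query complexity is the number of adjacency queries. $C_4$ is the cycle on $4$ vertices; induced $C_4$-free means no induced subgraph is isomorphic to $C_4$. -}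

module Defs where

open import Data.Bool using (Bool; true; false; _∧_; not; if_then_else_)
open import Data.Nat as ℕ using (ℕ; zero; suc; _+_; _*_; _^_; _<_; _≤_)
open import Data.Fin using (Fin; toℕ)
open import Data.List using (List; length; filter; allFin; concatMap; map)
open import Data.Vec using (Vec)
open import Data.Product using (Σ; _×_; ∃; ∃-syntax; _,_)
open import Relation.Binary.PropositionalEquality using (_≡_; _≢_)
open import Relation.Nullary using (¬_; Dec; yes; no)
open import Data.Integer using (+_)
open import Data.Rational as ℚ using (ℚ; _/_)

record Graph (n : ℕ) : Set where
  field
    adj   : Fin n → Fin n → Bool
    sym   : ∀ i j → adj i j ≡ adj j i
    irrefl : ∀ i → adj i i ≡ false
open Graph public

HasInducedC4 : ∀ {n} → Graph n → Set
HasInducedC4 {n} G = Σ (Fin n) λ a → Σ (Fin n) λ b → Σ (Fin n) λ c → Σ (Fin n) λ d →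
  (a ≢ b) × (a ≢ c) × (a ≢ d) × (b ≢ c) × (b ≢ d) × (c ≢ d) ×
  (adj G a b ≡ true) × (adj G b c ≡ true) × (adj G c d ≡ true) × (adj G d a ≡ true) ×
  (adj G a c ≡ false) × (adj G b d ≡ false)

InducedC4Free : ∀ {n} → Graph n → Set
InducedC4Free G = ¬ HasInducedC4 G

xor : Bool → Bool → Bool
xor true b = not b
xor false b = b

editCount : ∀ {n} → Graph n → Graph n → ℕ
editCount {n} G H =
  length (filter (λ p → Data.Bool._≟_ (xor (adj G (Data.Product.proj₁ p)
                                                  (Data.Product.proj₂ p))
                                             (adj H (Data.Product.proj₁ p)
                                                  (Data.Product.proj₂ p))) true)
                 (concatMap (λ i → map (λ j → (i , j))
                    (filter (λ j → toℕ i ℕ.<? toℕ j) (allFin n))) (allFin n)))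
  where import Data.Bool

-- k is the minimum edit count from G to an induced-C4-free graph, so that
-- Δ(G, induced C4-free) = k / n².
IsMinDistC4 : ∀ {n} → Graph n → ℕ → Set
IsMinDistC4 {n} G k =
  (Σ (Graph n) λ H → InducedC4Free H × editCount G H ≡ k) ×
  (∀ (H : Graph n) → InducedC4Free H → k ≤ editCount G H)

-- Adaptive query algorithm (deterministic, given the random seed):
-- a decision tree querying adjacency-matrix entries, outputting a rational.
data QTree (n : ℕ) : Set where
  output : ℚ → QTree n
  query  : Fin n → Fin n → (Bool → QTree n) → QTree n

run : ∀ {n} → QTree n → Graph n → ℚ
run (output x) G = x
run (query i j k) G = run (k (adj G i j)) G

queries : ∀ {n} → QTree n → Graph n → ℕ
queries (output x) G = 0
queries (query i j k) G = suc (queries (k (adj G i j)) G)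

-- A randomized query algorithm: for each ε and n, uses r uniform random bits;
-- seed s determines the decision tree that is run.
record RandAlg : Set where
  field
    bits : ℚ → ℕ → ℕ
    tree : (ε : ℚ) (n : ℕ) → Vec Bool (bits ε n) → QTree n
open RandAlg public

seeds : (r : ℕ) → List (Vec Bool r)
seeds zero = Vec.[] ∷ []
  where open import Data.List using (_∷_; [])
        import Data.Vec as Vec
seeds (suc r) = concatMap (λ s → (true Vec.∷ s) ∷ (false Vec.∷ s) ∷ []) (seeds r)
  where open import Data.List using (_∷_; [])
        import Data.Vec as Vec

goodSeeds : RandAlg → (ε : ℚ) → ∀ {n} → Graph n → ℚ → ℕ
goodSeeds A ε {n} G v =
  length (filter (λ s → ℚ.∣ run (tree A ε n s) G ℚ.- v ∣ ℚ.≤? ε) (seeds (bits A ε n)))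

-- A is a distance-approximation algorithm for induced C4-freeness:
-- for all n ≥ 1, graphs G, ε ∈ (0,1): with probability ≥ 2/3 the output
-- is within ε of Δ(G, P) = k / n².
IsDistApproxC4 : RandAlg → Set
IsDistApproxC4 A = ∀ (ε : ℚ) → ℚ.0ℚ ℚ.< ε → ε ℚ.< ℚ.1ℚ →
  ∀ (m : ℕ) (G : Graph (suc m)) (k : ℕ) → IsMinDistC4 G k →
  2 * 2 ^ bits A ε (suc m) ≤ 3 * goodSeeds A ε G ((+ k) / (suc m * suc m))

QueryBound : RandAlg → (ℚ → ℕ) → Set
QueryBound A q = ∀ (ε : ℚ) → ℚ.0ℚ ℚ.< ε → ε ℚ.< ℚ.1ℚ →
  ∀ (n : ℕ) (G : Graph n) (s : Vec Bool (bits A ε n)) → queries (tree A ε n s) G ≤ q ε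

-- q(ε) = exp(poly(1/ε)): there are constants c, d with
-- q(ε) ≤ 2^(c · m^d) for every natural m ≥ 1/ε.
ExpPolyBound : (ℚ → ℕ) → Set
ExpPolyBound q = ∃[ c ] ∃[ d ] ∀ (ε : ℚ) → ℚ.0ℚ ℚ.< ε → ε ℚ.< ℚ.1ℚ →
  ∀ (m : ℕ) → ℚ.1ℚ ℚ.≤ ε ℚ.* ((+ m) / 1) → q ε ≤ 2 ^ (c * m ^ d)

{-# OPTIONS --safe #-}

-- Up to εn² edits, an induced C₄-free graph on n vertices consists of cliques X₁, …, X_N with
-- N ≤ exp(poly(1/ε)), pairwise completely joined or not joined at all, and an independent set Y, each
-- of whose vertices sees, arbitrarily, only cliques that are pairwise joined.  Indeed, remove linearly
-- large cliques greedily.  The rest Y is sparse, since an independent set of high-degree vertices has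
-- too many common neighbours, while common neighbours of non-adjacent vertices form a clique.  Between
-- two cliques the neighbourhoods are nested, so cutting each clique into layers makes almost all pairs
-- of layers homogeneous.  Non-adjacent pairs inside the neighbourhood of y ∈ Y form a 2K₂-free graph
-- with few edges, so a few deletions turn that neighbourhood into a union of joined cliques.
-- Conversely every graph of this shape is induced C₄-free as soon as the graph of its cliques is.
--
-- Hence the distance is, up to ε, the least cost of a labelling of the vertices by the parts of such a
-- shape.  Split the vertices into O(1/ε) blocks.  Starting from an optimal labelling, relabel the
-- blocks one after the other, giving each vertex the label that is cheapest against the labels of a
-- fresh random sample.  On average this costs little, and the result depends only on the labels of the
-- samples.  So it suffices to estimate, for each possible labelling of the samples, the cost of the
-- labelling it generates.  A majority vote over groups of random pairs errs with probability small
-- enough for a union bound over all doubly exponentially many of them.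

module Submission where

open import Data.Bool using (Bool; true; false; _∧_; _∨_; not; if_then_else_)
open import Data.Empty using (⊥; ⊥-elim)
open import Data.Unit using (⊤; tt)
open import Data.Fin using (Fin; zero; suc; toℕ; fromℕ<; combine; funToFin; finToFun)
import Data.Fin.Properties as Fin
open import Data.List using (List; []; _∷_; length; map; filter; concatMap; allFin; _++_)
import Data.List.Extrema as Extrema
import Data.List.Properties as List
open import Data.List.Membership.Propositional using (_∈_; lose; find)
import Data.List.Membership.Propositional.Properties as ∈
import Data.List.Relation.Unary.All as All
import Data.List.Relation.Unary.All.Properties as All
open import Data.List.Relation.Unary.Any as Any using (Any; here; there; any?)
open import Data.Maybe using (Maybe; just; nothing)
import Data.Maybe.Properties as Maybe
open import Data.Nat
open import Data.Nat.Coprimality using (Coprime)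
open import Data.Nat.DivMod
open import Data.Nat.Properties
open import Data.Nat.Tactic.RingSolver using (solve-∀)
open import Data.Product using (Σ; _×_; _,_; proj₁; proj₂; ∃)
open import Data.Sum using (_⊎_; inj₁; inj₂; [_,_]′)
open import Data.Vec as Vec using (Vec; []; _∷_; toList; lookup; tabulate)
import Data.Vec.Properties as Vec
open import Function using (_∘_; id; case_of_)
open import Relation.Binary.Definitions using (tri<; tri≈; tri>)
open import Relation.Binary.PropositionalEquality
open import Relation.Nullary using (¬_; Dec; yes; no; does; contradiction)
open import Relation.Nullary.Decidable using (_×-dec_; _⊎-dec_; _→-dec_; ¬?; map′; dec-true; dec-false; decidable-stable)
open import Defs renaming (sym to adj-sym; irrefl to adj-irrefl)
open import Data.Integer as ℤ using (ℤ)
import Data.Integer.Properties as ℤ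
open import Data.Rational as ℚ using (ℚ)
import Data.Rational.Properties as ℚ
open import Data.Rational.Unnormalised as ℚᵘ using (ℚᵘ; mkℚᵘ)
import Data.Rational.Unnormalised.Properties as ℚᵘ

-- Finite sums

-- Error budget, with e = `invCeil ε` above 1/ε. Costs run over ordered pairs, so an edit distance k
-- appears as 2k and may be missed by 2n²/e. The template approximation loses n²/(8e), recolouring
-- another n²/(8e) on average, half of it from sampling and half from pairs inside one block. A
-- valid labelling never costs less than 2k, so by Markov's inequality the excess is above 2n²/e
-- with probability at most 1/8; the majority votes fail with probability at most another 1/8.
--
-- The obstacle is the number of labels: a vertex of the independent part has 2 ^ N possible types,
-- and N is already exponential in 1/ε. The number of hypotheses enters only through its logarithm,
-- which is polynomial in N, and the sample sizes are polynomial in N because the costs of all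
-- labels reduce to 2N + 1 counts. This keeps the query complexity singly exponential.
--
-- Large cliques and largest independent families are chosen classically, under double negation.
-- This does no harm: what is finally concluded from them is an inequality between natural numbers,
-- which is decidable.

∑ : {A : Set} → List A → (A → ℕ) → ℕ
∑ []       f = 0
∑ (x ∷ xs) f = f x + ∑ xs f

𝟙 : Bool → ℕ
𝟙 true  = 1
𝟙 false = 0

𝟙≤1 : ∀ b → 𝟙 b ≤ 1
𝟙≤1 true  = ≤-refl
𝟙≤1 false = z≤n

𝟙-mono : ∀ {b c} → (b ≡ true → c ≡ true) → 𝟙 b ≤ 𝟙 c
𝟙-mono {false}         h = z≤n
𝟙-mono {true} {true}   h = ≤-refl
𝟙-mono {true} {false}  h with () ← h refl

𝟙-≤ : ∀ b {n} → (b ≡ true → 1 ≤ n) → 𝟙 b ≤ n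
𝟙-≤ false h = z≤n
𝟙-≤ true  h = h refl

𝟙≡1 : ∀ {b} → b ≡ true → 𝟙 b ≡ 1
𝟙≡1 refl = refl

false≢true : false ≢ true
false≢true ()

does⇒ : ∀ {P : Set} (d : Dec P) → does d ≡ true → P
does⇒ (yes p) _ = p

does-false : ∀ {P : Set} (d : Dec P) → does d ≡ false → ¬ P
does-false (no ¬p) _ = ¬p

𝟙-scale : ∀ {P : Set} (d : Dec P) {m n} → (P → m ≤ n) → m * 𝟙 (does d) ≤ n
𝟙-scale (yes p) {m} h = ≤-trans (≤-reflexive (*-identityʳ m)) (h p)
𝟙-scale (no _)  {m} h = ≤-trans (≤-reflexive (*-zeroʳ m)) z≤n

module _ {A : Set} where

  ∑-cong : ∀ (xs : List A) {f g : A → ℕ} → (∀ x → f x ≡ g x) → ∑ xs f ≡ ∑ xs g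
  ∑-cong []       h = refl
  ∑-cong (x ∷ xs) h = cong₂ _+_ (h x) (∑-cong xs h)

  ∑-mono∈ : ∀ (xs : List A) {f g : A → ℕ} → (∀ {x} → x ∈ xs → f x ≤ g x) → ∑ xs f ≤ ∑ xs g
  ∑-mono∈ []       h = z≤n
  ∑-mono∈ (x ∷ xs) h = +-mono-≤ (h (here refl)) (∑-mono∈ xs (h ∘ there))

  ∑-mono : ∀ (xs : List A) {f g : A → ℕ} → (∀ x → f x ≤ g x) → ∑ xs f ≤ ∑ xs g
  ∑-mono xs h = ∑-mono∈ xs λ {x} _ → h x

  ∑-+ : ∀ (xs : List A) (f g : A → ℕ) → ∑ xs (λ x → f x + g x) ≡ ∑ xs f + ∑ xs g
  ∑-+ []       f g = refl
  ∑-+ (x ∷ xs) f g = trans (cong (f x + g x +_) (∑-+ xs f g)) (lem (f x) (g x) (∑ xs f) (∑ xs g))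
    where
    lem : ∀ a b c d → a + b + (c + d) ≡ a + c + (b + d)
    lem = solve-∀

  ∑-*ˡ : ∀ (xs : List A) c (f : A → ℕ) → ∑ xs (λ x → c * f x) ≡ c * ∑ xs f
  ∑-*ˡ []       c f = sym (*-zeroʳ c)
  ∑-*ˡ (x ∷ xs) c f = trans (cong (c * f x +_) (∑-*ˡ xs c f)) (sym (*-distribˡ-+ c (f x) (∑ xs f)))

  ∑-*ʳ : ∀ (xs : List A) c (f : A → ℕ) → ∑ xs (λ x → f x * c) ≡ ∑ xs f * c
  ∑-*ʳ xs c f = trans (∑-cong xs λ x → *-comm (f x) c) (trans (∑-*ˡ xs c f) (*-comm c (∑ xs f)))

  ∑-const : ∀ (xs : List A) c → ∑ xs (λ _ → c) ≡ length xs * c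
  ∑-const []       c = refl
  ∑-const (x ∷ xs) c = cong (c +_) (∑-const xs c)

  ∑-≤const : ∀ (xs : List A) {f : A → ℕ} c → (∀ x → f x ≤ c) → ∑ xs f ≤ length xs * c
  ∑-≤const xs c h = ≤-trans (∑-mono xs h) (≤-reflexive (∑-const xs c))

  ∑-zero : ∀ (xs : List A) {f : A → ℕ} → (∀ x → f x ≡ 0) → ∑ xs f ≡ 0
  ∑-zero xs h = trans (∑-cong xs h) (trans (∑-const xs 0) (*-zeroʳ (length xs)))

  ∑-++ : ∀ (xs ys : List A) (f : A → ℕ) → ∑ (xs ++ ys) f ≡ ∑ xs f + ∑ ys f
  ∑-++ []       ys f = refl
  ∑-++ (x ∷ xs) ys f = trans (cong (f x +_) (∑-++ xs ys f)) (sym (+-assoc (f x) _ _))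

  ∑-∈ : ∀ {xs : List A} {x} (f : A → ℕ) → x ∈ xs → f x ≤ ∑ xs f
  ∑-∈ f (here refl) = m≤m+n _ _
  ∑-∈ f (there p)   = ≤-trans (∑-∈ f p) (m≤n+m _ _)

  ∑-filter : ∀ {P : A → Set} (P? : ∀ x → Dec (P x)) (xs : List A) f →
             ∑ (filter P? xs) f ≡ ∑ xs (λ x → 𝟙 (does (P? x)) * f x)
  ∑-filter P? []       f = refl
  ∑-filter P? (x ∷ xs) f with does (P? x)
  ... | true  = cong₂ _+_ (sym (+-identityʳ (f x))) (∑-filter P? xs f)
  ... | false = ∑-filter P? xs f

  length-filter≡∑ : ∀ {P : A → Set} (P? : ∀ x → Dec (P x)) (xs : List A) →
                    length (filter P? xs) ≡ ∑ xs (λ x → 𝟙 (does (P? x)))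
  length-filter≡∑ P? []       = refl
  length-filter≡∑ P? (x ∷ xs) with does (P? x)
  ... | true  = cong suc (length-filter≡∑ P? xs)
  ... | false = length-filter≡∑ P? xs

  length≡∑ : ∀ (xs : List A) → length xs ≡ ∑ xs (λ _ → 1)
  length≡∑ []       = refl
  length≡∑ (x ∷ xs) = cong suc (length≡∑ xs)

module _ {A B : Set} where

  ∑-map : ∀ (g : A → B) xs (f : B → ℕ) → ∑ (map g xs) f ≡ ∑ xs (f ∘ g)
  ∑-map g []       f = refl
  ∑-map g (x ∷ xs) f = cong (f (g x) +_) (∑-map g xs f)

  ∑-concatMap : ∀ (g : A → List B) xs (f : B → ℕ) → ∑ (concatMap g xs) f ≡ ∑ xs (λ x → ∑ (g x) f)
  ∑-concatMap g []       f = refl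
  ∑-concatMap g (x ∷ xs) f =
    trans (∑-++ (g x) (concatMap g xs) f) (cong (∑ (g x) f +_) (∑-concatMap g xs f))

  ∑-swap : ∀ (xs : List A) (ys : List B) (f : A → B → ℕ) →
           ∑ xs (λ x → ∑ ys (λ y → f x y)) ≡ ∑ ys (λ y → ∑ xs (λ x → f x y))
  ∑-swap []       ys f = sym (∑-zero ys λ _ → refl)
  ∑-swap (x ∷ xs) ys f =
    trans (cong (∑ ys (f x) +_) (∑-swap xs ys f)) (sym (∑-+ ys (f x) (λ y → ∑ xs (λ x → f x y))))

  ∑-product : ∀ (xs : List A) (ys : List B) (f : A → ℕ) (g : B → ℕ) →
              ∑ xs (λ x → ∑ ys (λ y → f x * g y)) ≡ ∑ xs f * ∑ ys g
  ∑-product xs ys f g =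
    trans (∑-cong xs λ x → ∑-*ˡ ys (f x) g) (∑-*ʳ xs (∑ ys g) f)

module _ {A B : Set} where

  pairs : List A → List B → List (A × B)
  pairs xs ys = concatMap (λ x → map (x ,_) ys) xs

  ∑-pairs : ∀ xs ys (f : A × B → ℕ) → ∑ (pairs xs ys) f ≡ ∑ xs (λ x → ∑ ys (λ y → f (x , y)))
  ∑-pairs xs ys f = trans (∑-concatMap _ xs f) (∑-cong xs λ x → ∑-map (x ,_) ys f)

  length-pairs : ∀ (xs : List A) (ys : List B) → length (pairs xs ys) ≡ length xs * length ys
  length-pairs xs ys = trans (length≡∑ (pairs xs ys)) (trans (∑-pairs xs ys _)
    (trans (∑-cong xs λ _ → sym (length≡∑ ys)) (∑-const xs _)))

  ∈-pairs : ∀ {xs ys} {x : A} {y : B} → x ∈ xs → y ∈ ys → (x , y) ∈ pairs xs ys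
  ∈-pairs {ys = ys} x∈ y∈ = ∈.∈-concatMap⁺ (λ x → map (x ,_) ys) (Any.map (λ { refl → ∈.∈-map⁺ _ y∈ }) x∈)

  pairs-∈ : ∀ xs {ys : List B} {p} → p ∈ pairs xs ys → proj₁ p ∈ xs × proj₂ p ∈ ys
  pairs-∈ xs {ys} p∈ with find (∈.∈-concatMap⁻ (λ x → map (x ,_) ys) {xs = xs} p∈)
  ... | x , x∈ , q∈ with ∈.∈-map⁻ (x ,_) q∈
  ... | y , y∈ , refl = x∈ , y∈

module _ {A : Set} where

  vecs : List A → (k : ℕ) → List (Vec A k)
  vecs xs zero    = [] ∷ []
  vecs xs (suc k) = concatMap (λ x → map (x ∷_) (vecs xs k)) xs

  ∑-vecs : ∀ xs k (f : Vec A (suc k) → ℕ) →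
           ∑ (vecs xs (suc k)) f ≡ ∑ xs (λ x → ∑ (vecs xs k) (λ v → f (x ∷ v)))
  ∑-vecs xs k f = trans (∑-concatMap _ xs f) (∑-cong xs λ x → ∑-map (x ∷_) (vecs xs k) f)

  length-vecs : ∀ xs k → length (vecs xs k) ≡ length xs ^ k
  length-vecs xs zero    = refl
  length-vecs xs (suc k) = trans (length≡∑ (vecs xs (suc k))) (trans (∑-vecs xs k _)
    (trans (∑-cong xs λ _ → trans (sym (length≡∑ (vecs xs k))) (length-vecs xs k)) (∑-const xs _)))

  ∑-vecs-const : ∀ xs k c → ∑ (vecs xs k) (λ _ → c) ≡ length xs ^ k * c
  ∑-vecs-const xs k c = trans (∑-const (vecs xs k) c) (cong (_* c) (length-vecs xs k))

  ∈-vecs : ∀ {xs k} (v : Vec A k) → (∀ i → lookup v i ∈ xs) → v ∈ vecs xs k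
  ∈-vecs []      h = here refl
  ∈-vecs {xs} (x ∷ v) h = ∈.∈-concatMap⁺ (λ x → map (x ∷_) (vecs xs _))
    (Any.map (λ { refl → ∈.∈-map⁺ _ (∈-vecs v (h ∘ suc)) }) (h zero))

-- Moments of sampled sums

^-distribʳ-* : ∀ k a b → (a * b) ^ k ≡ a ^ k * b ^ k
^-distribʳ-* zero    a b = refl
^-distribʳ-* (suc k) a b = trans (cong (a * b *_) (^-distribʳ-* k a b)) (lem a b (a ^ k) (b ^ k))
  where
  lem : ∀ a b c d → a * b * (c * d) ≡ a * c * (b * d)
  lem = solve-∀

dist² : ∀ a b → ∣ a - b ∣ * ∣ a - b ∣ + 2 * (a * b) ≡ a * a + b * b
dist² a b with ≤-total a b
... | inj₁ a≤b with d , refl ← m≤n⇒∃[o]m+o≡n a≤b rewrite ∣m-m+n∣≡n a d = lem a d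
  where
  lem : ∀ a d → d * d + 2 * (a * (a + d)) ≡ a * a + (a + d) * (a + d)
  lem = solve-∀
... | inj₂ b≤a with d , refl ← m≤n⇒∃[o]m+o≡n b≤a rewrite ∣-∣-comm (b + d) b | ∣m-m+n∣≡n b d = lem b d
  where
  lem : ∀ b d → d * d + 2 * ((b + d) * b) ≡ (b + d) * (b + d) + b * b
  lem = solve-∀

2ab≤a²+b² : ∀ a b → 2 * (a * b) ≤ a * a + b * b
2ab≤a²+b² a b = subst (2 * (a * b) ≤_) (dist² a b) (m≤n+m _ (∣ a - b ∣ * ∣ a - b ∣))

m≤m*m : ∀ m → m ≤ m * m
m≤m*m zero    = z≤n
m≤m*m (suc m) = m≤m+n (suc m) _

module Sampling {A : Set} (xs : List A) (f : A → ℕ) (f≤1 : ∀ x → f x ≤ 1) where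

  private
    n = length xs
    τ = ∑ xs f
    E : ∀ {k} → Vec A k → ℕ
    E v = ∑ (toList v) f
    M₁ M₂ : ℕ → ℕ
    M₁ k = ∑ (vecs xs k) E
    M₂ k = ∑ (vecs xs k) λ v → E v * E v

  τ≤n : τ ≤ n
  τ≤n = subst (τ ≤_) (*-identityʳ n) (∑-≤const xs 1 f≤1)

  firstMoment : ∀ k → n * M₁ k ≡ k * (n ^ k * τ)
  firstMoment zero    = *-zeroʳ n
  firstMoment (suc k) = begin
    n * M₁ (suc k)                  ≡⟨ cong (n *_) step ⟩
    n * (n ^ k * τ + n * M₁ k)      ≡⟨ cong (λ z → n * (n ^ k * τ + z)) (firstMoment k) ⟩
    n * (n ^ k * τ + k * (n ^ k * τ)) ≡⟨ lem n (n ^ k) τ k ⟩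
    suc k * (n * n ^ k * τ)         ∎
    where
    open ≡-Reasoning
    lem : ∀ n p t k → n * (p * t + k * (p * t)) ≡ (1 + k) * (n * p * t)
    lem = solve-∀
    step : M₁ (suc k) ≡ n ^ k * τ + n * M₁ k
    step = trans (∑-vecs xs k _) (trans
      (∑-cong xs λ x → trans (∑-+ (vecs xs k) _ _) (cong (_+ M₁ k) (∑-vecs-const xs k (f x))))
      (trans (∑-+ xs _ _) (cong₂ _+_ (∑-*ˡ xs (n ^ k) f) (∑-const xs (M₁ k)))))

  -- After division by `n ^ k * (n * n)`: the squared mean plus at most 1 for each draw, because all
  -- values of `f` are at most 1.
  secondMoment : ∀ k → n * n * M₂ k ≤ n ^ k * (k * k * (τ * τ) + k * (n * n))
  secondMoment zero    = ≤-reflexive (*-zeroʳ (n * n))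
  secondMoment (suc k) = begin
    n * n * M₂ (suc k)                                ≡⟨ cong (n * n *_) step ⟩
    n * n * (n ^ k * φ + (2 * τ * M₁ k + n * M₂ k))   ≡⟨ lem₁ n (n ^ k) φ τ (M₁ k) (M₂ k) ⟩
    n * n ^ k * (n * φ) + (2 * τ * n * (n * M₁ k) + n * (n * n * M₂ k))
      ≤⟨ +-mono-≤ (*-monoʳ-≤ (n * n ^ k) (*-monoʳ-≤ n (≤-trans φ≤τ τ≤n)))
           (+-mono-≤ (≤-reflexive (cong (2 * τ * n *_) (firstMoment k))) (*-monoʳ-≤ n (secondMoment k))) ⟩
    n * n ^ k * (n * n) + (2 * τ * n * (k * (n ^ k * τ)) + n * (n ^ k * (k * k * (τ * τ) + k * (n * n))))
      -- The added term completes the square k² + 2k + 1.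
      ≤⟨ m≤m+n _ (n * n ^ k * (τ * τ)) ⟩
    n * n ^ k * (n * n) + (2 * τ * n * (k * (n ^ k * τ)) + n * (n ^ k * (k * k * (τ * τ) + k * (n * n))))
      + n * n ^ k * (τ * τ)                           ≡⟨ lem₂ n (n ^ k) τ k ⟩
    n * n ^ k * (suc k * suc k * (τ * τ) + suc k * (n * n)) ∎
    where
    open ≤-Reasoning
    φ = ∑ xs λ x → f x * f x
    φ≤τ : φ ≤ τ
    φ≤τ = ∑-mono xs λ x → ≤-trans (*-monoʳ-≤ (f x) (f≤1 x)) (≤-reflexive (*-identityʳ (f x)))
    lem₁ : ∀ n p φ t a b → n * n * (p * φ + (2 * t * a + n * b)) ≡
           n * p * (n * φ) + (2 * t * n * (n * a) + n * (n * n * b))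
    lem₁ = solve-∀
    lem₂ : ∀ n p t k → n * p * (n * n) + (2 * t * n * (k * (p * t)) + n * (p * (k * k * (t * t) + k * (n * n))))
           + n * p * (t * t) ≡ n * p * ((1 + k) * (1 + k) * (t * t) + (1 + k) * (n * n))
    lem₂ = solve-∀
    square : ∀ a b → (a + b) * (a + b) ≡ a * a + (2 * a * b + b * b)
    square = solve-∀
    inner : ∀ x → ∑ (vecs xs k) (λ v → (f x + E v) * (f x + E v)) ≡
                  n ^ k * (f x * f x) + (2 * f x * M₁ k + M₂ k)
    inner x = trans (∑-cong (vecs xs k) λ v → square (f x) (E v))
      (trans (∑-+ (vecs xs k) _ _) (cong₂ _+_ (∑-vecs-const xs k _)
        (trans (∑-+ (vecs xs k) _ _) (cong (_+ M₂ k) (∑-*ˡ (vecs xs k) (2 * f x) E)))))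
    step : M₂ (suc k) ≡ n ^ k * φ + (2 * τ * M₁ k + n * M₂ k)
    step = trans (∑-vecs xs k _) (trans (∑-cong xs inner) (trans (∑-+ xs _ _)
      (cong₂ _+_ (∑-*ˡ xs (n ^ k) _) (trans (∑-+ xs _ _) (cong₂ _+_
        (trans (∑-*ʳ xs (M₁ k) _) (cong (_* M₁ k) (∑-*ˡ xs 2 f))) (∑-const xs (M₂ k)))))))

  deviation : ∀ {k} → Vec A k → ℕ
  deviation {k} v = ∣ n * E v - k * τ ∣

  -- Expanding the square would need a subtraction; instead the cross term is added to both sides
  -- and cancelled once `firstMoment` has evaluated it.
  variance : ∀ k → ∑ (vecs xs k) (λ v → deviation v * deviation v) ≤ n ^ k * (k * (n * n))
  variance k = +-cancelʳ-≤ (2 * (k * τ) * (n * M₁ k)) _ _ (begin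
    Δ + 2 * (k * τ) * (n * M₁ k)     ≡⟨ expand ⟩
    n * n * M₂ k + n ^ k * (k * τ * (k * τ))
      ≤⟨ +-monoˡ-≤ _ (secondMoment k) ⟩
    n ^ k * (k * k * (τ * τ) + k * (n * n)) + n ^ k * (k * τ * (k * τ))
      ≡⟨ lem (n ^ k) k τ n ⟩
    n ^ k * (k * (n * n)) + 2 * (k * τ) * (k * (n ^ k * τ))
      ≡⟨ cong (λ z → n ^ k * (k * (n * n)) + 2 * (k * τ) * z) (firstMoment k) ⟨
    n ^ k * (k * (n * n)) + 2 * (k * τ) * (n * M₁ k) ∎)
    where
    open ≤-Reasoning
    Δ = ∑ (vecs xs k) λ v → deviation v * deviation v
    lem : ∀ p k t n → p * (k * k * (t * t) + k * (n * n)) + p * (k * t * (k * t)) ≡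
                      p * (k * (n * n)) + 2 * (k * t) * (k * (p * t))
    lem = solve-∀
    lem′ : ∀ a b c → 2 * a * (b * c) ≡ 2 * (b * c * a)
    lem′ = solve-∀
    lem″ : ∀ a c b → a * c * (a * c) + b ≡ a * a * (c * c) + b
    lem″ = solve-∀
    expand : Δ + 2 * (k * τ) * (n * M₁ k) ≡ n * n * M₂ k + n ^ k * (k * τ * (k * τ))
    expand = trans (cong (Δ +_) (trans (sym (*-assoc (2 * (k * τ)) n (M₁ k))) (sym (∑-*ˡ (vecs xs k) (2 * (k * τ) * n) E))))
      (trans (sym (∑-+ (vecs xs k) _ _))
      (trans (∑-cong (vecs xs k) λ v → trans (cong (deviation v * deviation v +_)
          (trans (*-assoc (2 * (k * τ)) n (E v)) (lem′ (k * τ) n (E v)))) (trans (dist² (n * E v) (k * τ)) (lem″ n (E v) _)))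
      (trans (∑-+ (vecs xs k) _ _) (cong₂ _+_ (∑-*ˡ (vecs xs k) (n * n) _) (∑-vecs-const xs k _)))))

  -- Replaces Cauchy-Schwarz by 2cδ ≤ c² + δ², which avoids square roots; the best parameter is c² =
  -- k n².
  averageDeviation : ∀ k c → ∑ (vecs xs k) (λ v → 2 * (c * deviation v)) ≤ n ^ k * (c * c + k * (n * n))
  averageDeviation k c = begin
    ∑ (vecs xs k) (λ v → 2 * (c * deviation v))
      ≤⟨ ∑-mono (vecs xs k) (λ v → 2ab≤a²+b² c (deviation v)) ⟩
    ∑ (vecs xs k) (λ v → c * c + deviation v * deviation v)
      ≡⟨ trans (∑-+ (vecs xs k) _ _) (cong (_+ _) (∑-vecs-const xs k (c * c))) ⟩
    n ^ k * (c * c) + ∑ (vecs xs k) (λ v → deviation v * deviation v)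
      ≤⟨ +-monoʳ-≤ (n ^ k * (c * c)) (variance k) ⟩
    n ^ k * (c * c) + n ^ k * (k * (n * n))
      ≡⟨ *-distribˡ-+ (n ^ k) (c * c) _ ⟨
    n ^ k * (c * c + k * (n * n)) ∎
    where open ≤-Reasoning

  deviant : ℕ → ∀ {k} → Vec A k → Bool
  deviant e {k} v = does (k * n <? e * deviation v)

  -- `deviant e` says that the sampled and the true frequency differ by more than 1/e. The variance
  -- is at most k n² and the threshold is k n / e, which leaves probability e²/k = 1/64.
  chebyshev : ∀ e k .{{_ : NonZero e}} .{{_ : NonZero k}} .{{_ : NonZero n}} → k ≡ 64 * (e * e) →
              64 * ∑ (vecs xs k) (𝟙 ∘ deviant e) ≤ n ^ k
  chebyshev e k {{_}} {{k≢0}} k≡ = *-cancelˡ-≤ (e * e * (k * (n * n))) {{nz}} (begin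
    e * e * (k * (n * n)) * (64 * c)      ≡⟨ lem (e * e) k n c ⟩
    64 * (e * e) * n * (k * n) * c        ≡⟨ cong (λ z → z * n * (k * n) * c) k≡ ⟨
    k * n * (k * n) * c                   ≡⟨ ∑-*ˡ (vecs xs k) (k * n * (k * n)) (𝟙 ∘ deviant e) ⟨
    ∑ (vecs xs k) (λ v → k * n * (k * n) * 𝟙 (deviant e v))   ≤⟨ ∑-mono (vecs xs k) pointwise ⟩
    ∑ (vecs xs k) (λ v → e * e * (deviation v * deviation v)) ≡⟨ ∑-*ˡ (vecs xs k) (e * e) (λ v → deviation v * deviation v) ⟩
    e * e * ∑ (vecs xs k) (λ v → deviation v * deviation v)   ≤⟨ *-monoʳ-≤ (e * e) (variance k) ⟩
    e * e * (n ^ k * (k * (n * n)))       ≡⟨ lem‴ (e * e) (n ^ k) (k * (n * n)) ⟩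
    e * e * (k * (n * n)) * n ^ k ∎)
    where
    open ≤-Reasoning
    c = ∑ (vecs xs k) (𝟙 ∘ deviant e)
    nz : NonZero (e * e * (k * (n * n)))
    nz = m*n≢0 (e * e) (k * (n * n)) {{m*n≢0 e e}}
           {{m*n≢0 k (n * n) {{k≢0}} {{m*n≢0 n n}}}}
    lem : ∀ e² k n c → e² * (k * (n * n)) * (64 * c) ≡ 64 * e² * n * (k * n) * c
    lem = solve-∀
    lem‴ : ∀ a b c → a * (b * c) ≡ a * c * b
    lem‴ = solve-∀
    lem₄ : ∀ e d → e * d * (e * d) ≡ e * e * (d * d)
    lem₄ = solve-∀
    pointwise : ∀ v → k * n * (k * n) * 𝟙 (deviant e v) ≤ e * e * (deviation v * deviation v)
    pointwise v = 𝟙-scale (k * n <? e * deviation v) λ p →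
      ≤-trans (*-mono-≤ (<⇒≤ p) (<⇒≤ p)) (≤-reflexive (lem₄ e (deviation v)))

module _ {A : Set} (xs : List A) (bad : A → Bool) where

  private
    n = length xs
    fails : ∀ {k} → Vec A k → ℕ
    fails v = ∑ (toList v) (𝟙 ∘ bad)

  exponentialMoment : ∀ c k → ∑ (vecs xs k) (λ v → c ^ fails v) ≡ (∑ xs λ x → c ^ 𝟙 (bad x)) ^ k
  exponentialMoment c zero    = refl
  exponentialMoment c (suc k) = trans (∑-vecs xs k _)
    (trans (∑-cong xs λ x → ∑-cong (vecs xs k) λ v → ^-distribˡ-+-* c (𝟙 (bad x)) (fails v))
    (trans (∑-product xs (vecs xs k) _ _) (cong ((∑ xs λ x → c ^ 𝟙 (bad x)) *_) (exponentialMoment c k))))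

  -- Markov's inequality for `8 ^ fails v`: each of the 2b independent draws multiplies the moment
  -- by at most 1 + 7/64 ≤ 2, which gives 4 ^ b against the threshold 8 ^ b.
  majorityBad : 64 * ∑ xs (𝟙 ∘ bad) ≤ n → ∀ b →
                ∑ (vecs xs (b + b)) (λ v → 𝟙 (does (b ≤? fails v))) * 2 ^ b ≤ n ^ (b + b)
  majorityBad few b = *-cancelʳ-≤ _ _ (4 ^ b) {{m^n≢0 4 b}} (begin
    c * 2 ^ b * 4 ^ b            ≡⟨ *-assoc c (2 ^ b) (4 ^ b) ⟩
    c * (2 ^ b * 4 ^ b)          ≡⟨ cong (c *_) (^-distribʳ-* b 2 4) ⟨
    c * 8 ^ b                    ≡⟨ ∑-*ʳ (vecs xs (b + b)) (8 ^ b) _ ⟨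
    ∑ (vecs xs (b + b)) (λ v → 𝟙 (does (b ≤? fails v)) * 8 ^ b) ≤⟨ ∑-mono (vecs xs (b + b)) markov ⟩
    ∑ (vecs xs (b + b)) (λ v → 8 ^ fails v) ≡⟨ exponentialMoment 8 (b + b) ⟩
    (∑ xs λ x → 8 ^ 𝟙 (bad x)) ^ (b + b)    ≤⟨ ^-monoˡ-≤ (b + b) few′ ⟩
    (n * 2) ^ (b + b)            ≡⟨ ^-distribʳ-* (b + b) n 2 ⟩
    n ^ (b + b) * 2 ^ (b + b)    ≡⟨ cong (n ^ (b + b) *_) (trans (^-distribˡ-+-* 2 b b) (sym (^-distribʳ-* b 2 2))) ⟩
    n ^ (b + b) * 4 ^ b          ∎)
    where
    open ≤-Reasoning
    c = ∑ (vecs xs (b + b)) (λ v → 𝟙 (does (b ≤? fails v)))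
    markov : ∀ v → 𝟙 (does (b ≤? fails v)) * 8 ^ b ≤ 8 ^ fails v
    markov v = ≤-trans (≤-reflexive (*-comm _ (8 ^ b))) (𝟙-scale (b ≤? fails v) (^-monoʳ-≤ 8))
    weight : ∀ y → 8 ^ 𝟙 y ≡ 1 + 7 * 𝟙 y
    weight true  = refl
    weight false = refl
    few′ : ∑ xs (λ x → 8 ^ 𝟙 (bad x)) ≤ n * 2
    few′ = begin
      ∑ xs (λ x → 8 ^ 𝟙 (bad x))          ≡⟨ ∑-cong xs (weight ∘ bad) ⟩
      ∑ xs (λ x → 1 + 7 * 𝟙 (bad x))      ≡⟨ ∑-+ xs _ _ ⟩
      ∑ xs (λ _ → 1) + ∑ xs (λ x → 7 * 𝟙 (bad x)) ≡⟨ cong₂ _+_ (∑-const xs 1) (∑-*ˡ xs 7 _) ⟩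
      n * 1 + 7 * ∑ xs (𝟙 ∘ bad)          ≤⟨ +-monoʳ-≤ (n * 1) (≤-trans (*-monoˡ-≤ (∑ xs (𝟙 ∘ bad)) (m≤m+n 7 57)) few) ⟩
      n * 1 + n                           ≡⟨ trans (cong (_+ n) (*-identityʳ n)) (trans (cong (n +_) (sym (+-identityʳ n))) (*-comm 2 n)) ⟩
      n * 2 ∎

-- C₄-free relations: extracting cliques, and sparseness of the rest

∧-intro : ∀ {a b} → a ≡ true → b ≡ true → a ∧ b ≡ true
∧-intro refl refl = refl

∧-fst : ∀ {a b} → a ∧ b ≡ true → a ≡ true
∧-fst {true} _ = refl

∧-snd : ∀ {a b} → a ∧ b ≡ true → b ≡ true
∧-snd {true} p = p

not-true : ∀ {a} → not a ≡ true → a ≡ false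
not-true {false} _ = refl

true-or-false : ∀ a → a ≡ true ⊎ a ≡ false
true-or-false true  = inj₁ refl
true-or-false false = inj₂ refl

¬¬-em : {P : Set} → ¬ ¬ (P ⊎ ¬ P)
¬¬-em k = k (inj₂ λ p → k (inj₁ p))

length-allFin : ∀ n → length (allFin n) ≡ n
length-allFin n = List.length-tabulate id

∑-allFin-suc : ∀ {k} (f : Fin (suc k) → ℕ) → ∑ (allFin (suc k)) f ≡ f zero + ∑ (allFin k) (f ∘ suc)
∑-allFin-suc f = cong (f zero +_) (trans (cong (λ l → ∑ l f) (sym (List.map-tabulate id suc))) (∑-map suc (allFin _) f))

∑-δ : ∀ {k} (i : Fin k) → ∑ (allFin k) (λ j → 𝟙 (does (j Fin.≟ i))) ≡ 1
∑-δ {suc k} zero    = trans (∑-allFin-suc {k} (λ j → 𝟙 (does (j Fin.≟ zero)))) (cong suc (∑-zero (allFin k) λ _ → refl))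
∑-δ {suc k} (suc i) = trans (∑-allFin-suc {k} (λ j → 𝟙 (does (j Fin.≟ suc i)))) (∑-δ i)

-- A family with m ≥ 1 true entries has m(m − 1) ≥ m − 1 ordered pairs of them.
∑𝟙≤1+pairs : ∀ {k} (χ : Fin k → Bool) → ∑ (allFin k) (𝟙 ∘ χ) ≤
  1 + ∑ (allFin k) λ i → ∑ (allFin k) λ j → 𝟙 (not (does (j Fin.≟ i)) ∧ (χ i ∧ χ j))
∑𝟙≤1+pairs {k} χ with Fin.any? (λ i → χ i Data.Bool.≟ true)
... | no ∄ = ≤-trans (≤-reflexive (∑-zero (allFin k) λ i → none i (χ i) refl)) z≤n
  where
  none : ∀ i b → χ i ≡ b → 𝟙 b ≡ 0
  none i true  eq = ⊥-elim (∄ (i , eq))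
  none i false eq = refl
... | yes (i , χi) = begin
  ∑ (allFin k) (𝟙 ∘ χ)                             ≤⟨ ∑-mono (allFin k) pointwise ⟩
  ∑ (allFin k) (λ j → 𝟙 (does (j Fin.≟ i)) + 𝟙 (not (does (j Fin.≟ i)) ∧ (χ i ∧ χ j))) ≡⟨ ∑-+ (allFin k) _ _ ⟩
  ∑ (allFin k) (λ j → 𝟙 (does (j Fin.≟ i))) + row i ≡⟨ cong (_+ row i) (∑-δ i) ⟩
  1 + row i                                        ≤⟨ +-monoʳ-≤ 1 (∑-∈ row (∈.∈-allFin i)) ⟩
  1 + ∑ (allFin k) row                             ∎
  where
  open ≤-Reasoning
  row : Fin k → ℕ
  row i = ∑ (allFin k) λ j → 𝟙 (not (does (j Fin.≟ i)) ∧ (χ i ∧ χ j))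
  pointwise : ∀ j → 𝟙 (χ j) ≤ 𝟙 (does (j Fin.≟ i)) + 𝟙 (not (does (j Fin.≟ i)) ∧ (χ i ∧ χ j))
  pointwise j rewrite χi with does (j Fin.≟ i)
  ... | true  = ≤-trans (𝟙≤1 (χ j)) (m≤m+n 1 _)
  ... | false = ≤-refl

module _ {A : Set} (xs : List A) where

  # : (A → Bool) → ℕ
  # p = ∑ xs (𝟙 ∘ p)

  #-mono : ∀ {p q : A → Bool} → (∀ v → p v ≡ true → q v ≡ true) → # p ≤ # q
  #-mono h = ∑-mono xs λ v → 𝟙-mono (h v)

  #-union : ∀ {I : Set} (is : List I) (p : A → Bool) (q : I → A → Bool) →
            (∀ v → p v ≡ true → ∃ λ i → i ∈ is × q i v ≡ true) → # p ≤ ∑ is (λ i → # (q i))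
  #-union is p q h = ≤-trans (∑-mono xs λ v → 𝟙-≤ (p v) λ pv → let i , i∈ , qv = h v pv in
      ≤-trans (≤-reflexive (sym (𝟙≡1 qv))) (∑-∈ (λ i → 𝟙 (q i v)) i∈))
    (≤-reflexive (∑-swap xs is _))

  #-∪ : ∀ (p q r : A → Bool) → (∀ v → p v ≡ true → q v ≡ true ⊎ r v ≡ true) → # p ≤ # q + # r
  #-∪ p q r h = ≤-trans (∑-mono xs λ v → 𝟙-≤ (p v) λ pv → lem (h v pv)) (≤-reflexive (∑-+ xs _ _))
    where
    lem : ∀ {a b} → a ≡ true ⊎ b ≡ true → 1 ≤ 𝟙 a + 𝟙 b
    lem (inj₁ refl) = s≤s z≤n
    lem {a} (inj₂ refl) = m≤n+m 1 (𝟙 a)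

  #-disjoint : ∀ (p q r : A → Bool) → (∀ v → p v ≡ true → r v ≡ true) → (∀ v → q v ≡ true → r v ≡ true) →
               (∀ v → p v ≡ true → q v ≡ true → ⊥) → # p + # q ≤ # r
  #-disjoint p q r pr qr pq = ≤-trans (≤-reflexive (sym (∑-+ xs _ _)))
      (∑-mono xs λ v → lem (pr v) (qr v) (pq v))
    where
    lem : ∀ {a b c} → (a ≡ true → c ≡ true) → (b ≡ true → c ≡ true) → (a ≡ true → b ≡ true → ⊥) →
          𝟙 a + 𝟙 b ≤ 𝟙 c
    lem {true}  {true}         f g h = ⊥-elim (h refl refl)
    lem {true}  {false} {true} f g h = ≤-refl
    lem {true}  {false} {false} f g h with () ← f refl
    lem {false} f g h = 𝟙-mono g

  #≤length : ∀ p → # p ≤ length xs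
  #≤length p = subst (# p ≤_) (*-identityʳ _) (∑-≤const xs 1 (𝟙≤1 ∘ p))

-- No distinctness is asked for: when `E` is reflexive and symmetric, degenerate squares satisfy the
-- conclusion anyway. So the property can be pulled back along any map, injective or not.
NoC4 : {A : Set} → (A → A → Bool) → Set
NoC4 E = ∀ a b c d → E a b ≡ true → E b c ≡ true → E c d ≡ true → E d a ≡ true →
         E a c ≡ true ⊎ E b d ≡ true

module Cliques {n} {{n≢0 : NonZero n}} (E : Fin n → Fin n → Bool)
  (E-sym : ∀ u v → E u v ≡ E v u) (E-refl : ∀ v → E v v ≡ true) (noC4 : NoC4 E) where

  V : List (Fin n)
  V = allFin n

  IsClique : (Fin n → Bool) → Set
  IsClique p = ∀ u v → p u ≡ true → p v ≡ true → E u v ≡ true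

  common-clique : ∀ x y {p : Fin n → Bool} → E x y ≡ false →
    (∀ v → p v ≡ true → E x v ≡ true × E y v ≡ true) → IsClique p
  common-clique x y xy h u v pu pv with h u pu | h v pv
  ... | xu , yu | xv , yv with noC4 x u y v xu (trans (E-sym u y) yu) yv (trans (E-sym v x) xv)
  ...   | inj₁ e = contradiction (trans (sym xy) e) false≢true
  ...   | inj₂ e = e

  module _ (Q : ℕ) where

    SmallCliques : (Fin n → Bool) → Set
    SmallCliques Y = ∀ p → (∀ v → p v ≡ true → Y v ≡ true) → IsClique p → Q * # V p ≤ n

    IsRest : Maybe (Fin Q) → Bool
    IsRest (just _) = false
    IsRest nothing  = true

    Proper : (Fin n → Maybe (Fin Q)) → Set
    Proper κ = ∀ u v c → κ u ≡ just c → κ v ≡ just c → E u v ≡ true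

    -- Every extracted clique takes at least n/Q new vertices, so the `Q` colours last until no
    -- large clique is left. In `go`, `j` colours are in use and `k` are still fresh.
    extractCliques : ¬ ¬ (∃ λ κ → Proper κ × SmallCliques (IsRest ∘ κ))
    extractCliques = go Q 0 (+-identityʳ Q) (λ _ → nothing) (λ u v c ()) (λ v c ()) z≤n
      where
      covered : (Fin n → Maybe (Fin Q)) → Fin n → Bool
      covered κ v = not (IsRest (κ v))

      go : ∀ k j → k + j ≡ Q → (κ : Fin n → Maybe (Fin Q)) → Proper κ →
           (∀ v c → κ v ≡ just c → toℕ c < j) → j * n ≤ Q * # V (covered κ) →
           ¬ ¬ (∃ λ κ → Proper κ × SmallCliques (IsRest ∘ κ))
      go k j k+j κ proper fresh big done = ¬¬-em λ
        { (inj₂ ∄) → done (κ , proper , λ p p⊆ cl → case Q * # V p ≤? n of λ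
            { (yes q) → q ; (no q) → ⊥-elim (∄ (p , p⊆ , cl , <⇒≤ (≰⇒> q))) })
        ; (inj₁ (p , p⊆ , cl , large)) → extend k k+j p p⊆ cl large }
        where
        open ≤-Reasoning
        extend : ∀ k → k + j ≡ Q → ∀ p → (∀ v → p v ≡ true → IsRest (κ v) ≡ true) → IsClique p →
                 n ≤ Q * # V p → ⊥
        -- All `Q` colours are in use, so the covered part already has `n` vertices, and one more
        -- nonempty clique does not fit.
        extend zero refl p p⊆ cl large = <-irrefl refl (begin-strict
          Q * n                                ≤⟨ big ⟩
          Q * # V (covered κ)                  <⟨ m<m+n _ (≤-trans (>-nonZero⁻¹ n) large) ⟩
          Q * # V (covered κ) + Q * # V p      ≡⟨ *-distribˡ-+ Q _ _ ⟨
          Q * (# V (covered κ) + # V p)        ≤⟨ *-monoʳ-≤ Q (#-disjoint V (covered κ) p (λ _ → true)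
                                                    (λ _ _ → refl) (λ _ _ → refl) disjoint) ⟩
          Q * # V (λ _ → true)                 ≤⟨ *-monoʳ-≤ Q (≤-trans (#≤length V _) (≤-reflexive (length-allFin n))) ⟩
          Q * n                                ∎)
          where
          disjoint : ∀ v → covered κ v ≡ true → p v ≡ true → ⊥
          disjoint v a b = contradiction (trans (sym (not-true a)) (p⊆ v b)) false≢true
        extend (suc k) k+j p p⊆ cl large = go k (suc j) (trans (+-suc k j) k+j) κ′ proper′ fresh′ big′ done
          where
          j<Q : j < Q
          j<Q = subst (j <_) k+j (s≤s (m≤n+m j k))
          new : Fin Q
          new = fromℕ< j<Q
          κ′ : Fin n → Maybe (Fin Q)
          κ′ v = if p v then just new else κ v
          cases : ∀ v c → κ′ v ≡ just c → (p v ≡ true × c ≡ new) ⊎ κ v ≡ just c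
          cases v c eq with p v
          cases v c refl | true  = inj₁ (refl , refl)
          cases v c eq   | false = inj₂ eq
          old≢new : ∀ v c → κ v ≡ just c → c ≢ new
          old≢new v c eq refl = <-irrefl (Fin.toℕ-fromℕ< j<Q) (fresh v c eq)
          proper′ : Proper κ′
          proper′ u v c eu ev with cases u c eu | cases v c ev
          ... | inj₁ (pu , _) | inj₁ (pv , _) = cl u v pu pv
          ... | inj₁ (_ , c≡) | inj₂ kv = ⊥-elim (old≢new v c kv c≡)
          ... | inj₂ ku | inj₁ (_ , c≡) = ⊥-elim (old≢new u c ku c≡)
          ... | inj₂ ku | inj₂ kv = proper u v c ku kv
          fresh′ : ∀ v c → κ′ v ≡ just c → toℕ c < suc j
          fresh′ v c eq with cases v c eq
          ... | inj₁ (_ , refl) = s≤s (≤-reflexive (Fin.toℕ-fromℕ< j<Q))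
          ... | inj₂ kv = m≤n⇒m≤1+n (fresh v c kv)
          old⊆ : ∀ v → covered κ v ≡ true → covered κ′ v ≡ true
          old⊆ v e with p v
          ... | true  = refl
          ... | false = e
          p⊆′ : ∀ v → p v ≡ true → covered κ′ v ≡ true
          p⊆′ v e rewrite e = refl
          disjoint : ∀ v → covered κ v ≡ true → p v ≡ true → ⊥
          disjoint v a b = contradiction (trans (sym (not-true a)) (p⊆ v b)) false≢true
          big′ : n + j * n ≤ Q * # V (covered κ′)
          big′ = begin
            n + j * n                            ≤⟨ +-mono-≤ large big ⟩
            Q * # V p + Q * # V (covered κ)      ≡⟨ *-distribˡ-+ Q _ _ ⟨
            Q * (# V p + # V (covered κ))        ≤⟨ *-monoʳ-≤ Q (#-disjoint V p (covered κ) (covered κ′)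
                                                      p⊆′ old⊆ λ v a b → disjoint v b a) ⟩
            Q * # V (covered κ′)                 ∎

module Sparse {n} {{n≢0 : NonZero n}} (E : Fin n → Fin n → Bool)
  (E-sym : ∀ u v → E u v ≡ E v u) (E-refl : ∀ v → E v v ≡ true) (noC4 : NoC4 E)
  (D Q : ℕ) (Q≡D³ : Q ≡ D * D * D) (5≤D : 5 ≤ D) (Y : Fin n → Bool)
  (small : Cliques.SmallCliques E E-sym E-refl noC4 Q Y) where

  open Cliques E E-sym E-refl noC4
  open ≤-Reasoning

  private instance
    D≢0 : NonZero D
    D≢0 = >-nonZero (≤-trans (s≤s z≤n) 5≤D)

  deg : Fin n → ℕ
  deg v = # V (λ w → Y w ∧ E v w)

  High : Fin n → Bool
  High v = Y v ∧ does (n ≤? D * deg v)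

  Independent : ∀ {k} → (Fin k → Fin n) → Set
  Independent S = (∀ i → High (S i) ≡ true) × (∀ i j → i ≢ j → E (S i) (S j) ≡ false)

  -- Inclusion–exclusion: the neighbourhoods of the members overlap in cliques only, which are small.
  independent-bounded : (S : Fin (D + D) → Fin n) → ¬ Independent S
  -- The 2D degrees sum to at least 2n, the union has at most n vertices, and each of the (2D)²
  -- overlaps has at most n/D³. Hence 2D ≤ D + 4, against `5 ≤ D`.
  independent-bounded S (high , indep) = <-irrefl refl (≤-trans 5≤D (+-cancelˡ-≤ D D 4
    (*-cancelˡ-≤ (D * D * D * n) {{m*n≢0 (D * D * D) n {{m*n≢0 (D * D) D {{m*n≢0 D D}}}}}} (begin
      D * D * D * n * (D + D)                       ≡⟨ lem₁ (D * D * D) n (D + D) ⟩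
      D * D * D * ((D + D) * n)                     ≡⟨ cong (_* ((D + D) * n)) Q≡D³ ⟨
      Q * ((D + D) * n)                             ≤⟨ *-monoʳ-≤ Q lower ⟩
      Q * (D * ∑ K (deg ∘ S))                       ≤⟨ *-monoʳ-≤ Q (*-monoʳ-≤ D overlaps) ⟩
      Q * (D * (n + ∑ K λ i → ∑ K (codeg i)))       ≡⟨ lem₂ Q D n _ ⟩
      D * (Q * n + Q * (∑ K λ i → ∑ K (codeg i)))   ≤⟨ *-monoʳ-≤ D (+-monoʳ-≤ (Q * n) total) ⟩
      D * (Q * n + (D + D) * ((D + D) * n))         ≡⟨ cong (λ q → D * (q * n + (D + D) * ((D + D) * n))) Q≡D³ ⟩
      D * (D * D * D * n + (D + D) * ((D + D) * n)) ≡⟨ lem₃ D n ⟩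
      D * D * D * n * (D + 4)                       ∎))))
    where
    K = allFin (D + D)
    codeg : Fin (D + D) → Fin (D + D) → ℕ
    codeg i j = # V (λ v → not (does (j Fin.≟ i)) ∧ ((Y v ∧ E (S i) v) ∧ (Y v ∧ E (S j) v)))
    lem₁ : ∀ a n b → a * n * b ≡ a * (b * n)
    lem₁ = solve-∀
    lem₂ : ∀ q d n x → q * (d * (n + x)) ≡ d * (q * n + q * x)
    lem₂ = solve-∀
    lem₃ : ∀ d n → d * (d * d * d * n + (d + d) * ((d + d) * n)) ≡ d * d * d * n * (d + 4)
    lem₃ = solve-∀
    lower : (D + D) * n ≤ D * ∑ K (deg ∘ S)
    lower = begin
      (D + D) * n             ≡⟨ cong (_* n) (length-allFin (D + D)) ⟨
      length K * n            ≡⟨ ∑-const K n ⟨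
      ∑ K (λ _ → n)           ≤⟨ ∑-mono K (λ i → does⇒ (n ≤? D * deg (S i)) (∧-snd {Y (S i)} (high i))) ⟩
      ∑ K (λ i → D * deg (S i)) ≡⟨ ∑-*ˡ K D _ ⟩
      D * ∑ K (deg ∘ S)       ∎
    overlaps : ∑ K (deg ∘ S) ≤ n + ∑ K λ i → ∑ K (codeg i)
    overlaps = begin
      ∑ K (deg ∘ S)           ≡⟨ ∑-swap K V _ ⟩
      ∑ V (λ v → ∑ K λ i → 𝟙 (Y v ∧ E (S i) v)) ≤⟨ ∑-mono V (λ v → ∑𝟙≤1+pairs λ i → Y v ∧ E (S i) v) ⟩
      ∑ V (λ v → 1 + _)       ≡⟨ ∑-+ V (λ _ → 1) _ ⟩
      ∑ V (λ _ → 1) + _       ≡⟨ cong₂ _+_ (trans (sym (length≡∑ V)) (length-allFin n))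
                                   (trans (∑-swap V K _) (∑-cong K λ i → ∑-swap V K _)) ⟩
      n + ∑ K (λ i → ∑ K (codeg i)) ∎
    codeg-small : ∀ i j → Q * codeg i j ≤ n
    codeg-small i j with j Fin.≟ i
    ... | yes _ = ≤-trans (≤-reflexive (trans (cong (Q *_) (∑-zero V λ _ → refl)) (*-zeroʳ Q))) z≤n
    ... | no j≢i = small _ (λ v e → ∧-fst (∧-fst {Y v ∧ E (S i) v} e))
        (common-clique (S i) (S j) (indep i j (j≢i ∘ sym)) λ v e →
          ∧-snd {Y v} (∧-fst {Y v ∧ E (S i) v} e) , ∧-snd {Y v} (∧-snd {Y v ∧ E (S i) v} e))
    total : Q * (∑ K λ i → ∑ K (codeg i)) ≤ (D + D) * ((D + D) * n)
    total = begin
      Q * (∑ K λ i → ∑ K (codeg i))           ≡⟨ ∑-*ˡ K Q _ ⟨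
      ∑ K (λ i → Q * ∑ K (codeg i))           ≡⟨ ∑-cong K (λ i → sym (∑-*ˡ K Q _)) ⟩
      ∑ K (λ i → ∑ K λ j → Q * codeg i j)     ≤⟨ ∑-≤const K _ (λ i → ∑-≤const K n (codeg-small i)) ⟩
      length K * (length K * n)               ≡⟨ cong (λ l → l * (l * n)) (length-allFin (D + D)) ⟩
      (D + D) * ((D + D) * n)                 ∎

  -- Largest possible size, not maximality under inclusion: the exchange of one member for two other
  -- vertices has to be excluded.
  Maximal : ∀ {k} → (Fin k → Fin n) → Set
  Maximal {k} S = Independent S × (∀ (S′ : Fin (suc k) → Fin n) → ¬ Independent S′)

  maximal-exists : ∀ k → (∀ (S : Fin k → Fin n) → ¬ Independent S) →
                   ¬ ¬ (∃ λ j → j < k × Σ (Fin j → Fin n) Maximal)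
  maximal-exists zero    none done = none (λ ()) ((λ ()) , λ ())
  maximal-exists (suc k) none done = ¬¬-em {∃ λ (S : Fin k → Fin n) → Independent S} λ
    { (inj₁ (S , ind)) → done (k , ≤-refl , S , ind , none)
    ; (inj₂ ∄) → maximal-exists k (λ S ind → ∄ (S , ind))
                   λ (j , j<k , max) → done (j , m≤n⇒m≤1+n j<k , max) }

  -- The vertices seen by exactly one member i form a clique: two non-adjacent ones could replace i.
  maximal-covers : ∀ {k} (S : Fin k → Fin n) → Maximal S → Q * # V High ≤ (k + k * k) * n
  maximal-covers {k} S ((high , indep) , max) = begin
    Q * # V High                   ≤⟨ *-monoʳ-≤ Q (#-union V is High q covered) ⟩
    Q * ∑ is (λ i → # V (q i))     ≡⟨ ∑-*ˡ is Q _ ⟨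
    ∑ is (λ i → Q * # V (q i))     ≤⟨ ∑-≤const is n q-small ⟩
    length is * n                  ≡⟨ cong (_* n) length-is ⟩
    (k + k * k) * n                ∎
    where
    other : ∀ i v → Dec (∃ λ j → j ≢ i × E (S j) v ≡ true)
    other i v = Fin.any? λ j → ¬? (j Fin.≟ i) ×-dec (E (S j) v Data.Bool.≟ true)
    is : List (Fin k ⊎ (Fin k × Fin k))
    is = map inj₁ (allFin k) ++ map inj₂ (pairs (allFin k) (allFin k))
    q : Fin k ⊎ (Fin k × Fin k) → Fin n → Bool
    q (inj₁ i)       v = High v ∧ (E (S i) v ∧ not (does (other i v)))
    q (inj₂ (i , j)) v = High v ∧ (not (does (j Fin.≟ i)) ∧ (E (S i) v ∧ E (S j) v))
    length-is : length is ≡ k + k * k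
    length-is = trans (List.length-++ (map inj₁ (allFin k)))
      (cong₂ _+_ (trans (List.length-map inj₁ (allFin k)) (length-allFin k))
        (trans (List.length-map inj₂ (pairs (allFin k) (allFin k)))
          (trans (length-pairs (allFin k) (allFin k)) (cong₂ _*_ (length-allFin k) (length-allFin k)))))
    High⇒Y : ∀ {v} b → High v ∧ b ≡ true → Y v ≡ true
    High⇒Y {v} b e = ∧-fst (∧-fst {High v} e)

    add : Fin n → (Fin k → Fin n) → Fin (suc k) → Fin n
    add v S zero    = v
    add v S (suc i) = S i
    add-independent : ∀ v S → High v ≡ true → (∀ i → E v (S i) ≡ false) → Independent S → Independent (add v S)
    add-independent v S hv vS (hS , indS) = (λ { zero → hv ; (suc i) → hS i }) , λ
      { zero zero ne → ⊥-elim (ne refl)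
      ; zero (suc j) _ → vS j
      ; (suc i) zero _ → trans (E-sym (S i) v) (vS i)
      ; (suc i) (suc j) ne → indS i j (ne ∘ cong suc) }

    none-other : ∀ i v → not (does (other i v)) ≡ true → ∀ j → j ≢ i → E (S j) v ≡ false
    none-other i v e j j≢i with true-or-false (E (S j) v)
    ... | inj₂ f = f
    ... | inj₁ t = ⊥-elim (does-false (other i v) (not-true e) (j , j≢i , t))

    q-small : ∀ i → Q * # V (q i) ≤ n
    q-small (inj₂ (i , j)) with j Fin.≟ i
    ... | yes _ = ≤-trans (≤-reflexive (trans (cong (Q *_) (∑-zero V λ v → cong 𝟙 (lem (High v)))) (*-zeroʳ Q))) z≤n
      where
      lem : ∀ b → b ∧ false ≡ false
      lem true  = refl
      lem false = refl
    ... | no j≢i = small _ (λ v → High⇒Y _) (common-clique (S i) (S j) (indep i j (j≢i ∘ sym)) λ v e →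
          ∧-fst (∧-snd {High v} e) , ∧-snd {E (S i) v} (∧-snd {High v} e))
    q-small (inj₁ i) = small _ (λ v → High⇒Y _) clique
      where
      clique : IsClique (q (inj₁ i))
      clique u v qu qv with true-or-false (E u v)
      ... | inj₁ t = t
      ... | inj₂ uv = ⊥-elim (max (add v S′) (add-independent v S′ (∧-fst qv) vS′ (highS′ , indepS′)))
        where
        S′ : Fin k → Fin n
        S′ j = if does (j Fin.≟ i) then u else S j
        far : ∀ w → q (inj₁ i) w ≡ true → ∀ j → j ≢ i → E (S j) w ≡ false
        far w e = none-other i w (∧-snd {E (S i) w} (∧-snd {High w} e))
        highS′ : ∀ j → High (S′ j) ≡ true
        highS′ j with j Fin.≟ i
        ... | yes _ = ∧-fst qu
        ... | no  _ = high j
        vS′ : ∀ j → E v (S′ j) ≡ false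
        vS′ j with j Fin.≟ i
        ... | yes _ = trans (E-sym v u) uv
        ... | no j≢i = trans (E-sym v (S j)) (far v qv j j≢i)
        indepS′ : ∀ j l → j ≢ l → E (S′ j) (S′ l) ≡ false
        indepS′ j l j≢l with j Fin.≟ i | l Fin.≟ i
        ... | yes refl | yes refl = ⊥-elim (j≢l refl)
        ... | yes _    | no l≢i   = trans (E-sym u (S l)) (far u qu l l≢i)
        ... | no j≢i   | yes _    = far u qu j j≢i
        ... | no _     | no _     = indep j l j≢l

    covered : ∀ v → High v ≡ true → ∃ λ i → i ∈ is × q i v ≡ true
    covered v hv with Fin.any? (λ i → E (S i) v Data.Bool.≟ true)
    ... | no ∄ = ⊥-elim (max (add v S) (add-independent v S hv (λ i → nonadjacent i (true-or-false (E (S i) v))) (high , indep)))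
      where
      nonadjacent : ∀ i → E (S i) v ≡ true ⊎ E (S i) v ≡ false → E v (S i) ≡ false
      nonadjacent i (inj₁ t) = ⊥-elim (∄ (i , t))
      nonadjacent i (inj₂ f) = trans (E-sym v (S i)) f
    ... | yes (i , iv) = pick (other i v) refl
      where
      pick : (d : Dec (∃ λ j → j ≢ i × E (S j) v ≡ true)) → d ≡ other i v → ∃ λ i → i ∈ is × q i v ≡ true
      pick (no ¬o) eq = inj₁ i , ∈.∈-++⁺ˡ (∈.∈-map⁺ inj₁ (∈.∈-allFin i)) ,
        ∧-intro hv (∧-intro iv (cong not (dec-false (other i v) ¬o)))
      pick (yes (j , j≢i , jv)) eq = inj₂ (i , j) ,
        ∈.∈-++⁺ʳ (map inj₁ (allFin k)) (∈.∈-map⁺ inj₂ (∈-pairs (∈.∈-allFin i) (∈.∈-allFin j))) ,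
        ∧-intro hv (∧-intro (cong not (dec-false (j Fin.≟ i) j≢i)) (∧-intro iv jv))

  -- A largest independent family has fewer than 2D members, so at most 2D + (2D)² ≤ 8D² cliques
  -- cover the high vertices, each of size at most n/D³.
  high-few : D * # V High ≤ 8 * n
  high-few = decidable-stable (D * # V High ≤? 8 * n) λ ¬few →
    maximal-exists (D + D) independent-bounded λ (j , j<2D , S , max) → ¬few
      (*-cancelˡ-≤ (D * D) {{m*n≢0 D D}} (begin
        D * D * (D * # V High)        ≡⟨ *-assoc (D * D) D _ ⟨
        D * D * D * # V High          ≡⟨ cong (_* # V High) Q≡D³ ⟨
        Q * # V High                  ≤⟨ maximal-covers S max ⟩
        (j + j * j) * n               ≤⟨ *-monoˡ-≤ n (+-mono-≤ (≤-trans (<⇒≤ j<2D) (m≤m*m (D + D)))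
                                           (*-mono-≤ (<⇒≤ j<2D) (<⇒≤ j<2D))) ⟩
        ((D + D) * (D + D) + (D + D) * (D + D)) * n ≡⟨ lem D n ⟩
        D * D * (8 * n)               ∎))
    where
    lem : ∀ d n → ((d + d) * (d + d) + (d + d) * (d + d)) * n ≡ d * d * (8 * n)
    lem = solve-∀

  -- Low vertices contribute less than n/D each; the at most 8n/D high ones contribute at most n
  -- each.
  sparse : D * ∑ V (λ u → ∑ V λ v → 𝟙 (Y u ∧ (Y v ∧ E u v))) ≤ 9 * (n * n)
  sparse = begin
    D * ∑ V (λ u → ∑ V λ v → 𝟙 (Y u ∧ (Y v ∧ E u v)))  ≡⟨ ∑-*ˡ V D _ ⟨
    ∑ V (λ u → D * ∑ V λ v → 𝟙 (Y u ∧ (Y v ∧ E u v)))  ≤⟨ ∑-mono V row ⟩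
    ∑ V (λ u → n + D * n * 𝟙 (High u))                 ≡⟨ trans (∑-+ V _ _) (cong₂ _+_ (∑-const V n) (∑-*ˡ V (D * n) _)) ⟩
    length V * n + D * n * # V High                    ≡⟨ cong₂ _+_ (cong (_* n) (length-allFin n)) (lem D n (# V High)) ⟩
    n * n + n * (D * # V High)                         ≤⟨ +-monoʳ-≤ (n * n) (*-monoʳ-≤ n high-few) ⟩
    n * n + n * (8 * n)                                ≡⟨ lem′ n ⟩
    9 * (n * n) ∎
    where
    lem : ∀ d n h → d * n * h ≡ n * (d * h)
    lem = solve-∀
    lem′ : ∀ n → n * n + n * (8 * n) ≡ 9 * (n * n)
    lem′ = solve-∀
    row : ∀ u → D * ∑ V (λ v → 𝟙 (Y u ∧ (Y v ∧ E u v))) ≤ n + D * n * 𝟙 (High u)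
    row u with true-or-false (Y u) | n ≤? D * deg u
    ... | inj₂ f | _ rewrite f = ≤-trans (≤-reflexive (trans (cong (D *_) (∑-zero V λ _ → refl)) (*-zeroʳ D))) z≤n
    ... | inj₁ t | no low rewrite t = ≤-trans (<⇒≤ (≰⇒> low)) (m≤m+n n _)
    ... | inj₁ t | yes p = ≤-trans (*-monoʳ-≤ D (≤-trans (#≤length V _) (≤-reflexive (length-allFin n))))
            (≤-trans (≤-reflexive (sym (trans (cong (D * n *_) (𝟙≡1 (∧-intro t (dec-true (n ≤? D * deg u) p)))) (*-identityʳ (D * n)))))
              (m≤n+m _ n))

-- Nested neighbourhoods between two cliques

m<n*[1+m/n] : ∀ m n .{{_ : NonZero n}} → m < n * suc (m / n)
m<n*[1+m/n] m n = subst₂ _<_ (sym (m≡m%n+[m/n]*n m n)) (*-comm (suc (m / n)) n) (+-monoˡ-< _ (m%n<n m n))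

#-witness : ∀ {A : Set} (xs : List A) (p : A → Bool) {c} → (∀ x → p x ≡ true → # xs p ≤ c) → # xs p ≤ c
#-witness xs p h with any? (λ x → p x Data.Bool.≟ true) xs
... | yes a = let x , _ , px = find a in h x px
... | no ∄ = ≤-trans (≤-reflexive (zeroes xs ∄)) z≤n
  where
  zeroes : ∀ xs → ¬ Any (λ x → p x ≡ true) xs → # xs p ≡ 0
  zeroes []       _  = refl
  zeroes (x ∷ xs) ∄ with true-or-false (p x)
  ... | inj₁ t = ⊥-elim (∄ (here t))
  ... | inj₂ f rewrite f = zeroes xs (∄ ∘ there)

#-unique : ∀ {n} (p : Fin n → Bool) → (∀ u v → p u ≡ true → p v ≡ true → u ≡ v) → # (allFin n) p ≤ 1
#-unique {n} p h = #-witness (allFin n) p λ u pu →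
  ≤-trans (∑-mono (allFin n) λ v → 𝟙-mono λ pv → dec-true (v Fin.≟ u) (h v u pv pu)) (≤-reflexive (∑-δ u))

#-bucket : ∀ {n} (p : Fin n → Bool) (f : Fin n → ℕ) s .{{_ : NonZero s}} b →
           (∀ u v → p u ≡ true → p v ≡ true → f u ≡ f v → u ≡ v) →
           # (allFin n) (λ v → p v ∧ does (f v / s ≟ b)) ≤ s
#-bucket {n} p f s b inj = ≤-trans
  (#-union (allFin n) (allFin s) _ (λ r v → p v ∧ does (f v ≟ b * s + toℕ r)) residue)
  (≤-trans (∑-≤const (allFin s) 1 λ r → #-unique _ λ u v pu pv → inj u v (∧-fst pu) (∧-fst pv)
      (trans (does⇒ (f u ≟ _) (∧-snd {p u} pu)) (sym (does⇒ (f v ≟ _) (∧-snd {p v} pv)))))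
    (≤-reflexive (trans (*-identityʳ _) (length-allFin s))))
  where
  residue : ∀ v → p v ∧ does (f v / s ≟ b) ≡ true →
            ∃ λ r → r ∈ allFin s × p v ∧ does (f v ≟ b * s + toℕ r) ≡ true
  residue v e = fromℕ< r<s , ∈.∈-allFin _ , ∧-intro (∧-fst e) (dec-true (f v ≟ _) (begin
      f v                         ≡⟨ m≡m%n+[m/n]*n (f v) s ⟩
      f v % s + f v / s * s       ≡⟨ +-comm (f v % s) _ ⟩
      f v / s * s + f v % s       ≡⟨ cong₂ (λ x y → x * s + y) (does⇒ (f v / s ≟ b) (∧-snd {p v} e)) (sym (Fin.toℕ-fromℕ< r<s)) ⟩
      b * s + toℕ (fromℕ< r<s)    ∎))
    where
    open ≡-Reasoning
    r<s : f v % s < s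
    r<s = m%n<n (f v) s

module Pieces {n} {{n≢0 : NonZero n}} (E : Fin n → Fin n → Bool)
  (E-sym : ∀ u v → E u v ≡ E v u) (E-refl : ∀ v → E v v ≡ true) (noC4 : NoC4 E)
  (Q m : ℕ) {{m≢0 : NonZero m}} (κ : Fin n → Maybe (Fin Q))
  (proper : Cliques.Proper E E-sym E-refl noC4 Q κ) where

  open Cliques E E-sym E-refl noC4 hiding (Proper)

  infix 4 _≟κ_
  _≟κ_ : (c d : Maybe (Fin Q)) → Dec (c ≡ d)
  _≟κ_ = Maybe.≡-dec Fin._≟_

  inClass : Fin Q → Fin n → Bool
  inClass i v = does (κ v ≟κ just i)

  -- `key j` orders vertices by degree into clique `j`, with the index breaking ties. `rank j` is
  -- the position in this order within the vertex's own clique, and `bucket j` cuts the clique into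
  -- at most `m` layers of at most `s` consecutive ranks.
  deg key rank bucket : Fin Q → Fin n → ℕ
  deg j v    = # V (λ w → inClass j w ∧ E v w)
  key j v    = deg j v * n + toℕ v
  rank j v   = # V (λ w → does (κ w ≟κ κ v) ∧ does (key j w <? key j v))

  s : ℕ
  s = suc (n / m)

  bucket j v = rank j v / s

  rank≤n : ∀ j v → rank j v ≤ n
  rank≤n j v = ≤-trans (#≤length V _) (≤-reflexive (length-allFin n))

  n<ms : n < m * s
  n<ms = m<n*[1+m/n] n m

  bucket<m : ∀ j v → bucket j v < m
  bucket<m j v = m<n*o⇒m/o<n (≤-<-trans (rank≤n j v) n<ms)

  key-injective : ∀ j u v → key j u ≡ key j v → u ≡ v
  key-injective j u v e = Fin.toℕ-injective (begin
    toℕ u                       ≡⟨ m<n⇒m%n≡m (Fin.toℕ<n u) ⟨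
    toℕ u % n                   ≡⟨ [m+kn]%n≡m%n (toℕ u) (deg j u) n ⟨
    (toℕ u + deg j u * n) % n   ≡⟨ cong (_% n) (trans (+-comm (toℕ u) _) (trans e (+-comm _ (toℕ v)))) ⟩
    (toℕ v + deg j v * n) % n   ≡⟨ [m+kn]%n≡m%n (toℕ v) (deg j v) n ⟩
    toℕ v % n                   ≡⟨ m<n⇒m%n≡m (Fin.toℕ<n v) ⟩
    toℕ v                       ∎)
    where open ≡-Reasoning

  key≤⇒deg≤ : ∀ j u v → key j u ≤ key j v → deg j u ≤ deg j v
  key≤⇒deg≤ j u v le = ≮⇒≥ λ lt → <⇒≱ (begin-strict
      key j v                   <⟨ +-monoʳ-< (deg j v * n) (Fin.toℕ<n v) ⟩
      deg j v * n + n           ≡⟨ +-comm (deg j v * n) n ⟩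
      suc (deg j v) * n         ≤⟨ *-monoˡ-≤ n lt ⟩
      deg j u * n               ≤⟨ m≤m+n _ (toℕ u) ⟩
      key j u ∎) le
    where open ≤-Reasoning

  -- If v missed w, then for every x of clique `j` seen by v the square u w x v would force u to see
  -- x. So u would see all that v sees and also w, against the order of the degrees.
  nested : ∀ j {c} u v w → κ u ≡ just c → κ v ≡ just c → κ w ≡ just j → key j u ≤ key j v →
           E u w ≡ true → E v w ≡ true
  nested j {c} u v w ku kv kw le uw with true-or-false (E v w)
  ... | inj₁ t = t
  ... | inj₂ vw = ⊥-elim (<⇒≱ smaller (key≤⇒deg≤ j u v le))
    where
    only : Fin n → Bool
    only x = does (x Fin.≟ w)
    sub : ∀ x → inClass j x ∧ E v x ≡ true → inClass j x ∧ E u x ≡ true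
    sub x e with noC4 u w x v uw (proper w x j kw kx) (trans (E-sym x v) (∧-snd {inClass j x} e)) (proper v u c kv ku)
      where
      kx : κ x ≡ just j
      kx = does⇒ (κ x ≟κ just j) (∧-fst e)
    ... | inj₁ ux = ∧-intro (∧-fst e) ux
    ... | inj₂ wv = contradiction (trans (sym vw) (trans (E-sym v w) wv)) false≢true
    sub′ : ∀ x → only x ≡ true → inClass j x ∧ E u x ≡ true
    sub′ x e with refl ← does⇒ (x Fin.≟ w) e = ∧-intro (dec-true (κ x ≟κ just j) kw) uw
    disjoint : ∀ x → only x ≡ true → inClass j x ∧ E v x ≡ true → ⊥
    disjoint x e vx with refl ← does⇒ (x Fin.≟ w) e =
      contradiction (trans (sym vw) (∧-snd {inClass j x} vx)) false≢true
    smaller : deg j v < deg j u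
    smaller = subst (_≤ deg j u) (cong (_+ deg j v) (∑-δ w)) (#-disjoint V only _ _ sub′ sub disjoint)

  rank-mono : ∀ j u v → κ u ≡ κ v → key j u ≤ key j v → rank j u ≤ rank j v
  rank-mono j u v κ≡ le = #-mono V λ w e → ∧-intro
    (dec-true (κ w ≟κ κ v) (trans (does⇒ (κ w ≟κ κ u) (∧-fst e)) κ≡))
    (dec-true (key j w <? key j v) (<-≤-trans (does⇒ (key j w <? key j u) (∧-snd {does (κ w ≟κ κ u)} e)) le))

  rank-strict : ∀ j u v → κ u ≡ κ v → key j u < key j v → rank j u < rank j v
  rank-strict j u v κ≡ lt = subst (_≤ rank j v) (cong (_+ rank j u) (∑-δ u)) (#-disjoint V only _ _ sub′ sub disjoint)
    where
    only : Fin n → Bool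
    only x = does (x Fin.≟ u)
    sub′ : ∀ x → only x ≡ true → does (κ x ≟κ κ v) ∧ does (key j x <? key j v) ≡ true
    sub′ x e with refl ← does⇒ (x Fin.≟ u) e = ∧-intro (dec-true (κ x ≟κ κ v) κ≡) (dec-true (key j x <? key j v) lt)
    sub : ∀ x → does (κ x ≟κ κ u) ∧ does (key j x <? key j u) ≡ true → does (κ x ≟κ κ v) ∧ does (key j x <? key j v) ≡ true
    sub x e = ∧-intro (dec-true (κ x ≟κ κ v) (trans (does⇒ (κ x ≟κ κ u) (∧-fst e)) κ≡))
      (dec-true (key j x <? key j v) (<-trans (does⇒ (key j x <? key j u) (∧-snd {does (κ x ≟κ κ u)} e)) lt))
    disjoint : ∀ x → only x ≡ true → does (κ x ≟κ κ u) ∧ does (key j x <? key j u) ≡ true → ⊥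
    disjoint x e e′ with refl ← does⇒ (x Fin.≟ u) e = <-irrefl refl (does⇒ (key j x <? key j x) (∧-snd {does (κ x ≟κ κ x)} e′))

  rank-injective : ∀ j u v → κ u ≡ κ v → rank j u ≡ rank j v → u ≡ v
  rank-injective j u v κ≡ r≡ with <-cmp (key j u) (key j v)
  ... | tri< lt _ _ = ⊥-elim (<-irrefl r≡ (rank-strict j u v κ≡ lt))
  ... | tri≈ _ eq _ = key-injective j u v eq
  ... | tri> _ _ gt = ⊥-elim (<-irrefl (sym r≡) (rank-strict j v u (sym κ≡) gt))

  bucket<⇒key≤ : ∀ j u v → κ u ≡ κ v → bucket j u < bucket j v → key j u ≤ key j v
  bucket<⇒key≤ j u v κ≡ lt = ≮⇒≥ λ gt → <⇒≱ lt (/-monoˡ-≤ s (rank-mono j v u (sym κ≡) (<⇒≤ gt)))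

  bucket-size : ∀ i j b → # V (λ v → inClass i v ∧ does (bucket j v ≟ b)) ≤ s
  bucket-size i j b = #-bucket (inClass i) (rank j) s b λ u v cu cv → rank-injective j u v
    (trans (does⇒ (κ u ≟κ just i) cu) (sym (does⇒ (κ v ≟κ just i) cv)))

  module _ (z : Fin n → Fin n) (z-κ : ∀ v {i} → κ v ≡ just i → κ (z v) ≡ just i)
    (z-bucket : ∀ j v {i} → κ v ≡ just i → bucket j (z v) ≡ bucket j v) where

    bad : Fin Q → Fin Q → Fin n × Fin n → Bool
    bad i j (v , w) = inClass i v ∧ (inClass j w ∧ xor (E v w) (E (z v) (z w)))

    record Member (i j : Fin Q) (v w : Fin n) (b c : ℕ) (t : Bool) : Set where
      constructor member
      field
        {x y} : Fin n
        κx : κ x ≡ just i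
        κy : κ y ≡ just j
        bx : bucket j x ≡ b
        by : bucket i y ≡ c
        xy : E x y ≡ t

    -- The pairs (v, w) and (z v, z w) lie in the same box of layers and differ in adjacency. From
    -- here on only this matters: the box of a bad pair contains an edge and a non-edge.
    both-values : ∀ {i j v w} → bad i j (v , w) ≡ true → ∀ t → Member i j v w (bucket j v) (bucket i w) t
    both-values {i} {j} {v} {w} e t with true-or-false (xor (E v w) t)
    ... | inj₂ same = member κv κw refl refl (lem (E v w) t same)
      where
      κv = does⇒ (κ v ≟κ just i) (∧-fst e)
      κw = does⇒ (κ w ≟κ just j) (∧-fst (∧-snd {inClass i v} e))
      lem : ∀ a b → xor a b ≡ false → a ≡ b
      lem true true _ = refl
      lem false false _ = refl
    ... | inj₁ diff = member (z-κ v κv) (z-κ w κw) (z-bucket j v κv) (z-bucket i w κw)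
        (lem (E v w) t (E (z v) (z w)) diff (∧-snd {inClass j w} (∧-snd {inClass i v} e)))
      where
      κv = does⇒ (κ v ≟κ just i) (∧-fst e)
      κw = does⇒ (κ w ≟κ just j) (∧-fst (∧-snd {inClass i v} e))
      lem : ∀ a b c → xor a b ≡ true → xor a c ≡ true → c ≡ b
      lem true false false _ _ = refl
      lem false true true _ _ = refl

    -- Nestedness carries an edge of the lower box upwards, first in one coordinate and then in the
    -- other, to every pair of the higher box, which would then contain no non-edge.
    antichain : ∀ {i j v w v′ w′} → bad i j (v , w) ≡ true → bad i j (v′ , w′) ≡ true →
                bucket j v < bucket j v′ → bucket i w < bucket i w′ → ⊥
    antichain {i} {j} e e′ lt lt′ with both-values e true | both-values e′ false
    ... | member {x} {y} κx κy bx₀ by₀ xy | member {x′} {y′} κx′ κy′ bx by x′y′ =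
      contradiction (trans (sym x′y′) x′y′-true) false≢true
      where
      x′y : E x′ y ≡ true
      x′y = nested j x x′ y κx κx′ κy (bucket<⇒key≤ j x x′ (trans κx (sym κx′)) (subst₂ _<_ (sym bx₀) (sym bx) lt)) xy
      x′y′-true : E x′ y′ ≡ true
      x′y′-true = trans (E-sym x′ y′) (nested i y y′ x′ κy κy′ κx′
        (bucket<⇒key≤ i y y′ (trans κy (sym κy′)) (subst₂ _<_ (sym by₀) (sym by) lt′)) (trans (E-sym y x′) x′y))

    -- The diagonal of the box, shifted by `m` to stay in ℕ. Two different boxes on one diagonal are
    -- strictly comparable in both coordinates, so `antichain` leaves at most one mixed box on each
    -- of the 2m diagonals.
    offset : Fin Q → Fin Q → Fin n × Fin n → ℕ
    offset i j (v , w) = bucket j v + (m ∸ bucket i w)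

    offset< : ∀ i j p → offset i j p < m + m
    offset< i j (v , w) = +-mono-<-≤ (bucket<m j v) (m∸n≤m m (bucket i w))

    same-offset : ∀ {i j v w v′ w′} → bad i j (v , w) ≡ true → bad i j (v′ , w′) ≡ true →
                  offset i j (v , w) ≡ offset i j (v′ , w′) → bucket j v ≡ bucket j v′ × bucket i w ≡ bucket i w′
    same-offset {i} {j} {v} {w} {v′} {w′} e e′ eq with <-cmp (bucket j v) (bucket j v′)
    ... | tri< lt _ _ = ⊥-elim (antichain e e′ lt (≰⇒> λ ge → <-irrefl eq (+-mono-<-≤ lt (∸-monoʳ-≤ m ge))))
    ... | tri> _ _ gt = ⊥-elim (antichain e′ e gt (≰⇒> λ ge → <-irrefl (sym eq) (+-mono-<-≤ gt (∸-monoʳ-≤ m ge))))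
    ... | tri≈ _ b≡ _ = b≡ , ∸-cancelˡ-≡ (<⇒≤ (bucket<m i w)) (<⇒≤ (bucket<m i w′))
      (+-cancelˡ-≡ (bucket j v) _ _ (trans eq (cong (_+ (m ∸ bucket i w′)) (sym b≡))))

    bad-class : ∀ i j → # (pairs V V) (bad i j) ≤ (m + m) * (s * s)
    bad-class i j = ≤-trans (#-union (pairs V V) (allFin (m + m)) (bad i j) q
        (λ p e → fromℕ< (offset< i j p) , ∈.∈-allFin _ ,
          ∧-intro e (dec-true (offset i j p ≟ _) (sym (Fin.toℕ-fromℕ< (offset< i j p))))))
      (≤-trans (∑-≤const (allFin (m + m)) (s * s) q-small) (≤-reflexive (cong (_* (s * s)) (length-allFin (m + m)))))
      where
      q : Fin (m + m) → Fin n × Fin n → Bool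
      q r p = bad i j p ∧ does (offset i j p ≟ toℕ r)
      box : Fin Q → Fin Q → ℕ → Fin n → Bool
      box i j b v = inClass i v ∧ does (bucket j v ≟ b)
      q-small : ∀ r → # (pairs V V) (q r) ≤ s * s
      q-small r = #-witness (pairs V V) (q r) λ (v , w) e → begin
        # (pairs V V) (q r)      ≤⟨ ∑-mono (pairs V V) (λ (v′ , w′) → 𝟙-≤ _ λ e′ →
                                      let bv , bw = same-offset (∧-fst e′) (∧-fst e)
                                            (trans (does⇒ (offset i j (v′ , w′) ≟ toℕ r) (∧-snd {bad i j (v′ , w′)} e′))
                                              (sym (does⇒ (offset i j (v , w) ≟ toℕ r) (∧-snd {bad i j (v , w)} e))))
                                          b = ∧-fst {bad i j (v′ , w′)} e′
                                      in ≤-reflexive (sym (cong₂ _*_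
                                           (𝟙≡1 (∧-intro (∧-fst {inClass i v′} b) (dec-true (bucket j v′ ≟ _) bv)))
                                           (𝟙≡1 (∧-intro (∧-fst {inClass j w′} (∧-snd {inClass i v′} b)) (dec-true (bucket i w′ ≟ _) bw)))))) ⟩
        ∑ (pairs V V) (λ (v′ , w′) → 𝟙 (box i j (bucket j v) v′) * 𝟙 (box j i (bucket i w) w′))
                                 ≡⟨ trans (∑-pairs V V _) (∑-product V V _ _) ⟩
        # V (box i j (bucket j v)) * # V (box j i (bucket i w))
                                 ≤⟨ *-mono-≤ (bucket-size i j _) (bucket-size j i _) ⟩
        s * s                    ∎
        where open ≤-Reasoning

    Bad : Fin n × Fin n → Bool
    Bad (v , w) = not (IsRest Q (κ v)) ∧ (not (IsRest Q (κ w)) ∧ xor (E v w) (E (z v) (z w)))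

    class : ∀ {v} → not (IsRest Q (κ v)) ≡ true → ∃ λ i → κ v ≡ just i
    class {v} e with just i ← κ v = i , refl

    -- Below m vertices every bucket is a singleton, so that z is the identity.
    Bad-few : m * # (pairs V V) Bad ≤ 8 * (Q * Q) * (n * n)
    Bad-few with m ≤? n
    ... | no m≰n = ≤-trans (≤-reflexive (trans (cong (m *_) (∑-zero (pairs V V) none)) (*-zeroʳ m))) z≤n
      where
      s≡1 : s ≡ 1
      s≡1 = cong suc (m<n⇒m/n≡0 (≰⇒> m≰n))
      bucket≡rank : ∀ j v → bucket j v ≡ rank j v
      bucket≡rank j v = lem s s≡1
        where
        lem : ∀ t .{{_ : NonZero t}} → t ≡ 1 → rank j v / t ≡ rank j v
        lem t refl = n/1≡n (rank j v)
      z≡id : ∀ v {i} → κ v ≡ just i → z v ≡ v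
      z≡id v {i} κv = rank-injective i (z v) v (trans (z-κ v κv) (sym κv))
        (trans (sym (bucket≡rank i (z v))) (trans (z-bucket i v κv) (bucket≡rank i v)))
      none : ∀ p → 𝟙 (Bad p) ≡ 0
      none (v , w) with true-or-false (Bad (v , w))
      ... | inj₂ f = cong 𝟙 f
      ... | inj₁ t = let i , κv = class {v} (∧-fst t) ; j , κw = class {w} (∧-fst (∧-snd {not (IsRest Q (κ v))} t)) in
        ⊥-elim (lem (E v w) (subst₂ (λ a b → xor (E v w) (E a b) ≡ true) (z≡id v κv) (z≡id w κw)
          (∧-snd {not (IsRest Q (κ w))} (∧-snd {not (IsRest Q (κ v))} t))))
        where
        lem : ∀ a → xor a a ≢ true
        lem true ()
        lem false ()
    ... | yes m≤n = begin
      m * # (pairs V V) Bad                 ≤⟨ *-monoʳ-≤ m (#-union (pairs V V) (pairs C C) Bad (λ (i , j) → bad i j) cover) ⟩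
      m * ∑ (pairs C C) (λ (i , j) → # (pairs V V) (bad i j))
                                            ≤⟨ *-monoʳ-≤ m (∑-≤const (pairs C C) _ λ (i , j) → bad-class i j) ⟩
      m * (length (pairs C C) * ((m + m) * (s * s)))
                                            ≡⟨ cong (λ l → m * (l * ((m + m) * (s * s))))
                                                 (trans (length-pairs C C) (cong (λ l → l * l) (length-allFin Q))) ⟩
      m * (Q * Q * ((m + m) * (s * s)))     ≡⟨ lem₁ m Q s ⟩
      2 * (Q * Q) * (m * s * (m * s))       ≤⟨ *-monoʳ-≤ (2 * (Q * Q)) (*-mono-≤ ms≤2n ms≤2n) ⟩
      2 * (Q * Q) * (2 * n * (2 * n))       ≡⟨ lem₂ (Q * Q) n ⟩
      8 * (Q * Q) * (n * n) ∎
      where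
      open ≤-Reasoning
      C = allFin Q
      lem₁ : ∀ m Q s → m * (Q * Q * ((m + m) * (s * s))) ≡ 2 * (Q * Q) * (m * s * (m * s))
      lem₁ = solve-∀
      lem₂ : ∀ a n → 2 * a * (2 * n * (2 * n)) ≡ 8 * a * (n * n)
      lem₂ = solve-∀
      ms≤2n : m * s ≤ 2 * n
      ms≤2n = begin
        m * suc (n / m)   ≡⟨ *-suc m (n / m) ⟩
        m + m * (n / m)   ≤⟨ +-mono-≤ m≤n (≤-trans (≤-reflexive (*-comm m (n / m))) (m/n*n≤m n m)) ⟩
        n + n             ≡⟨ cong (n +_) (+-identityʳ n) ⟨
        2 * n ∎
      cover : ∀ p → Bad p ≡ true → ∃ λ ij → ij ∈ pairs C C × bad (proj₁ ij) (proj₂ ij) p ≡ true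
      cover (v , w) e = let a = ∧-snd {not (IsRest Q (κ v))} e
                            i , κv = class {v} (∧-fst e)
                            j , κw = class {w} (∧-fst a)
        in (i , j) , ∈-pairs (∈.∈-allFin i) (∈.∈-allFin j) ,
           ∧-intro (dec-true (κ v ≟κ just i) κv) (∧-intro (dec-true (κ w ≟κ just j) κw) (∧-snd {not (IsRest Q (κ w))} a))

-- 2K₂-free relations and their vertex covers

∨-introˡ : ∀ {a b} → a ≡ true → a ∨ b ≡ true
∨-introˡ refl = refl

∨-introʳ : ∀ {a b} → b ≡ true → a ∨ b ≡ true
∨-introʳ {true}  _ = refl
∨-introʳ {false} p = p

∨-elim : ∀ {a b} → a ∨ b ≡ true → a ≡ true ⊎ b ≡ true
∨-elim {true}  _ = inj₁ refl
∨-elim {false} p = inj₂ p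

2K₂-Free : {A : Set} → (A → A → Bool) → Set
2K₂-Free B = ∀ v w v′ w′ → B v w ≡ true → B v′ w′ ≡ true →
  (B v v′ ∨ B v w′) ∨ (B w v′ ∨ B w w′) ≡ true

NonEdges : {A : Set} → (A → Bool) → (A → A → Bool) → A → A → Bool
NonEdges p e v w = p v ∧ (p w ∧ not (e v w))

module _ {A : Set} (p : A → Bool) (e : A → A → Bool) where

  NonEdges-intro : ∀ {v w} → p v ≡ true → p w ≡ true → e v w ≡ false → NonEdges p e v w ≡ true
  NonEdges-intro a b c = ∧-intro a (∧-intro b (cong not c))

  NonEdges-elim : ∀ v w → NonEdges p e v w ≡ true → p v ≡ true × p w ≡ true × e v w ≡ false
  NonEdges-elim v w h = ∧-fst h , ∧-fst (∧-snd {p v} h) , not-true (∧-snd {p w} (∧-snd {p v} h))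

  NonEdges-sym : (∀ u v → e u v ≡ e v u) → ∀ v w → NonEdges p e v w ≡ NonEdges p e w v
  NonEdges-sym e-sym v w rewrite e-sym v w = lem (p v) (p w) _
    where
    lem : ∀ a b c → a ∧ (b ∧ c) ≡ b ∧ (a ∧ c)
    lem true  true  c = refl
    lem true  false c = refl
    lem false true  c = refl
    lem false false c = refl

  -- The complement of C₄ is 2K₂: if all four cross pairs of two non-edges v w and v′ w′ were edges,
  -- v v′ w w′ would be a square without diagonals.
  NonEdges-2K₂-free : (∀ u v → e u v ≡ e v u) → NoC4 e → 2K₂-Free (NonEdges p e)
  NonEdges-2K₂-free e-sym e-noC4 v w v′ w′ h h′
    with NonEdges-elim v w h | NonEdges-elim v′ w′ h′
       | true-or-false (e v v′) | true-or-false (e v′ w) | true-or-false (e w w′) | true-or-false (e w′ v)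
  ... | pv , pw , _ | pv′ , pw′ , _ | inj₂ f | _ | _ | _ = ∨-introˡ (∨-introˡ (NonEdges-intro pv pv′ f))
  ... | pv , pw , _ | pv′ , pw′ , _ | _ | inj₂ f | _ | _ =
    ∨-introʳ {NonEdges p e v v′ ∨ NonEdges p e v w′} (∨-introˡ (NonEdges-intro pw pv′ (trans (e-sym w v′) f)))
  ... | pv , pw , _ | pv′ , pw′ , _ | _ | _ | inj₂ f | _ =
    ∨-introʳ {NonEdges p e v v′ ∨ NonEdges p e v w′} (∨-introʳ {NonEdges p e w v′} (NonEdges-intro pw pw′ f))
  ... | pv , pw , _ | pv′ , pw′ , _ | _ | _ | _ | inj₂ f =
    ∨-introˡ (∨-introʳ {NonEdges p e v v′} (NonEdges-intro pv pw′ (trans (e-sym v w′) f)))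
  ... | _ , _ , vw | _ , _ , v′w′ | inj₁ t₁ | inj₁ t₂ | inj₁ t₃ | inj₁ t₄ with e-noC4 v v′ w w′ t₁ t₂ t₃ t₄
  ...   | inj₁ t = contradiction (trans (sym vw) t) false≢true
  ...   | inj₂ t = contradiction (trans (sym v′w′) t) false≢true

-- The two neighbourhoods of an edge cover a 2K₂-free graph, so it suffices to add all vertices of
-- high degree and then the neighbourhoods of any edge that is left.
vertexCover : ∀ {n} {{_ : NonZero n}} (D : ℕ) (B : Fin n → Fin n → Bool) → (∀ u v → B u v ≡ B v u) → 2K₂-Free B →
  ∃ λ (cov : Fin n → Bool) → (∀ v w → B v w ≡ true → cov v ≡ true ⊎ cov w ≡ true) ×
    n * D * # (allFin n) cov ≤ D * D * ∑ (allFin n) (λ v → # (allFin n) (B v)) + 2 * (n * n)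
vertexCover {n} D B B-sym free with Fin.any? (λ v → Fin.any? (λ w →
    (B v w Data.Bool.≟ true) ×-dec ((D * # (allFin n) (B v) <? n) ×-dec (D * # (allFin n) (B w) <? n))))
-- Every edge has an end of degree at least n/D, so such vertices form a cover by themselves; their
-- number is bounded by the degree sum.
... | no ∄ = high , covers , bound
  where
  open ≤-Reasoning
  V = allFin n
  high : Fin n → Bool
  high v = does (n ≤? D * # V (B v))
  covers : ∀ v w → B v w ≡ true → high v ≡ true ⊎ high w ≡ true
  covers v w e with n ≤? D * # V (B v) | n ≤? D * # V (B w)
  ... | yes p | _     = inj₁ (dec-true (n ≤? D * # V (B v)) p)
  ... | no _  | yes p = inj₂ (dec-true (n ≤? D * # V (B w)) p)
  ... | no p  | no q  = ⊥-elim (∄ (v , w , e , ≰⇒> p , ≰⇒> q))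
  bound : n * D * # V high ≤ D * D * ∑ V (λ v → # V (B v)) + 2 * (n * n)
  bound = begin
    n * D * # V high                        ≡⟨ lem n D (# V high) ⟩
    D * (n * # V high)                      ≡⟨ cong (D *_) (∑-*ˡ V n _) ⟨
    D * ∑ V (λ v → n * 𝟙 (high v))          ≤⟨ *-monoʳ-≤ D (∑-mono V λ v → 𝟙-scale (n ≤? D * # V (B v)) id) ⟩
    D * ∑ V (λ v → D * # V (B v))           ≡⟨ trans (cong (D *_) (∑-*ˡ V D _)) (sym (*-assoc D D _)) ⟩
    D * D * ∑ V (λ v → # V (B v))           ≤⟨ m≤m+n _ _ ⟩
    D * D * ∑ V (λ v → # V (B v)) + 2 * (n * n) ∎
    where
    lem : ∀ n d h → n * d * h ≡ d * (n * h)
    lem = solve-∀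
-- Both ends of this edge have degree below n/D, so their neighbourhoods form a cover of at most
-- 2n/D vertices.
... | yes (v₀ , w₀ , edge , lowv , loww) = cov , covers , bound
  where
  open ≤-Reasoning
  V = allFin n
  high cov : Fin n → Bool
  high v = does (n ≤? D * # V (B v))
  cov u = B v₀ u ∨ B w₀ u
  covers : ∀ v w → B v w ≡ true → cov v ≡ true ⊎ cov w ≡ true
  covers v w e with ∨-elim (free v₀ w₀ v w edge e)
  ... | inj₁ p = [ (λ q → inj₁ (∨-introˡ q)) , (λ q → inj₂ (∨-introˡ q)) ]′ (∨-elim {B v₀ v} p)
  ... | inj₂ p = [ (λ q → inj₁ (∨-introʳ {B v₀ v} q)) , (λ q → inj₂ (∨-introʳ {B v₀ w} q)) ]′ (∨-elim {B w₀ v} p)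
  bound : n * D * # V cov ≤ D * D * ∑ V (λ v → # V (B v)) + 2 * (n * n)
  bound = begin
    n * D * # V cov                         ≤⟨ *-monoʳ-≤ (n * D) (#-∪ V cov (B v₀) (B w₀) λ u → ∨-elim {B v₀ u}) ⟩
    n * D * (# V (B v₀) + # V (B w₀))       ≡⟨ lem n D (# V (B v₀)) (# V (B w₀)) ⟩
    n * (D * # V (B v₀) + D * # V (B w₀))   ≤⟨ *-monoʳ-≤ n (+-mono-≤ (<⇒≤ lowv) (<⇒≤ loww)) ⟩
    n * (n + n)                             ≡⟨ lem′ n ⟩
    2 * (n * n)                             ≤⟨ m≤n+m _ (D * D * ∑ V (λ v → # V (B v))) ⟩
    D * D * ∑ V (λ v → # V (B v)) + 2 * (n * n) ∎
    where
    lem : ∀ n d a b → n * d * (a + b) ≡ n * (d * a + d * b)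
    lem = solve-∀
    lem′ : ∀ n → n * (n + n) ≡ 2 * (n * n)
    lem′ = solve-∀

-- Templates

-- X p lies in the clique p of a template; a vertex with label Y I belongs to the independent part
-- and may be joined, arbitrarily, to the cliques in I and to nothing else.
data Label (N : ℕ) : Set where
  X : Fin N → Label N
  Y : Vec Bool N → Label N

record Template {N : ℕ} (r : Fin N → Fin N → Bool) : Set where
  field
    r-sym  : ∀ p q → r p q ≡ r q p
    r-refl : ∀ p → r p p ≡ true
    r-noC4 : NoC4 r

Valid : ∀ {N} → (Fin N → Fin N → Bool) → Label N → Set
Valid r (X p) = ⊤
Valid r (Y I) = ∀ p q → lookup I p ≡ true → lookup I q ≡ true → r p q ≡ true

-- A missing edge between `X p` and `Y I` never counts, as those joins are arbitrary. `nothing` is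
-- the observation of a vertex paired with itself.
viol : ∀ {N} → (Fin N → Fin N → Bool) → Label N → Label N → Maybe Bool → Bool
viol r a     b     nothing  = false
viol r (X p) (X q) (just g) = xor g (r p q)
viol r (X p) (Y I) (just g) = g ∧ not (lookup I p)
viol r (Y I) (X p) (just g) = g ∧ not (lookup I p)
viol r (Y I) (Y J) (just g) = g

obs : ∀ {n} → Graph n → Fin n → Fin n → Maybe Bool
obs G u v = if does (u Fin.≟ v) then nothing else just (adj G u v)

obs-≢ : ∀ {n} (G : Graph n) {u v} → u ≢ v → obs G u v ≡ just (adj G u v)
obs-≢ G {u} {v} u≢v = cong (λ b → if b then nothing else just (adj G u v)) (dec-false (u Fin.≟ v) u≢v)

obs-≡ : ∀ {n} (G : Graph n) u → obs G u u ≡ nothing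
obs-≡ G u = cong (λ b → if b then nothing else just (adj G u u)) (dec-true (u Fin.≟ u) refl)

-- Taken over ordered pairs, so it compares with twice an edit count.
cost : ∀ {N n} → (Fin N → Fin N → Bool) → Graph n → (Fin n → Label N) → ℕ
cost {n = n} r G φ = ∑ (allFin n) λ u → ∑ (allFin n) λ v → 𝟙 (viol r (φ u) (φ v) (obs G u v))

-- Approximating an induced C₄-free graph by a template

module Approximation {n} {{n≢0 : NonZero n}} (H : Graph n) (C4-free : InducedC4Free H)
  (D Q m N : ℕ) (5≤D : 5 ≤ D) (Q≡ : Q ≡ D * D * D) (m≡ : m ≡ Q * Q * (D * D)) (N≡ : N ≡ Q * m ^ Q) where

  E : Fin n → Fin n → Bool
  E u v = does (u Fin.≟ v) ∨ adj H u v

  E-≡ : ∀ {u v} → u ≡ v → E u v ≡ true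
  E-≡ {u} {v} e = ∨-introˡ (dec-true (u Fin.≟ v) e)

  E-refl : ∀ v → E v v ≡ true
  E-refl v = E-≡ refl

  E-≢ : ∀ {u v} → u ≢ v → E u v ≡ adj H u v
  E-≢ {u} {v} u≢v = cong (_∨ adj H u v) (dec-false (u Fin.≟ v) u≢v)

  E-sym : ∀ u v → E u v ≡ E v u
  E-sym u v with u Fin.≟ v
  ... | yes refl = sym (E-refl u)
  ... | no u≢v = trans (adj-sym H u v) (sym (E-≢ (u≢v ∘ sym)))

  noC4 : NoC4 E
  noC4 a b c d ab bc cd da with true-or-false (E a c) | true-or-false (E b d)
  ... | inj₁ ac | _ = inj₁ ac
  ... | _ | inj₁ bd = inj₂ bd
  ... | inj₂ ac | inj₂ bd = ⊥-elim (C4-free (a , b , c , d , a≢b , a≢c , a≢d , b≢c , b≢d , c≢d ,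
      edge a≢b ab , edge b≢c bc , edge c≢d cd , edge (a≢d ∘ sym) da , trans (sym (E-≢ a≢c)) ac , trans (sym (E-≢ b≢d)) bd))
    where
    edge : ∀ {u v} → u ≢ v → E u v ≡ true → adj H u v ≡ true
    edge ne e = trans (sym (E-≢ ne)) e
    distinct : ∀ {u v} x → E u x ≡ false → E v x ≡ true → u ≢ v
    distinct x f t refl = contradiction (trans (sym f) t) false≢true
    a≢c : a ≢ c
    a≢c e = contradiction (trans (sym ac) (E-≡ e)) false≢true
    b≢d : b ≢ d
    b≢d e = contradiction (trans (sym bd) (E-≡ e)) false≢true
    a≢b : a ≢ b
    a≢b = distinct c ac bc
    a≢d : a ≢ d
    a≢d = distinct c ac (trans (E-sym d c) cd)
    b≢c : b ≢ c
    b≢c = distinct d bd cd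
    c≢d : c ≢ d
    c≢d = distinct a (trans (E-sym c a) ac) da

  open Cliques E E-sym E-refl noC4

  private instance
    D≢0 : NonZero D
    D≢0 = >-nonZero (≤-trans (s≤s z≤n) 5≤D)
    Q≢0 : NonZero Q
    Q≢0 = subst NonZero (sym Q≡) (m*n≢0 (D * D) D {{m*n≢0 D D}})
    m≢0 : NonZero m
    m≢0 = subst NonZero (sym m≡) (m*n≢0 (Q * Q) (D * D) {{m*n≢0 Q Q}} {{m*n≢0 D D}})

  module FromCliques (κ : Fin n → Maybe (Fin Q)) (proper : Proper Q κ) (small : SmallCliques Q (IsRest Q ∘ κ)) where

    open Pieces E E-sym E-refl noC4 Q m κ proper using (bucket; bucket<m; Bad; Bad-few)
    open Sparse E E-sym E-refl noC4 D Q Q≡ 5≤D (IsRest Q ∘ κ) small using (sparse)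
    open ≤-Reasoning

    inY : Fin n → Bool
    inY = IsRest Q ∘ κ

    abstract
      -- The clique together with its layers relative to all `Q` cliques at once, whence N = Q m ^
      -- Q.
      piece : Fin Q → Fin n → Fin N
      piece i v = subst Fin (sym N≡) (combine i (funToFin λ j → fromℕ< (bucket<m j v)))

      piece-injective : ∀ i u j v → piece i u ≡ piece j v → i ≡ j × (∀ l → bucket l u ≡ bucket l v)
      piece-injective i u j v e with Fin.combine-injective i _ j _ (subst-injective (sym N≡) e)
      ... | i≡j , f≡ = i≡j , λ l → trans (sym (Fin.toℕ-fromℕ< (bucket<m l u)))
        (trans (cong toℕ (trans (sym (Fin.finToFun-funToFin _ l)) (trans (cong (λ f → finToFun f l) f≡) (Fin.finToFun-funToFin _ l))))
          (Fin.toℕ-fromℕ< (bucket<m l v)))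

    code : Fin n → Maybe (Fin N)
    code v = Data.Maybe.map (λ i → piece i v) (κ v)

    code-just : ∀ {v i} → κ v ≡ just i → code v ≡ just (piece i v)
    code-just {v} e = cong (Data.Maybe.map (λ i → piece i v)) e

    code-inX : ∀ {v p} → code v ≡ just p → not (inY v) ≡ true
    code-inX {v} e = lem (κ v) e
      where
      lem : ∀ c → Data.Maybe.map (λ i → piece i v) c ≡ just _ → not (IsRest Q c) ≡ true
      lem (just _) _ = refl

    code-injective : ∀ {u v p i} → code u ≡ just p → code v ≡ just p → κ v ≡ just i →
                     κ u ≡ just i × (∀ l → bucket l u ≡ bucket l v)
    code-injective {u} {v} {p} {i} cu cv kv = by-class (κ u) refl
      where
      by-class : ∀ c → κ u ≡ c → κ u ≡ just i × (∀ l → bucket l u ≡ bucket l v)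
      by-class nothing  ku = contradiction (trans (sym cu) (cong (Data.Maybe.map _) ku)) λ ()
      by-class (just j) ku with piece-injective j u i v
        (Maybe.just-injective (trans (sym (code-just ku)) (trans cu (trans (sym cv) (code-just kv)))))
      ... | j≡i , b≡ = trans ku (cong just j≡i) , b≡

    someone : Fin n
    someone = fromℕ< (>-nonZero⁻¹ n)

    rep : Fin N → Fin n
    rep p with Fin.any? (λ v → Maybe.≡-dec Fin._≟_ (code v) (just p))
    ... | yes (v , _) = v
    ... | no  _       = someone

    code-rep : ∀ {v p} → code v ≡ just p → code (rep p) ≡ just p
    code-rep {v} {p} cv with Fin.any? (λ v → Maybe.≡-dec Fin._≟_ (code v) (just p))
    ... | yes (_ , e) = e
    ... | no ∄ = ⊥-elim (∄ (v , cv))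

    -- Pulled back from `E` along `rep`, so all template laws are inherited, even at empty pieces,
    -- where `rep` is an arbitrary vertex. A majority between pieces would not guarantee this.
    r : Fin N → Fin N → Bool
    r p q = E (rep p) (rep q)

    template : Template r
    template = record { r-sym = λ p q → E-sym (rep p) (rep q) ; r-refl = λ p → E-refl (rep p)
                      ; r-noC4 = λ a b c d → noC4 (rep a) (rep b) (rep c) (rep d) }

    representative : Fin n → Maybe (Fin N) → Fin n
    representative v (just p) = rep p
    representative v nothing  = v

    z : Fin n → Fin n
    z v = representative v (code v)

    z≡rep : ∀ {v p} → code v ≡ just p → z v ≡ rep p
    z≡rep {v} e = cong (representative v) e

    z-piece : ∀ {v i} → κ v ≡ just i → κ (z v) ≡ just i × (∀ l → bucket l (z v) ≡ bucket l v)
    z-piece {v} {i} kv = code-injective (trans (cong code (z≡rep cv)) (code-rep cv)) cv kv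
      where
      cv : code v ≡ just (piece i v)
      cv = code-just kv

    bad : Fin n × Fin n → Bool
    bad = Bad z (λ v kv → proj₁ (z-piece kv)) (λ j v kv → proj₂ (z-piece kv) j)

    nbr : Fin n → Fin n → Bool
    nbr y v = not (inY v) ∧ E y v

    zz : Fin n → Fin n → Bool
    zz v w = E (z v) (z w)

    -- Adjacency is read between representatives: `B y` stays 2K₂-free, as `E` pulled back along `z`
    -- is still C₄-free, and a pair outside `B y` in the neighbourhood has pieces joined in `r`.
    B : Fin n → Fin n → Fin n → Bool
    B y = NonEdges (nbr y) zz

    abstract
      cover : ∀ y → ∃ λ (cov : Fin n → Bool) → (∀ v w → B y v w ≡ true → cov v ≡ true ⊎ cov w ≡ true) ×
        n * D * # V cov ≤ D * D * ∑ V (λ v → # V (B y v)) + 2 * (n * n)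
      cover y = vertexCover D (B y) (NonEdges-sym (nbr y) zz z-sym)
        (NonEdges-2K₂-free (nbr y) zz z-sym λ a b c d → noC4 (z a) (z b) (z c) (z d))
        where
        z-sym : ∀ u v → E (z u) (z v) ≡ E (z v) (z u)
        z-sym u v = E-sym (z u) (z v)

    cov : Fin n → Fin n → Bool
    cov y = proj₁ (cover y)

    free : Fin n → Fin N → Fin n → Set
    free y p v = code v ≡ just p × E y v ≡ true × cov y v ≡ false

    free? : ∀ y p v → Dec (free y p v)
    free? y p v = Maybe.≡-dec Fin._≟_ (code v) (just p) ×-dec ((E y v Data.Bool.≟ true) ×-dec (cov y v Data.Bool.≟ false))

    -- A piece enters the type as soon as one uncovered vertex of it is seen. Thus every neighbour
    -- lost by the type is covered, while two pieces in the type have uncovered witnesses and hence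
    -- are joined.
    type : Fin n → Vec Bool N
    type y = tabulate λ p → does (Fin.any? (free? y p))

    label : Fin n → Maybe (Fin N) → Label N
    label v (just p) = X p
    label v nothing  = Y (type v)

    φ : Fin n → Label N
    φ v = label v (code v)

    type-true : ∀ y p → lookup (type y) p ≡ true → ∃ (free y p)
    type-true y p e = does⇒ (Fin.any? (free? y p)) (trans (sym (Vec.lookup∘tabulate _ p)) e)

    type-clique : ∀ y → Valid r (Y (type y))
    type-clique y p q ep eq with type-true y p ep | type-true y q eq
    ... | v , cv , yv , nv | w , cw , yw , nw with true-or-false (r p q)
    ...   | inj₁ t = t
    ...   | inj₂ f = ⊥-elim ([ (λ c → contradiction (trans (sym nv) c) false≢true) , (λ c → contradiction (trans (sym nw) c) false≢true) ]′
              (proj₁ (proj₂ (cover y)) v w (NonEdges-intro (nbr y) zz (∧-intro (code-inX cv) yv) (∧-intro (code-inX cw) yw)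
                (trans (cong₂ E (z≡rep cv) (z≡rep cw)) f))))

    φ-valid : ∀ v → Valid r (φ v)
    φ-valid v with code v
    ... | just p  = tt
    ... | nothing = type-clique v

    V² : List (Fin n × Fin n)
    V² = pairs V V

    sparseY : Fin n × Fin n → Bool
    sparseY (u , v) = inY u ∧ (inY v ∧ E u v)
    crossing : Fin n × Fin n → Bool
    crossing (u , v) = inY u ∧ cov u v

    code-inY : ∀ {v} → code v ≡ nothing → inY v ≡ true
    code-inY {v} e = lem (κ v) e
      where
      lem : ∀ c → Data.Maybe.map (λ i → piece i v) c ≡ nothing → IsRest Q c ≡ true
      lem nothing _ = refl

    uncovered : ∀ y w {p} → code w ≡ just p → E y w ≡ true → not (lookup (type y) p) ≡ true → cov y w ≡ true
    uncovered y w {p} cw yw nl with true-or-false (cov y w)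
    ... | inj₁ t = t
    ... | inj₂ f = contradiction (trans (sym (not-true nl)) (trans (Vec.lookup∘tabulate _ p)
            (dec-true (Fin.any? (free? y p)) (w , cw , yw , f)))) false≢true

    one : ∀ {b} → b ≡ true → 1 ≤ 𝟙 b
    one refl = ≤-refl

    -- Each violation is charged by the kinds of its two labels: two clique vertices form a bad
    -- pair, two vertices of the rest an edge inside it, and in a mixed pair the clique vertex lies
    -- in the cover of the other one.
    viol-bound′ : ∀ u v cu cv → code u ≡ cu → code v ≡ cv → E u v ≡ adj H u v →
      𝟙 (viol r (label u cu) (label v cv) (just (adj H u v))) ≤
      𝟙 (bad (u , v)) + (𝟙 (sparseY (u , v)) + (𝟙 (crossing (u , v)) + 𝟙 (crossing (v , u))))
    viol-bound′ u v (just p) (just q) cu cv uv = 𝟙-≤ _ λ e → ≤-trans (one (∧-intro (code-inX cu) (∧-intro (code-inX cv)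
      (trans (cong₂ xor uv (cong₂ E (z≡rep cu) (z≡rep cv))) e)))) (m≤m+n _ _)
    viol-bound′ u v nothing nothing cu cv uv = 𝟙-≤ _ λ e → ≤-trans
      (one (∧-intro (code-inY cu) (∧-intro (code-inY cv) (trans uv e)))) (≤-trans (m≤m+n _ _) (m≤n+m _ (𝟙 (bad (u , v)))))
    viol-bound′ u v nothing (just q) cu cv uv = 𝟙-≤ _ λ e → ≤-trans
      (one (∧-intro (code-inY cu) (uncovered u v cv (trans uv (∧-fst e)) (∧-snd {adj H u v} e))))
      (≤-trans (m≤m+n _ _) (≤-trans (m≤n+m _ (𝟙 (sparseY (u , v)))) (m≤n+m _ (𝟙 (bad (u , v))))))
    viol-bound′ u v (just p) nothing cu cv uv = 𝟙-≤ _ λ e → ≤-trans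
      (one (∧-intro (code-inY cv) (uncovered v u cu (trans (E-sym v u) (trans uv (∧-fst e))) (∧-snd {adj H u v} e))))
      (≤-trans (m≤n+m _ (𝟙 (crossing (u , v)))) (≤-trans (m≤n+m _ (𝟙 (sparseY (u , v)))) (m≤n+m _ (𝟙 (bad (u , v))))))

    viol-bound : ∀ u v → 𝟙 (viol r (φ u) (φ v) (obs H u v)) ≤
      𝟙 (bad (u , v)) + (𝟙 (sparseY (u , v)) + (𝟙 (crossing (u , v)) + 𝟙 (crossing (v , u))))
    viol-bound u v = case u Fin.≟ v of λ
      { (yes e) → ≤-trans (≤-reflexive (cong 𝟙 (cong (viol r (φ u) (φ v))
                    (trans (cong (obs H u) (sym e)) (obs-≡ H u))))) z≤n
      ; (no ne) → ≤-trans (≤-reflexive (cong 𝟙 (cong (viol r (φ u) (φ v)) (obs-≢ H ne))))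
                    (viol-bound′ u v (code u) (code v) refl refl (E-≢ ne)) }

    length-V : length V ≡ n
    length-V = length-allFin n

    -- `Bad-few` loses a factor Q² for the pairs of cliques; `m` contains this factor and leaves D².
    bad-few : D * D * # V² bad ≤ 8 * (n * n)
    bad-few = *-cancelˡ-≤ (Q * Q) {{m*n≢0 Q Q}} (begin
      Q * Q * (D * D * # V² bad)    ≡⟨ *-assoc (Q * Q) (D * D) (# V² bad) ⟨
      Q * Q * (D * D) * # V² bad    ≡⟨ cong (_* # V² bad) m≡ ⟨
      m * # V² bad                  ≤⟨ Bad-few z (λ v kv → proj₁ (z-piece kv)) (λ j v kv → proj₂ (z-piece kv) j) ⟩
      8 * (Q * Q) * (n * n)         ≡⟨ lem (Q * Q) (n * n) ⟩
      Q * Q * (8 * (n * n))         ∎)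
      where
      lem : ∀ a b → 8 * a * b ≡ a * (8 * b)
      lem = solve-∀

    -- The covers are bounded only in total over `y`: exchanging the sums fixes the pair first,
    -- where few `y` can see both of its ends.
    NonEdgeSum : ℕ
    NonEdgeSum = ∑ V λ y → ∑ V² λ p → 𝟙 (inY y ∧ B y (proj₁ p) (proj₂ p))

    common : Fin n × Fin n → Fin n → Bool
    common (v , w) y = not (E v w) ∧ (inY y ∧ (E v y ∧ E w y))

    common-small : ∀ p → Q * # V (common p) ≤ n
    common-small (v , w) with true-or-false (E v w)
    ... | inj₁ t = ≤-trans (≤-reflexive (trans (cong (Q *_) (∑-zero V λ y → cong (λ b → 𝟙 (not b ∧ (inY y ∧ (E v y ∧ E w y)))) t)) (*-zeroʳ Q))) z≤n
    ... | inj₂ f = small (common (v , w)) (λ y e → ∧-fst (∧-snd {not (E v w)} e))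
      (common-clique v w f λ y e → let c = ∧-snd {inY y} (∧-snd {not (E v w)} e) in ∧-fst c , ∧-snd {E v y} c)

    -- If v and w are adjacent although their representatives are not, the pair is bad. Otherwise
    -- `y` is a common neighbour in the rest of two non-adjacent vertices, and these form a small
    -- clique.
    nonEdge-bound : ∀ y p → 𝟙 (inY y ∧ B y (proj₁ p) (proj₂ p)) ≤ 𝟙 (common p y) + 𝟙 (bad p)
    nonEdge-bound y (v , w) = 𝟙-≤ _ λ e →
      let nv , nw , f = NonEdges-elim (nbr y) zz v w (∧-snd {inY y} e)
      in case true-or-false (E v w) of λ
        { (inj₁ t) → ≤-trans (one (∧-intro (∧-fst {not (inY v)} nv) (∧-intro (∧-fst {not (inY w)} nw) (cong₂ xor t f)))) (m≤n+m _ (𝟙 (common (v , w) y)))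
        ; (inj₂ g) → ≤-trans (one (∧-intro (cong not g) (∧-intro (∧-fst {inY y} e)
             (∧-intro (trans (E-sym v y) (∧-snd {not (inY v)} nv)) (trans (E-sym w y) (∧-snd {not (inY w)} nw)))))) (m≤m+n _ _) }

    nonEdgeSum-bound : Q * NonEdgeSum ≤ n * n * n + Q * (n * # V² bad)
    nonEdgeSum-bound = begin
      Q * NonEdgeSum
        ≤⟨ *-monoʳ-≤ Q (∑-mono V λ y → ∑-mono V² (nonEdge-bound y)) ⟩
      Q * ∑ V (λ y → ∑ V² λ p → 𝟙 (common p y) + 𝟙 (bad p))
        ≡⟨ cong (Q *_) (trans (∑-cong V λ y → ∑-+ V² _ _) (trans (∑-+ V _ _) (cong₂ _+_ (∑-swap V V² _)
             (trans (∑-const V (# V² bad)) (cong (_* # V² bad) length-V))))) ⟩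
      Q * (∑ V² (λ p → # V (common p)) + n * # V² bad)
        ≡⟨ trans (*-distribˡ-+ Q _ _) (cong (_+ Q * (n * # V² bad)) (sym (∑-*ˡ V² Q _))) ⟩
      ∑ V² (λ p → Q * # V (common p)) + Q * (n * # V² bad)
        ≤⟨ +-monoˡ-≤ _ (∑-≤const V² n common-small) ⟩
      length V² * n + Q * (n * # V² bad)
        ≡⟨ cong (λ l → l * n + Q * (n * # V² bad)) (trans (length-pairs V V) (cong₂ _*_ length-V length-V)) ⟩
      n * n * n + Q * (n * # V² bad) ∎

    nonEdges-few : D * D * NonEdgeSum ≤ 9 * (n * n * n)
    nonEdges-few = *-cancelˡ-≤ D (begin
      D * (D * D * NonEdgeSum)                      ≡⟨ trans (sym (*-assoc D (D * D) _)) (cong (_* NonEdgeSum) (trans (*-comm D (D * D)) (sym Q≡))) ⟩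
      Q * NonEdgeSum                                ≤⟨ nonEdgeSum-bound ⟩
      n * n * n + Q * (n * # V² bad)                ≡⟨ cong (λ q → n * n * n + q * (n * # V² bad)) Q≡ ⟩
      n * n * n + D * D * D * (n * # V² bad)        ≡⟨ lem₁ D n (# V² bad) ⟩
      n * n * n + D * n * (D * D * # V² bad)        ≤⟨ +-mono-≤ (m≤n*m (n * n * n) D) (*-monoʳ-≤ (D * n) bad-few) ⟩
      D * (n * n * n) + D * n * (8 * (n * n))       ≡⟨ lem₂ D n ⟩
      D * (9 * (n * n * n))                         ∎)
      where
      lem₁ : ∀ d n b → n * n * n + d * d * d * (n * b) ≡ n * n * n + d * n * (d * d * b)
      lem₁ = solve-∀
      lem₂ : ∀ d n → d * (n * n * n) + d * n * (8 * (n * n)) ≡ d * (9 * (n * n * n))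
      lem₂ = solve-∀

    crossing-few : D * # V² crossing ≤ 11 * (n * n)
    crossing-few = *-cancelˡ-≤ n (begin
      n * (D * # V² crossing)                                 ≡⟨ *-assoc n D _ ⟨
      n * D * # V² crossing                                   ≡⟨ cong (n * D *_) (∑-pairs V V _) ⟩
      n * D * ∑ V (λ y → # V (λ v → inY y ∧ cov y v))         ≡⟨ ∑-*ˡ V (n * D) _ ⟨
      ∑ V (λ y → n * D * # V (λ v → inY y ∧ cov y v))         ≤⟨ ∑-mono V row ⟩
      ∑ V (λ y → D * D * ∑ V² (λ p → 𝟙 (inY y ∧ B y (proj₁ p) (proj₂ p))) + 2 * (n * n))
        ≡⟨ trans (∑-+ V _ _) (cong₂ _+_ (∑-*ˡ V (D * D) _) (trans (∑-const V _) (cong (_* (2 * (n * n))) length-V))) ⟩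
      D * D * NonEdgeSum + n * (2 * (n * n))                  ≤⟨ +-monoˡ-≤ _ nonEdges-few ⟩
      9 * (n * n * n) + n * (2 * (n * n))                     ≡⟨ lem n ⟩
      n * (11 * (n * n))                                      ∎)
      where
      lem : ∀ n → 9 * (n * n * n) + n * (2 * (n * n)) ≡ n * (11 * (n * n))
      lem = solve-∀
      row : ∀ y → n * D * # V (λ v → inY y ∧ cov y v) ≤
                  D * D * ∑ V² (λ p → 𝟙 (inY y ∧ B y (proj₁ p) (proj₂ p))) + 2 * (n * n)
      row y = lem′ (inY y)
        where
        lem′ : ∀ b → n * D * # V (λ v → b ∧ cov y v) ≤ D * D * ∑ V² (λ p → 𝟙 (b ∧ B y (proj₁ p) (proj₂ p))) + 2 * (n * n)
        lem′ true  = subst (λ x → n * D * # V (cov y) ≤ D * D * x + 2 * (n * n)) (sym (∑-pairs V V _)) (proj₂ (proj₂ (cover y)))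
        lem′ false = ≤-trans (≤-reflexive (trans (cong (n * D *_) (∑-zero V λ _ → refl)) (*-zeroʳ (n * D)))) z≤n

    -- In units of n²/D: 8 for bad pairs, 9 for edges inside the rest, and 11 for covered neighbours
    -- in each order, where 11 = 9 + 2 collects the two terms of the vertex cover bound.
    cost-small : D * cost r H φ ≤ 39 * (n * n)
    cost-small = begin
      D * cost r H φ
        ≤⟨ *-monoʳ-≤ D (∑-mono V λ u → ∑-mono V (viol-bound u)) ⟩
      D * ∑ V (λ u → ∑ V λ v → 𝟙 (bad (u , v)) + (𝟙 (sparseY (u , v)) + (𝟙 (crossing (u , v)) + 𝟙 (crossing (v , u)))))
        ≡⟨ cong (D *_) (trans (split (λ u v → 𝟙 (bad (u , v))) _) (cong₂ _+_ (sym (∑-pairs V V (𝟙 ∘ bad)))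
             (trans (split (λ u v → 𝟙 (sparseY (u , v))) _) (cong (σ +_)
               (trans (split (λ u v → 𝟙 (crossing (u , v))) _) (cong₂ _+_ (sym (∑-pairs V V (𝟙 ∘ crossing)))
                 (trans (∑-swap V V _) (sym (∑-pairs V V (𝟙 ∘ crossing)))))))))) ⟩
      D * (# V² bad + (σ + (# V² crossing + # V² crossing)))
        ≡⟨ lem D (# V² bad) σ (# V² crossing) ⟩
      D * # V² bad + (D * σ + (D * # V² crossing + D * # V² crossing))
        ≤⟨ +-mono-≤ (≤-trans (*-monoˡ-≤ (# V² bad) (m≤m*m D)) bad-few) (+-mono-≤ sparse (+-mono-≤ crossing-few crossing-few)) ⟩
      8 * (n * n) + (9 * (n * n) + (11 * (n * n) + 11 * (n * n)))
        ≡⟨ lem′ (n * n) ⟩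
      39 * (n * n) ∎
      where
      σ : ℕ
      σ = ∑ V λ u → ∑ V λ v → 𝟙 (sparseY (u , v))
      split : ∀ (f g : Fin n → Fin n → ℕ) → ∑ V (λ u → ∑ V λ v → f u v + g u v) ≡
              ∑ V (λ u → ∑ V (f u)) + ∑ V (λ u → ∑ V (g u))
      split f g = trans (∑-cong V λ u → ∑-+ V (f u) (g u)) (∑-+ V _ _)
      lem : ∀ d a b c → d * (a + (b + (c + c))) ≡ d * a + (d * b + (d * c + d * c))
      lem = solve-∀
      lem′ : ∀ x → 8 * x + (9 * x + (11 * x + 11 * x)) ≡ 39 * x
      lem′ = solve-∀

  approximation : ¬ ¬ (∃ λ (r : Fin N → Fin N → Bool) → ∃ λ (φ : Fin n → Label N) →
                       Template r × (∀ v → Valid r (φ v)) × D * cost r H φ ≤ 39 * (n * n))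
  approximation done = extractCliques Q λ (κ , proper , small) → let open FromCliques κ proper small in
    done (r , φ , template , φ-valid , cost-small)

-- Edit distance and the cost of labellings

module _ {n : ℕ} where

  private
    V = allFin n

  diff : Graph n → Graph n → Fin n → Fin n → Bool
  diff G H u v = xor (adj G u v) (adj H u v)

  xor-false : ∀ a b → xor a b ≡ false → a ≡ b
  xor-false true  true  _ = refl
  xor-false false false _ = refl

  diff-irrefl : ∀ (G H : Graph n) v → diff G H v v ≡ false
  diff-irrefl G H v = cong₂ xor (adj-irrefl G v) (adj-irrefl H v)

  editCount≡∑ : ∀ (G H : Graph n) → editCount G H ≡
    ∑ V λ u → ∑ V λ v → 𝟙 (does (toℕ u <? toℕ v)) * 𝟙 (diff G H u v)
  editCount≡∑ G H = trans (length-filter≡∑ _ (concatMap _ V)) (trans (∑-concatMap _ V _)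
    (∑-cong V λ u → trans (∑-map (u ,_) (filter (λ j → toℕ u <? toℕ j) V) _)
      (trans (∑-filter (λ j → toℕ u <? toℕ j) V _)
        (∑-cong V λ v → cong (λ b → 𝟙 (does (toℕ u <? toℕ v)) * 𝟙 b) (≟true (diff G H u v))))))
    where
    ≟true : ∀ b → does (b Data.Bool.≟ true) ≡ b
    ≟true true  = refl
    ≟true false = refl

  2editCount≡∑ : ∀ (G H : Graph n) → 2 * editCount G H ≡ ∑ V λ u → ∑ V λ v → 𝟙 (diff G H u v)
  2editCount≡∑ G H = begin
    2 * editCount G H          ≡⟨ cong (λ c → 2 * c) (editCount≡∑ G H) ⟩
    2 * ∑∑                     ≡⟨ cong (∑∑ +_) (+-identityʳ ∑∑) ⟩
    ∑∑ + ∑∑                    ≡⟨ cong (∑∑ +_) (∑-swap V V _) ⟩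
    ∑∑ + (∑ V λ u → ∑ V λ v → 𝟙 (does (toℕ v <? toℕ u)) * 𝟙 (diff G H v u))
      ≡⟨ trans (sym (∑-+ V _ _)) (∑-cong V λ u → trans (sym (∑-+ V _ _)) (∑-cong V λ v → pointwise u v)) ⟩
    ∑ V (λ u → ∑ V λ v → 𝟙 (diff G H u v)) ∎
    where
    open ≡-Reasoning
    ∑∑ : ℕ
    ∑∑ = ∑ V λ u → ∑ V λ v → 𝟙 (does (toℕ u <? toℕ v)) * 𝟙 (diff G H u v)
    pointwise : ∀ u v → 𝟙 (does (toℕ u <? toℕ v)) * 𝟙 (diff G H u v) + 𝟙 (does (toℕ v <? toℕ u)) * 𝟙 (diff G H v u)
                ≡ 𝟙 (diff G H u v)
    pointwise u v rewrite adj-sym G v u | adj-sym H v u with <-cmp (toℕ u) (toℕ v)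
    ... | tri< lt _ ≯ rewrite dec-true (toℕ u <? toℕ v) lt | dec-false (toℕ v <? toℕ u) ≯ = trans (+-identityʳ _) (+-identityʳ _)
    ... | tri> ≮ _ gt rewrite dec-false (toℕ u <? toℕ v) ≮ | dec-true (toℕ v <? toℕ u) gt = +-identityʳ _
    ... | tri≈ ≮ eq ≯ rewrite dec-false (toℕ u <? toℕ v) ≮ | dec-false (toℕ v <? toℕ u) ≯ =
      sym (cong 𝟙 (trans (cong (diff G H u) (sym (Fin.toℕ-injective eq))) (diff-irrefl G H u)))

  -- Lets a labelling found for the nearest induced C₄-free graph be charged against the input
  -- graph.
  cost-edit : ∀ {N} (r : Fin N → Fin N → Bool) (G H : Graph n) φ →
              cost r G φ ≤ 2 * editCount G H + cost r H φ
  cost-edit r G H φ = begin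
    cost r G φ                         ≤⟨ ∑-mono V (λ u → ∑-mono V λ v → pointwise u v) ⟩
    ∑ V (λ u → ∑ V λ v → 𝟙 (diff G H u v) + 𝟙 (viol r (φ u) (φ v) (obs H u v)))
                                       ≡⟨ trans (∑-cong V λ u → ∑-+ V _ _) (∑-+ V _ _) ⟩
    ∑ V (λ u → ∑ V λ v → 𝟙 (diff G H u v)) + cost r H φ ≡⟨ cong (_+ cost r H φ) (2editCount≡∑ G H) ⟨
    2 * editCount G H + cost r H φ     ∎
    where
    open ≤-Reasoning
    pointwise : ∀ u v → 𝟙 (viol r (φ u) (φ v) (obs G u v)) ≤ 𝟙 (diff G H u v) + 𝟙 (viol r (φ u) (φ v) (obs H u v))
    pointwise u v with true-or-false (diff G H u v)
    ... | inj₁ t rewrite t = ≤-trans (𝟙≤1 (viol r (φ u) (φ v) (obs G u v))) (m≤m+n 1 _)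
    ... | inj₂ f rewrite f | xor-false (adj G u v) (adj H u v) f = ≤-refl

  module Realisation {N} (r : Fin N → Fin N → Bool) (t : Template r) (G : Graph n)
    (φ : Fin n → Label N) (valid : ∀ v → Valid r (φ v)) where

    open Template t

    edge : Label N → Label N → Bool → Bool
    edge (X p) (X q) g = r p q
    edge (X p) (Y I) g = g ∧ lookup I p
    edge (Y I) (X p) g = g ∧ lookup I p
    edge (Y I) (Y J) g = false

    edge-sym : ∀ a b g → edge a b g ≡ edge b a g
    edge-sym (X p) (X q) g = r-sym p q
    edge-sym (X p) (Y I) g = refl
    edge-sym (Y I) (X p) g = refl
    edge-sym (Y I) (Y J) g = refl

    S-adj : Fin n → Fin n → Bool
    S-adj u v = not (does (u Fin.≟ v)) ∧ edge (φ u) (φ v) (adj G u v)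

    S-≢ : ∀ {u v} → u ≢ v → S-adj u v ≡ edge (φ u) (φ v) (adj G u v)
    S-≢ {u} {v} ne = cong (λ b → not b ∧ edge (φ u) (φ v) (adj G u v)) (dec-false (u Fin.≟ v) ne)

    S-irrefl : ∀ v → S-adj v v ≡ false
    S-irrefl v = cong (λ b → not b ∧ edge (φ v) (φ v) (adj G v v)) (dec-true (v Fin.≟ v) refl)

    S-sym : ∀ u v → S-adj u v ≡ S-adj v u
    S-sym u v = case u Fin.≟ v of λ
      { (yes refl) → refl
      ; (no ne) → trans (S-≢ ne) (trans (edge-sym (φ u) (φ v) _)
          (trans (cong (edge (φ v) (φ u)) (adj-sym G u v)) (sym (S-≢ (ne ∘ sym))))) }

    S : Graph n
    S = record { adj = S-adj ; sym = S-sym ; irrefl = S-irrefl }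

    -- A square of labels only: the adjacency bits of the input are arbitrary and labels may repeat,
    -- so the case analysis never mentions vertices.
    Square : (a b c d : Label N) → Set
    Square a b c d = ∃ λ g₁ → ∃ λ g₂ → ∃ λ g₃ → ∃ λ g₄ → ∃ λ g₅ → ∃ λ g₆ →
      edge a b g₁ ≡ true × edge b c g₂ ≡ true × edge c d g₃ ≡ true × edge d a g₄ ≡ true ×
      edge a c g₅ ≡ false × edge b d g₆ ≡ false

    rotate : ∀ {a b c d} → Square a b c d → Square b c d a
    rotate {a} {b} {c} {d} (g₁ , g₂ , g₃ , g₄ , g₅ , g₆ , ab , bc , cd , da , ac , bd) =
      g₂ , g₃ , g₄ , g₁ , g₆ , g₅ , bc , cd , da , ab , bd , trans (edge-sym c a g₅) ac

    -- The two neighbours on the square of a vertex of the independent part lie in adjacent cliques.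
    no-Y : ∀ I b c d → Valid r (Y I) → ¬ Square (Y I) b c d
    no-Y I (X p) c (X q) val (g₁ , g₂ , g₃ , g₄ , g₅ , g₆ , ab , bc , cd , da , ac , bd) =
      contradiction (trans (sym bd) (val p q (∧-snd {g₁} ab) (∧-snd {g₄} da))) false≢true

    -- A rotation brings any label of the independent part to the first corner. Four clique labels
    -- are left to `r-noC4`, which also covers repeated ones.
    no-square : ∀ a b c d → Valid r a → Valid r b → Valid r c → Valid r d → ¬ Square a b c d
    no-square (Y I) b c d va vb vc vd sq = no-Y I b c d va sq
    no-square a (Y I) c d va vb vc vd sq = no-Y I c d a vb (rotate {a} sq)
    no-square a b (Y I) d va vb vc vd sq = no-Y I d a b vc (rotate {b} (rotate {a} sq))
    no-square a b c (Y I) va vb vc vd sq = no-Y I a b c vd (rotate {c} (rotate {b} (rotate {a} sq)))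
    no-square (X p) (X q) (X o) (X s) _ _ _ _ (_ , _ , _ , _ , _ , _ , ab , bc , cd , da , ac , bd) with r-noC4 p q o s ab bc cd da
    ... | inj₁ e = contradiction (trans (sym ac) e) false≢true
    ... | inj₂ e = contradiction (trans (sym bd) e) false≢true

    S-C4-free : InducedC4Free S
    S-C4-free (a , b , c , d , a≢b , a≢c , a≢d , b≢c , b≢d , c≢d , ab , bc , cd , da , ac , bd) =
      no-square (φ a) (φ b) (φ c) (φ d) (valid a) (valid b) (valid c) (valid d)
        (_ , _ , _ , _ , _ , _ , trans (sym (S-≢ a≢b)) ab , trans (sym (S-≢ b≢c)) bc , trans (sym (S-≢ c≢d)) cd ,
         trans (sym (S-≢ (a≢d ∘ sym))) da , trans (sym (S-≢ a≢c)) ac , trans (sym (S-≢ b≢d)) bd)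

    edit≤cost : 2 * editCount G S ≤ cost r G φ
    edit≤cost = ≤-trans (≤-reflexive (2editCount≡∑ G S)) (∑-mono V λ u → ∑-mono V λ v → 𝟙-mono (pointwise u v))
      where
      by-labels : ∀ a b g → xor g (edge a b g) ≡ true → viol r a b (just g) ≡ true
      by-labels (X p) (X q) g     e = e
      by-labels (X p) (Y I) true  e = e
      by-labels (Y I) (X p) true  e = e
      by-labels (Y I) (Y J) true  e = refl
      pointwise : ∀ u v → diff G S u v ≡ true → viol r (φ u) (φ v) (obs G u v) ≡ true
      pointwise u v e = case u Fin.≟ v of λ
        { (yes refl) → contradiction (trans (sym (diff-irrefl G S u)) e) false≢true
        ; (no ne) → subst (λ o → viol r (φ u) (φ v) o ≡ true) (sym (obs-≢ G ne))
            (by-labels (φ u) (φ v) (adj G u v) (trans (cong (xor (adj G u v)) (sym (S-≢ ne))) e)) }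

  -- Holds for every valid labelling, however it arose. This protects against underestimates: even a
  -- wrong hypothesis describes an induced C₄-free graph.
  2dist≤cost : ∀ {N} {r : Fin N → Fin N → Bool} → Template r → ∀ (G : Graph n) {k} → IsMinDistC4 G k →
               ∀ φ → (∀ v → Valid r (φ v)) → 2 * k ≤ cost r G φ
  2dist≤cost {r = r} t G (_ , least) φ valid = ≤-trans (*-monoʳ-≤ 2 (least S S-C4-free)) edit≤cost
    where open Realisation r t G φ valid

-- Greedy recolouring from samples

open Extrema ≤-totalOrder using (argmin; argmin-all; f[argmin]≤f[xs])

∑-δ* : ∀ {k} (i : Fin k) (f : Fin k → ℕ) → ∑ (allFin k) (λ j → 𝟙 (does (j Fin.≟ i)) * f j) ≡ f i
∑-δ* {k} i f = trans (∑-cong (allFin k) pointwise) (trans (∑-*ʳ (allFin k) (f i) _) (trans (cong (_* f i) (∑-δ i)) (*-identityˡ (f i))))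
  where
  pointwise : ∀ j → 𝟙 (does (j Fin.≟ i)) * f j ≡ 𝟙 (does (j Fin.≟ i)) * f i
  pointwise j with j Fin.≟ i
  ... | yes refl = refl
  ... | no _     = refl

bools : List Bool
bools = true ∷ false ∷ []

∈-bools : ∀ b → b ∈ bools
∈-bools true  = here refl
∈-bools false = there (here refl)

module _ {N : ℕ} where

  allLabels : List (Label N)
  allLabels = map X (allFin N) ++ map Y (vecs bools N)

  ∈-allLabels : ∀ a → a ∈ allLabels
  ∈-allLabels (X p) = ∈.∈-++⁺ˡ (∈.∈-map⁺ X (∈.∈-allFin p))
  ∈-allLabels (Y I) = ∈.∈-++⁺ʳ (map X (allFin N)) (∈.∈-map⁺ Y (∈-vecs I λ i → ∈-bools (lookup I i)))

  length-allLabels : length allLabels ≡ N + 2 ^ N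
  length-allLabels = trans (List.length-++ (map X (allFin N))) (cong₂ _+_
    (trans (List.length-map X (allFin N)) (length-allFin N))
    (trans (List.length-map Y (vecs bools N)) (length-vecs bools N)))

  valid? : ∀ r (a : Label N) → Dec (Valid r a)
  valid? r (X p) = yes tt
  valid? r (Y I) = Fin.all? λ p → Fin.all? λ q →
    (lookup I p Data.Bool.≟ true) →-dec ((lookup I q Data.Bool.≟ true) →-dec (r p q Data.Bool.≟ true))

  score : (Fin N → Fin N → Bool) → ∀ {s} → Vec (Label N) s → Vec (Maybe Bool) s → Label N → ℕ
  score r ℓ os a = ∑ (toList (Vec.zip ℓ os)) λ (b , o) → 𝟙 (viol r a b o)

  -- The starting value of `argmin`: joined to no clique, it is valid for every relation.
  Y∅ : Label N
  Y∅ = Y (Vec.replicate N false)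

  Y∅-valid : ∀ r → Valid r Y∅
  Y∅-valid r p q e = contradiction (trans (sym (Vec.lookup-replicate p false)) e) false≢true

  abstract
    -- Depends on the whole labelling only through the labels of the sample, so guessing these few
    -- labels is enough to simulate it.
    greedy : (Fin N → Fin N → Bool) → ∀ {s} → Vec (Label N) s → Vec (Maybe Bool) s → Label N
    greedy r ℓ os = argmin (score r ℓ os) Y∅ (filter (valid? r) allLabels)

    greedy-valid : ∀ r {s} (ℓ : Vec (Label N) s) os → Valid r (greedy r ℓ os)
    greedy-valid r ℓ os = argmin-all (score r ℓ os) (Y∅-valid r) (All.all-filter (valid? r) allLabels)

    greedy-minimal : ∀ r {s} (ℓ : Vec (Label N) s) os a → Valid r a → score r ℓ os (greedy r ℓ os) ≤ score r ℓ os a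
    greedy-minimal r ℓ os a va = All.lookup (f[argmin]≤f[xs] {f = score r ℓ os} Y∅ (filter (valid? r) allLabels))
      (∈.∈-filter⁺ (valid? r) (∈-allLabels a) va)

-- The cost of giving a label to a vertex is a sum of the counts of some of 2N + 1 test events, so good
-- estimates for these counts serve all N + 2 ^ N labels at once.
data Test (N : ℕ) : Set where
  tX : Fin N → Test N
  tN : Fin N → Test N
  tY : Test N

module Tests {N : ℕ} (r : Fin N → Fin N → Bool) where

  edge? : Maybe Bool → Bool
  edge? (just true) = true
  edge? _           = false

  holds : Test N → Label N → Maybe Bool → Bool
  holds (tX p) b     o = viol r (X p) b o
  holds (tN p) (X q) o = does (p Fin.≟ q) ∧ edge? o
  holds (tN p) (Y _) o = false
  holds tY     (X q) o = false
  holds tY     (Y _) o = edge? o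

  weight : Label N → Test N → ℕ
  weight (X p) (tX q) = 𝟙 (does (q Fin.≟ p))
  weight (X p) _      = 0
  weight (Y I) (tX q) = 0
  weight (Y I) (tN p) = 𝟙 (not (lookup I p))
  weight (Y I) tY     = 1

  weight≤1 : ∀ a τ → weight a τ ≤ 1
  weight≤1 (X p) (tX q) = 𝟙≤1 (does (q Fin.≟ p))
  weight≤1 (X p) (tN q) = z≤n
  weight≤1 (X p) tY     = z≤n
  weight≤1 (Y I) (tX q) = z≤n
  weight≤1 (Y I) (tN p) = 𝟙≤1 (not (lookup I p))
  weight≤1 (Y I) tY     = ≤-refl

  tests : List (Test N)
  tests = map tX (allFin N) ++ (map tN (allFin N) ++ (tY ∷ []))

  ∑-tests : ∀ f → ∑ tests f ≡ ∑ (allFin N) (f ∘ tX) + (∑ (allFin N) (f ∘ tN) + f tY)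
  ∑-tests f = trans (∑-++ (map tX (allFin N)) _ f) (cong₂ _+_ (∑-map tX (allFin N) f)
    (trans (∑-++ (map tN (allFin N)) _ f) (cong₂ _+_ (∑-map tN (allFin N) f) (+-identityʳ (f tY)))))

  length-tests : length tests ≡ suc (N + N)
  length-tests = trans (length≡∑ tests) (trans (∑-tests _)
    (trans (cong (λ x → x + (x + 1)) (trans (sym (length≡∑ (allFin N))) (length-allFin N)))
      (trans (sym (+-assoc N N 1)) (+-comm (N + N) 1))))

  -- `X p` is priced by the single test `tX p`. The violations of `Y I` are its edges to cliques
  -- outside `I`, one test `tN p` each, and its edges to the independent part, `tY`.
  decompose : ∀ a b o → 𝟙 (viol r a b o) ≡ ∑ tests λ τ → weight a τ * 𝟙 (holds τ b o)
  decompose (X p) b o = sym (trans (∑-tests _) (trans (cong₂ _+_ (∑-δ* p λ q → 𝟙 (viol r (X q) b o))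
    (cong (_+ 0) (∑-zero (allFin N) λ _ → refl))) (+-identityʳ _)))
  decompose (Y I) b o = sym (trans (∑-tests _) (trans (cong (_+ rest) (∑-zero (allFin N) λ _ → refl)) (by-label b o)))
    where
    rest : ℕ
    rest = ∑ (allFin N) (λ p → 𝟙 (not (lookup I p)) * 𝟙 (holds (tN p) b o)) + 1 * 𝟙 (holds tY b o)
    none : ∀ (f : Fin N → ℕ) → ∑ (allFin N) (λ p → f p * 0) ≡ 0
    none f = ∑-zero (allFin N) λ p → *-zeroʳ (f p)
    by-label : ∀ b o → ∑ (allFin N) (λ p → 𝟙 (not (lookup I p)) * 𝟙 (holds (tN p) b o)) + 1 * 𝟙 (holds tY b o) ≡ 𝟙 (viol r (Y I) b o)
    by-label (X q) o = trans (+-identityʳ _) (trans (∑-cong (allFin N) λ p → lem (not (lookup I p)) (does (p Fin.≟ q)) (edge? o))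
      (trans (∑-δ* q λ p → 𝟙 (edge? o ∧ not (lookup I p))) (cong 𝟙 (final o))))
      where
      lem : ∀ a b c → 𝟙 a * 𝟙 (b ∧ c) ≡ 𝟙 b * 𝟙 (c ∧ a)
      lem true  true  true  = refl
      lem true  true  false = refl
      lem true  false c     = refl
      lem false true  true  = refl
      lem false true  false = refl
      lem false false c     = refl
      final : ∀ o → edge? o ∧ not (lookup I q) ≡ viol r (Y I) (X q) o
      final (just true)  = refl
      final (just false) = refl
      final nothing      = refl
    by-label (Y J) (just true)  = cong (_+ 1) (none λ p → 𝟙 (not (lookup I p)))
    by-label (Y J) (just false) = cong (_+ 0) (none λ p → 𝟙 (not (lookup I p)))
    by-label (Y J) nothing      = cong (_+ 0) (none λ p → 𝟙 (not (lookup I p)))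

viol-sym : ∀ {N} {r : Fin N → Fin N → Bool} → Template r → ∀ a b o → viol r a b o ≡ viol r b a o
viol-sym t a     b     nothing  = refl
viol-sym t (X p) (X q) (just g) = cong (xor g) (Template.r-sym t p q)
viol-sym t (X p) (Y I) (just g) = refl
viol-sym t (Y I) (X p) (just g) = refl
viol-sym t (Y I) (Y J) (just g) = refl

-- Compares a relabelling with its price against the old labels, rearranged to avoid subtraction.
-- The price is exact if at most one end changes; if both do, the three indicators on the left are
-- absorbed by `3 * k`, or vanish on the diagonal.
change-bound : ∀ {N} {r : Fin N → Fin N → Bool} → Template r → ∀ inU inV a a′ b b′ o k →
  (inU ≡ false → a′ ≡ a) → (inV ≡ false → b′ ≡ b) → (inU ≡ true → inV ≡ true → k ≡ 1 ⊎ o ≡ nothing) →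
  𝟙 (viol r a′ b′ o) + (𝟙 inU * 𝟙 (viol r a b o) + 𝟙 inV * 𝟙 (viol r b a o)) ≤
  𝟙 (viol r a b o) + (𝟙 inU * 𝟙 (viol r a′ b o) + 𝟙 inV * 𝟙 (viol r b′ a o)) + 3 * k
change-bound t false false a a′ b b′ o k a≡ b≡ both rewrite a≡ refl | b≡ refl = m≤m+n _ _
change-bound {r = r} t true false a a′ b b′ o k a≡ b≡ both rewrite b≡ refl =
  ≤-trans (≤-reflexive (lem (𝟙 (viol r a′ b o)) (𝟙 (viol r a b o)))) (m≤m+n _ _)
  where
  lem : ∀ x y → x + (1 * y + 0) ≡ y + (1 * x + 0)
  lem = solve-∀
change-bound {r = r} t false true a a′ b b′ o k a≡ b≡ both
  rewrite a≡ refl | viol-sym t b a o | viol-sym t b′ a o =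
  ≤-trans (≤-reflexive (lem (𝟙 (viol r a b′ o)) (𝟙 (viol r a b o)))) (m≤m+n _ _)
  where
  lem : ∀ x y → x + (0 + 1 * y) ≡ y + (0 + 1 * x)
  lem = solve-∀
change-bound {r = r} t true true a a′ b b′ o k a≡ b≡ both with both refl refl
... | inj₂ refl = z≤n
... | inj₁ refl = ≤-trans
  (+-mono-≤ (𝟙≤1 (viol r a′ b′ o)) (+-mono-≤ (≤-trans (≤-reflexive (*-identityˡ _)) (𝟙≤1 (viol r a b o)))
    (≤-trans (≤-reflexive (*-identityˡ _)) (𝟙≤1 (viol r b a o))))) (m≤n+m 3 _)

obs-sym : ∀ {n} (G : Graph n) u v → obs G u v ≡ obs G v u
obs-sym G u v = case u Fin.≟ v of λ
  { (yes refl) → refl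
  ; (no ne) → trans (obs-≢ G ne) (trans (cong just (adj-sym G u v)) (sym (obs-≢ G (ne ∘ sym)))) }

toList-zip-map : ∀ {A B C : Set} {k} (f : A → B) (g : A → C) (v : Vec A k) →
                 toList (Vec.zip (Vec.map f v) (Vec.map g v)) ≡ map (λ x → f x , g x) (toList v)
toList-zip-map f g []      = refl
toList-zip-map f g (x ∷ v) = cong ((f x , g x) ∷_) (toList-zip-map f g v)

module Recolouring {n N} {{n≢0 : NonZero n}} (G : Graph n) (r : Fin N → Fin N → Bool) (t : Template r)
  (h : ℕ) {{h≢0 : NonZero h}} (L : ℕ) {{L≢0 : NonZero L}} where

  open Tests r
  open ≤-Reasoning

  V : List (Fin n)
  V = allFin n

  -- `K / h` is the average increase of the cost allowed per recoloured vertex: 4n/h for each test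
  -- from sampling, and 3n/L from the other vertices of its block.
  s K : ℕ
  s = h * h
  K = 4 * length tests * n + 3 * h * (n / L)

  block : Fin n → ℕ
  block v = toℕ v / suc (n / L)

  step : ℕ → (Fin n → Label N) → Vec (Fin n) s → Fin n → Label N
  step l φ U v = if does (block v ≟ l) then greedy r (Vec.map φ U) (Vec.map (obs G v) U) else φ v

  step-in : ∀ l φ U v → block v ≡ l → step l φ U v ≡ greedy r (Vec.map φ U) (Vec.map (obs G v) U)
  step-in l φ U v e = cong (λ b → if b then greedy r (Vec.map φ U) (Vec.map (obs G v) U) else φ v) (dec-true (block v ≟ l) e)

  step-out : ∀ l φ U v → block v ≢ l → step l φ U v ≡ φ v
  step-out l φ U v ne = cong (λ b → if b then greedy r (Vec.map φ U) (Vec.map (obs G v) U) else φ v) (dec-false (block v ≟ l) ne)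

  step-valid : ∀ l φ U → (∀ v → Valid r (φ v)) → ∀ v → Valid r (step l φ U v)
  step-valid l φ U val v with block v ≟ l
  ... | yes e = subst (Valid r) (sym (step-in l φ U v e)) (greedy-valid r _ _)
  ... | no ne = subst (Valid r) (sym (step-out l φ U v ne)) (val v)

  module Step (l : ℕ) (φ : Fin n → Label N) (valid : ∀ v → Valid r (φ v)) where

    inB : Fin n → Bool
    inB v = does (block v ≟ l)

    c : Label N → Fin n → Fin n → ℕ
    c a v u = 𝟙 (viol r a (φ u) (obs G v u))

    total : Label N → Fin n → ℕ
    total a v = ∑ V (c a v)

    sampled : Label N → Fin n → Vec (Fin n) s → ℕ
    sampled a v U = ∑ (toList U) (c a v)

    score≡sampled : ∀ a v U → score r (Vec.map φ U) (Vec.map (obs G v) U) a ≡ sampled a v U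
    score≡sampled a v U = trans (cong (λ xs → ∑ xs λ (b , o) → 𝟙 (viol r a b o)) (toList-zip-map φ (obs G v) U))
      (∑-map _ (toList U) _)

    ct : Test N → Fin n → Fin n → ℕ
    ct τ v u = 𝟙 (holds τ (φ u) (obs G v u))

    ∑-decompose : ∀ a v xs → ∑ xs (c a v) ≡ ∑ tests λ τ → weight a τ * ∑ xs (ct τ v)
    ∑-decompose a v xs = trans (∑-cong xs λ u → decompose a (φ u) (obs G v u))
      (trans (∑-swap xs tests _) (∑-cong tests λ τ → ∑-*ˡ xs (weight a τ) _))

    module Smp (τ : Test N) (v : Fin n) = Sampling V (ct τ v) (λ u → 𝟙≤1 (holds τ (φ u) (obs G v u)))

    Err : Fin n → Vec (Fin n) s → ℕ
    Err v U = ∑ tests λ τ → Smp.deviation τ v U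

    weighted-≤ : ∀ a (f g e : Test N → ℕ) x y → (∀ τ → x * f τ ≤ y * g τ + e τ) →
                 x * ∑ tests (λ τ → weight a τ * f τ) ≤ y * ∑ tests (λ τ → weight a τ * g τ) + ∑ tests e
    weighted-≤ a f g e x y hyp = begin
      x * ∑ tests (λ τ → weight a τ * f τ)            ≡⟨ ∑-*ˡ tests x _ ⟨
      ∑ tests (λ τ → x * (weight a τ * f τ))          ≤⟨ ∑-mono tests (λ τ → lem τ) ⟩
      ∑ tests (λ τ → y * (weight a τ * g τ) + e τ)    ≡⟨ trans (∑-+ tests _ _) (cong (_+ ∑ tests e) (∑-*ˡ tests y _)) ⟩
      y * ∑ tests (λ τ → weight a τ * g τ) + ∑ tests e ∎
      where
      swap : ∀ x w f → x * (w * f) ≡ w * (x * f)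
      swap = solve-∀
      lem : ∀ τ → x * (weight a τ * f τ) ≤ y * (weight a τ * g τ) + e τ
      lem τ = begin
        x * (weight a τ * f τ)                 ≡⟨ swap x (weight a τ) (f τ) ⟩
        weight a τ * (x * f τ)                 ≤⟨ *-monoʳ-≤ (weight a τ) (hyp τ) ⟩
        weight a τ * (y * g τ + e τ)           ≡⟨ *-distribˡ-+ (weight a τ) _ _ ⟩
        weight a τ * (y * g τ) + weight a τ * e τ ≤⟨ +-mono-≤ (≤-reflexive (swap (weight a τ) y (g τ)))
                                                    (≤-trans (*-monoˡ-≤ (e τ) (weight≤1 a τ)) (≤-reflexive (*-identityˡ (e τ)))) ⟩
        y * (weight a τ * g τ) + e τ           ∎

    total≤sampled : ∀ a v U → s * total a v ≤ n * sampled a v U + Err v U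
    total≤sampled a v U = subst₂ (λ x y → s * x ≤ n * y + Err v U) (sym (∑-decompose a v V)) (sym (∑-decompose a v (toList U)))
      (weighted-≤ a _ _ _ s n λ τ → subst (λ l → s * ∑ V (ct τ v) ≤ l * ∑ (toList U) (ct τ v) + Smp.deviation τ v U)
        (length-allFin n) (m≤n+∣n-m∣ _ (length V * ∑ (toList U) (ct τ v))))

    sampled≤total : ∀ a v U → n * sampled a v U ≤ s * total a v + Err v U
    sampled≤total a v U = subst₂ (λ x y → n * y ≤ s * x + Err v U) (sym (∑-decompose a v V)) (sym (∑-decompose a v (toList U)))
      (weighted-≤ a _ _ _ n s λ τ → subst (λ l → l * ∑ (toList U) (ct τ v) ≤ s * ∑ V (ct τ v) + Smp.deviation τ v U)
        (length-allFin n) (m≤n+∣m-n∣ (length V * ∑ (toList U) (ct τ v)) _))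

    -- The old label competes in the minimisation, so the sample favours the new one; passing to the
    -- sample and back costs `Err v U` twice.
    step-total : ∀ U v → inB v ≡ true → s * total (step l φ U v) v ≤ s * total (φ v) v + 2 * Err v U
    step-total U v e = begin
      s * total (step l φ U v) v                     ≤⟨ total≤sampled (step l φ U v) v U ⟩
      n * sampled (step l φ U v) v U + Err v U       ≤⟨ +-monoˡ-≤ (Err v U) (*-monoʳ-≤ n best) ⟩
      n * sampled (φ v) v U + Err v U                ≤⟨ +-monoˡ-≤ (Err v U) (sampled≤total (φ v) v U) ⟩
      s * total (φ v) v + Err v U + Err v U          ≡⟨ lem (s * total (φ v) v) (Err v U) ⟩
      s * total (φ v) v + 2 * Err v U                ∎
      where
      lem : ∀ a b → a + b + b ≡ a + 2 * b
      lem = solve-∀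
      best : sampled (step l φ U v) v U ≤ sampled (φ v) v U
      best = begin
        sampled (step l φ U v) v U ≡⟨ cong (λ a → sampled a v U) (step-in l φ U v (does⇒ (block v ≟ l) e)) ⟩
        sampled (greedy r _ _) v U ≡⟨ score≡sampled _ v U ⟨
        score r (Vec.map φ U) (Vec.map (obs G v) U) (greedy r _ _) ≤⟨ greedy-minimal r (Vec.map φ U) (Vec.map (obs G v) U) (φ v) (valid v) ⟩
        score r (Vec.map φ U) (Vec.map (obs G v) U) (φ v) ≡⟨ score≡sampled (φ v) v U ⟩
        sampled (φ v) v U ∎

    clash : Fin n → Fin n → ℕ
    clash u v = 𝟙 (inB u ∧ (inB v ∧ not (does (u Fin.≟ v))))

    pointwise : ∀ U u v →
      𝟙 (viol r (step l φ U u) (step l φ U v) (obs G u v)) + (𝟙 (inB u) * c (φ u) u v + 𝟙 (inB v) * c (φ v) v u) ≤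
      𝟙 (viol r (φ u) (φ v) (obs G u v)) + (𝟙 (inB u) * c (step l φ U u) u v + 𝟙 (inB v) * c (step l φ U v) v u) + 3 * clash u v
    pointwise U u v rewrite obs-sym G v u = change-bound t (inB u) (inB v) (φ u) (step l φ U u) (φ v) (step l φ U v) (obs G u v) (clash u v)
      (λ e → step-out l φ U u (does-false (block u ≟ l) e)) (λ e → step-out l φ U v (does-false (block v ≟ l) e))
      (λ eu ev → case u Fin.≟ v of λ
        { (yes refl) → inj₂ (obs-≡ G u)
        ; (no ne) → inj₁ (𝟙≡1 (∧-intro eu (∧-intro ev (cong not (dec-false (u Fin.≟ v) ne))))) })

    size W : ℕ
    size = # V inB
    W    = ∑ V λ u → ∑ V λ v → clash u v

    length-V : length V ≡ n
    length-V = length-allFin n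

    block-size : size ≤ suc (n / L)
    block-size = #-bucket {n} (λ _ → true) toℕ (suc (n / L)) l λ u v _ _ → Fin.toℕ-injective

    -- Leaving out the diagonal removes exactly the 1 in the block size bound `suc (n / L)`. The
    -- remaining `n / L` needs no lower bound on `n`.
    clash-few : W ≤ size * (n / L)
    clash-few = ≤-trans (∑-mono V λ u → row u (inB u) refl) (≤-reflexive (∑-*ʳ V (n / L) _))
      where
      row : ∀ u b → inB u ≡ b → ∑ V (λ v → 𝟙 (b ∧ (inB v ∧ not (does (u Fin.≟ v))))) ≤ 𝟙 b * (n / L)
      row u false e = ≤-reflexive (∑-zero V λ _ → refl)
      row u true  e = ≤-trans (+-cancelʳ-≤ 1 _ _ (begin
          ∑ V (λ v → 𝟙 (inB v ∧ not (does (u Fin.≟ v)))) + 1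
            ≡⟨ cong (∑ V (λ v → 𝟙 (inB v ∧ not (does (u Fin.≟ v)))) +_) (∑-δ u) ⟨
          # V (λ v → inB v ∧ not (does (u Fin.≟ v))) + # V (λ v → does (v Fin.≟ u))
            ≤⟨ #-disjoint V _ _ inB (λ v → ∧-fst) (λ v p → subst (λ w → inB w ≡ true) (sym (does⇒ (v Fin.≟ u) p)) e)
                 (λ v p q → does-false (u Fin.≟ v) (not-true (∧-snd {inB v} p)) (sym (does⇒ (v Fin.≟ u) q))) ⟩
          size            ≤⟨ block-size ⟩
          suc (n / L)     ≡⟨ +-comm 1 (n / L) ⟩
          n / L + 1       ∎)) (≤-reflexive (sym (+-identityʳ (n / L))))

    P : (Fin n → Label N) → ℕ
    P ψ = ∑ V λ v → 𝟙 (inB v) * total (ψ v) v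

    cost-change : ∀ U → cost r G (step l φ U) + 2 * P φ ≤ cost r G φ + 2 * P (step l φ U) + 3 * W
    cost-change U = begin
      cost r G φ′ + 2 * P φ
        ≡⟨ cong (cost r G φ′ +_) (double φ) ⟨
      cost r G φ′ + ∑ V (λ u → ∑ V λ v → 𝟙 (inB u) * c (φ u) u v + 𝟙 (inB v) * c (φ v) v u)
        ≡⟨ split _ _ ⟨
      ∑ V (λ u → ∑ V λ v → 𝟙 (viol r (φ′ u) (φ′ v) (obs G u v)) + (𝟙 (inB u) * c (φ u) u v + 𝟙 (inB v) * c (φ v) v u))
        ≤⟨ ∑-mono V (λ u → ∑-mono V λ v → pointwise U u v) ⟩
      ∑ V (λ u → ∑ V λ v → 𝟙 (viol r (φ u) (φ v) (obs G u v)) + (𝟙 (inB u) * c (φ′ u) u v + 𝟙 (inB v) * c (φ′ v) v u) + 3 * clash u v)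
        ≡⟨ trans (split _ _) (cong₂ _+_ (split _ _) (trans (∑-cong V λ u → ∑-*ˡ V 3 _) (∑-*ˡ V 3 _))) ⟩
      cost r G φ + ∑ V (λ u → ∑ V λ v → 𝟙 (inB u) * c (φ′ u) u v + 𝟙 (inB v) * c (φ′ v) v u) + 3 * W
        ≡⟨ cong (λ x → cost r G φ + x + 3 * W) (double φ′) ⟩
      cost r G φ + 2 * P φ′ + 3 * W ∎
      where
      φ′ : Fin n → Label N
      φ′ = step l φ U
      split : ∀ (f g : Fin n → Fin n → ℕ) → ∑ V (λ u → ∑ V λ v → f u v + g u v) ≡
              ∑ V (λ u → ∑ V (f u)) + ∑ V (λ u → ∑ V (g u))
      split f g = trans (∑-cong V λ u → ∑-+ V (f u) (g u)) (∑-+ V _ _)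
      double : ∀ ψ → ∑ V (λ u → ∑ V λ v → 𝟙 (inB u) * c (ψ u) u v + 𝟙 (inB v) * c (ψ v) v u) ≡ 2 * P ψ
      double ψ = trans (split _ _) (trans (cong₂ _+_ (∑-cong V λ u → ∑-*ˡ V (𝟙 (inB u)) _)
        (trans (∑-swap V V _) (∑-cong V λ u → ∑-*ˡ V (𝟙 (inB u)) _))) (cong (P ψ +_) (sym (+-identityʳ (P ψ)))))

    R : Vec (Fin n) s → ℕ
    R U = ∑ V λ v → 𝟙 (inB v) * Err v U

    P-change : ∀ U → s * P (step l φ U) ≤ s * P φ + 2 * R U
    P-change U = begin
      s * P (step l φ U)    ≡⟨ ∑-*ˡ V s _ ⟨
      ∑ V (λ v → s * (𝟙 (inB v) * total (step l φ U v) v)) ≤⟨ ∑-mono V (λ v → row v (inB v) refl) ⟩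
      ∑ V (λ v → s * (𝟙 (inB v) * total (φ v) v) + 2 * (𝟙 (inB v) * Err v U))
                            ≡⟨ trans (∑-+ V _ _) (cong₂ _+_ (∑-*ˡ V s _) (∑-*ˡ V 2 _)) ⟩
      s * P φ + 2 * R U     ∎
      where
      row : ∀ v b → inB v ≡ b → s * (𝟙 b * total (step l φ U v) v) ≤ s * (𝟙 b * total (φ v) v) + 2 * (𝟙 b * Err v U)
      row v false e = ≤-trans (≤-reflexive (*-zeroʳ s)) z≤n
      row v true  e = subst₂ _≤_ (cong (s *_) (sym (*-identityˡ _)))
        (cong₂ _+_ (cong (s *_) (sym (*-identityˡ _))) (cong (2 *_) (sym (*-identityˡ (Err v U))))) (step-total U v e)

    step-cost : ∀ U → s * cost r G (step l φ U) ≤ s * cost r G φ + 4 * R U + 3 * (s * W)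
    step-cost U = +-cancelʳ-≤ (2 * (s * P φ)) _ _ (begin
      s * cost r G (step l φ U) + 2 * (s * P φ)              ≡⟨ lem₁ s (cost r G (step l φ U)) (P φ) ⟩
      s * (cost r G (step l φ U) + 2 * P φ)                  ≤⟨ *-monoʳ-≤ s (cost-change U) ⟩
      s * (cost r G φ + 2 * P (step l φ U) + 3 * W)          ≡⟨ lem₂ s (cost r G φ) (P (step l φ U)) W ⟩
      s * cost r G φ + 2 * (s * P (step l φ U)) + 3 * (s * W) ≤⟨ +-monoˡ-≤ (3 * (s * W)) (+-monoʳ-≤ (s * cost r G φ) (*-monoʳ-≤ 2 (P-change U))) ⟩
      s * cost r G φ + 2 * (s * P φ + 2 * R U) + 3 * (s * W) ≡⟨ lem₃ (s * cost r G φ) (s * P φ) (R U) (s * W) ⟩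
      s * cost r G φ + 4 * R U + 3 * (s * W) + 2 * (s * P φ) ∎)
      where
      lem₁ : ∀ s a b → s * a + 2 * (s * b) ≡ s * (a + 2 * b)
      lem₁ = solve-∀
      lem₂ : ∀ s a b c → s * (a + 2 * b + 3 * c) ≡ s * a + 2 * (s * b) + 3 * (s * c)
      lem₂ = solve-∀
      lem₃ : ∀ a b c d → a + 2 * (b + 2 * c) + 3 * d ≡ a + 4 * c + 3 * d + 2 * b
      lem₃ = solve-∀

    private instance
      hn≢0 : NonZero (h * n)
      hn≢0 = m*n≢0 h n

    -- With s = h² draws, the parameter h n makes the two terms of `averageDeviation` equal; sample
    -- sizes are squares for this reason.
    deviation-average : ∀ τ v → ∑ (vecs V s) (λ U → Smp.deviation τ v U) ≤ n ^ s * (h * n)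
    deviation-average τ v = *-cancelˡ-≤ (2 * (h * n)) {{m*n≢0 2 (h * n)}} (begin
      2 * (h * n) * ∑ (vecs V s) (λ U → Smp.deviation τ v U)      ≡⟨ ∑-*ˡ (vecs V s) (2 * (h * n)) _ ⟨
      ∑ (vecs V s) (λ U → 2 * (h * n) * Smp.deviation τ v U)      ≡⟨ ∑-cong (vecs V s) (λ U → *-assoc 2 (h * n) (Smp.deviation τ v U)) ⟩
      ∑ (vecs V s) (λ U → 2 * (h * n * Smp.deviation τ v U))      ≤⟨ subst (λ x → ∑ (vecs V s) (λ U → 2 * (h * n * Smp.deviation τ v U)) ≤ x ^ s * (h * n * (h * n) + s * (x * x))) length-V
                                                                      (Smp.averageDeviation τ v s (h * n)) ⟩
      n ^ s * (h * n * (h * n) + h * h * (n * n))                 ≡⟨ lem (n ^ s) h n ⟩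
      2 * (h * n) * (n ^ s * (h * n))                             ∎)
      where
      lem : ∀ x h n → x * (h * n * (h * n) + h * h * (n * n)) ≡ 2 * (h * n) * (x * (h * n))
      lem = solve-∀

    R-average : ∑ (vecs V s) R ≤ size * (length tests * (n ^ s * (h * n)))
    R-average = begin
      ∑ (vecs V s) R                                          ≡⟨ ∑-swap (vecs V s) V _ ⟩
      ∑ V (λ v → ∑ (vecs V s) λ U → 𝟙 (inB v) * Err v U)      ≡⟨ ∑-cong V (λ v → ∑-*ˡ (vecs V s) (𝟙 (inB v)) (Err v)) ⟩
      ∑ V (λ v → 𝟙 (inB v) * ∑ (vecs V s) (Err v))            ≤⟨ ∑-mono V (λ v → *-monoʳ-≤ (𝟙 (inB v)) (average v)) ⟩
      ∑ V (λ v → 𝟙 (inB v) * (length tests * (n ^ s * (h * n)))) ≡⟨ ∑-*ʳ V _ _ ⟩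
      size * (length tests * (n ^ s * (h * n)))               ∎
      where
      average : ∀ v → ∑ (vecs V s) (Err v) ≤ length tests * (n ^ s * (h * n))
      average v = ≤-trans (≤-reflexive (∑-swap (vecs V s) tests _)) (∑-≤const tests _ λ τ → deviation-average τ v)

    step-average : ∑ (vecs V s) (λ U → h * cost r G (step l φ U)) ≤ n ^ s * (h * cost r G φ + size * K)
    step-average = *-cancelˡ-≤ h (begin
      h * ∑ (vecs V s) (λ U → h * cost r G (step l φ U))      ≡⟨ ∑-*ˡ (vecs V s) h _ ⟨
      ∑ (vecs V s) (λ U → h * (h * cost r G (step l φ U)))    ≡⟨ ∑-cong (vecs V s) (λ U → *-assoc h h (cost r G (step l φ U))) ⟨
      ∑ (vecs V s) (λ U → s * cost r G (step l φ U))          ≤⟨ ∑-mono (vecs V s) step-cost ⟩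
      ∑ (vecs V s) (λ U → s * cost r G φ + 4 * R U + 3 * (s * W))
        ≡⟨ trans (∑-+ (vecs V s) _ _) (cong₂ _+_ (trans (∑-+ (vecs V s) _ _) (cong₂ _+_ (∑-vecs-const V s _) (∑-*ˡ (vecs V s) 4 R))) (∑-vecs-const V s _)) ⟩
      length V ^ s * (s * cost r G φ) + 4 * ∑ (vecs V s) R + length V ^ s * (3 * (s * W))
        ≡⟨ cong (λ x → x ^ s * (s * cost r G φ) + 4 * ∑ (vecs V s) R + x ^ s * (3 * (s * W))) length-V ⟩
      n ^ s * (s * cost r G φ) + 4 * ∑ (vecs V s) R + n ^ s * (3 * (s * W))
        ≤⟨ +-mono-≤ (+-monoʳ-≤ (n ^ s * (s * cost r G φ)) (*-monoʳ-≤ 4 R-average)) (*-monoʳ-≤ (n ^ s) (*-monoʳ-≤ 3 (*-monoʳ-≤ s clash-few))) ⟩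
      n ^ s * (h * h * cost r G φ) + 4 * (size * (length tests * (n ^ s * (h * n)))) + n ^ s * (3 * (h * h * (size * (n / L))))
        ≡⟨ lem (n ^ s) h (cost r G φ) size (length tests) n (n / L) ⟩
      h * (n ^ s * (h * cost r G φ + size * K))               ∎)
      where
      lem : ∀ x h F b T n q → x * (h * h * F) + 4 * (b * (T * (x * (h * n)))) + x * (3 * (h * h * (b * q))) ≡
            h * (x * (h * F + b * (4 * T * n + 3 * h * q)))
      lem = solve-∀

  recolour : ∀ {k} → ℕ → Vec (Vec (Fin n) s) k → (Fin n → Label N) → Fin n → Label N
  recolour l []       φ = φ
  recolour l (U ∷ Us) φ = recolour (suc l) Us (step l φ U)

  -- Labels at the moment of use: when a block is recoloured, sampled vertices of earlier blocks
  -- already carry their new labels.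
  seenLabels : ∀ {k} → ℕ → Vec (Vec (Fin n) s) k → (Fin n → Label N) → Vec (Vec (Label N) s) k
  seenLabels l []       φ = []
  seenLabels l (U ∷ Us) φ = Vec.map φ U ∷ seenLabels (suc l) Us (step l φ U)

  recolour-valid : ∀ {k} l (Us : Vec (Vec (Fin n) s) k) φ → (∀ v → Valid r (φ v)) → ∀ v → Valid r (recolour l Us φ v)
  recolour-valid l []       φ val = val
  recolour-valid l (U ∷ Us) φ val = recolour-valid (suc l) Us (step l φ U) (step-valid l φ U val)

  recolour-below : ∀ {k} l (Us : Vec (Vec (Fin n) s) k) φ v → block v < l → recolour l Us φ v ≡ φ v
  recolour-below l []       φ v lt = refl
  recolour-below l (U ∷ Us) φ v lt = trans (recolour-below (suc l) Us (step l φ U) v (m≤n⇒m≤1+n lt))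
    (step-out l φ U v (<⇒≢ lt))

  -- A vertex changes its label only in the turn of its own block. So sample labels and observed
  -- adjacencies determine the final labelling, without knowledge of `φ`.
  recolour-rule : ∀ {k} l (Us : Vec (Vec (Fin n) s) k) φ v i → block v ≡ l + toℕ i →
    recolour l Us φ v ≡ greedy r (lookup (seenLabels l Us φ) i) (Vec.map (obs G v) (lookup Us i))
  recolour-rule l (U ∷ Us) φ v zero    e = trans (recolour-below (suc l) Us (step l φ U) v (s≤s (≤-reflexive (trans e (+-identityʳ l)))))
    (step-in l φ U v (trans e (+-identityʳ l)))
  recolour-rule l (U ∷ Us) φ v (suc i) e = recolour-rule (suc l) Us (step l φ U) v i (trans e (+-suc l (toℕ i)))

  remaining : ℕ → ℕ
  remaining l = # V (λ v → does (l ≤? block v))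

  -- Each sample is fresh, so `step-average` applies to every intermediate labelling, and the sizes
  -- of the disjoint blocks add up within `remaining l`.
  recolour-average : ∀ k l φ → (∀ v → Valid r (φ v)) →
    ∑ (vecs (vecs V s) k) (λ Us → h * cost r G (recolour l Us φ)) ≤ (n ^ s) ^ k * (h * cost r G φ + remaining l * K)
  recolour-average zero    l φ val = ≤-trans (≤-reflexive (+-identityʳ _)) (≤-trans (m≤m+n _ _) (≤-reflexive (sym (*-identityˡ _))))
  recolour-average (suc k) l φ val = begin
    ∑ (vecs (vecs V s) (suc k)) (λ Us → h * cost r G (recolour l Us φ))
      ≡⟨ ∑-vecs (vecs V s) k _ ⟩
    ∑ (vecs V s) (λ U → ∑ (vecs (vecs V s) k) λ Us → h * cost r G (recolour (suc l) Us (step l φ U)))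
      ≤⟨ ∑-mono (vecs V s) (λ U → recolour-average k (suc l) (step l φ U) (step-valid l φ U val)) ⟩
    ∑ (vecs V s) (λ U → y * (h * cost r G (step l φ U) + remaining (suc l) * K))
      ≡⟨ trans (∑-*ˡ (vecs V s) y _) (cong (y *_) (trans (∑-+ (vecs V s) _ _)
           (cong (∑ (vecs V s) (λ U → h * cost r G (step l φ U)) +_) (trans (∑-vecs-const V s _)
             (cong (λ m → m ^ s * (remaining (suc l) * K)) (length-allFin n)))))) ⟩
    y * (∑ (vecs V s) (λ U → h * cost r G (step l φ U)) + n ^ s * (remaining (suc l) * K))
      ≤⟨ *-monoʳ-≤ y (+-monoˡ-≤ _ step-average) ⟩
    y * (n ^ s * (h * cost r G φ + size * K) + n ^ s * (remaining (suc l) * K))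
      ≡⟨ lem y (n ^ s) (h * cost r G φ) size K (remaining (suc l)) ⟩
    n ^ s * y * (h * cost r G φ + (size + remaining (suc l)) * K)
      ≤⟨ *-monoʳ-≤ (n ^ s * y) (+-monoʳ-≤ (h * cost r G φ) (*-monoˡ-≤ K counted)) ⟩
    n ^ s * y * (h * cost r G φ + remaining l * K) ∎
    where
    open Step l φ val
    y = (n ^ s) ^ k
    lem : ∀ y x F b K q → y * (x * (F + b * K) + x * (q * K)) ≡ x * y * (F + (b + q) * K)
    lem = solve-∀
    counted : size + remaining (suc l) ≤ remaining l
    counted = #-disjoint V inB _ _
      (λ v e → dec-true (l ≤? block v) (≤-reflexive (sym (does⇒ (block v ≟ l) e))))
      (λ v e → dec-true (l ≤? block v) (<⇒≤ (does⇒ (suc l ≤? block v) e)))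
      (λ v e e′ → <-irrefl (sym (does⇒ (block v ≟ l) e)) (does⇒ (suc l ≤? block v) e′))

-- Estimating the cost of all hypotheses at once

relation : ∀ {N} → Vec (Vec Bool N) N → Fin N → Fin N → Bool
relation R p q = lookup (lookup R p) q

template? : ∀ {N} (R : Vec (Vec Bool N) N) → Dec (Template (relation R))
template? R = map′ (λ (a , b , c) → record { r-sym = a ; r-refl = b ; r-noC4 = c })
  (λ t → Template.r-sym t , Template.r-refl t , Template.r-noC4 t)
  (Fin.all? (λ p → Fin.all? λ q → r p q Data.Bool.≟ r q p) ×-dec
  (Fin.all? (λ p → r p p Data.Bool.≟ true) ×-dec
   Fin.all? (λ a → Fin.all? λ b → Fin.all? λ c → Fin.all? λ d →
     (r a b Data.Bool.≟ true) →-dec ((r b c Data.Bool.≟ true) →-dec ((r c d Data.Bool.≟ true) →-dec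
     ((r d a Data.Bool.≟ true) →-dec ((r a c Data.Bool.≟ true) ⊎-dec (r b d Data.Bool.≟ true))))))))
  where
  r = relation R

searchFrom : (ℕ → Bool) → ℕ → ℕ → ℕ
searchFrom p zero    k = k
searchFrom p (suc f) k = if p k then k else searchFrom p f (suc k)

searchFrom-correct : ∀ p f k j → k ≤ j → j < k + f → p j ≡ true →
                     p (searchFrom p f k) ≡ true × searchFrom p f k ≤ j
searchFrom-correct p zero    k j k≤j j< pj = ⊥-elim (<-irrefl refl (≤-<-trans k≤j (subst (j <_) (+-identityʳ k) j<)))
searchFrom-correct p (suc f) k j k≤j j< pj with p k in pk
... | true  = pk , k≤j
... | false = searchFrom-correct p f (suc k) j (≤∧≢⇒< k≤j λ { refl → contradiction (trans (sym pk) pj) false≢true })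
                (subst (j <_) (+-suc k f) j<) pj

toList-map : ∀ {A B : Set} {k} (f : A → B) (v : Vec A k) → toList (Vec.map f v) ≡ map f (toList v)
toList-map f []      = refl
toList-map f (x ∷ v) = cong (f x ∷_) (toList-map f v)

length-toList : ∀ {A : Set} {k} (v : Vec A k) → length (toList v) ≡ k
length-toList []      = refl
length-toList (x ∷ v) = cong suc (length-toList v)

module Estimator (n N h L g b e : ℕ) {{n≢0 : NonZero n}} {{L≢0 : NonZero L}} where

  V : List (Fin n)
  V = allFin n

  s M : ℕ
  s = h * h
  M = length (pairs V V)

  block : Fin n → Fin L
  block v = fromℕ< (m<n*o⇒m/o<n {toℕ v} {L} {suc (n / L)} (<-trans (Fin.toℕ<n v) (m<n*[1+m/n] n L)))

  -- A `Pattern` is the observable data from which a vertex is coloured. What cannot be observed,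
  -- namely the template and the labels of the samples, makes up the `Hypothesis`.
  Pattern Item Hypothesis : Set
  Pattern    = Fin L × Vec (Maybe Bool) s
  Item       = Pattern × Pattern × Maybe Bool
  Hypothesis = Vec (Vec Bool N) N × Vec (Vec (Label N) s) L

  colour : Hypothesis → Pattern → Label N
  colour (R , ℓs) (i , os) = greedy (relation R) (lookup ℓs i) os

  violated : Hypothesis → Item → Bool
  violated H (p , q , o) = viol (relation (proj₁ H)) (colour H p) (colour H q) o

  hypotheses : List Hypothesis
  hypotheses = pairs (filter template? (vecs (vecs bools N) N)) (vecs (vecs allLabels s) L)

  violations : Hypothesis → Vec Item g → ℕ
  violations H W = ∑ (toList W) (𝟙 ∘ violated H)

  -- The violated fraction of the group is at most κ/M + 1/e.
  accepts : ℕ → Hypothesis → Vec Item g → Bool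
  accepts κ H W = does (e * (M * violations H W) ≤? e * (g * κ) + g * M)

  acceptable? : ∀ {k} (D : Vec (Vec Item g) k) κ → Dec (Any (λ H → b < ∑ (toList D) (𝟙 ∘ accepts κ H)) hypotheses)
  acceptable? D κ = any? (λ H → b <? ∑ (toList D) (𝟙 ∘ accepts κ H)) hypotheses

  estimate : ∀ {k} → Vec (Vec Item g) k → ℕ
  -- The least κ at which more than `b` groups accept one common hypothesis. The fuel `suc M`
  -- reaches every possible cost 0, ..., M.
  estimate D = searchFrom (λ κ → does (acceptable? D κ)) (suc M) 0

  Samples : Set
  Samples = Vec (Vec (Fin n) s) L × Vec (Vec (Fin n × Fin n) g) (b + b)

  samples : List Samples
  samples = pairs (vecs (vecs V s) L) (vecs (vecs (pairs V V) g) (b + b))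

  module Observed (G : Graph n) where

    pattern′ : Vec (Vec (Fin n) s) L → Fin n → Pattern
    pattern′ Us v = block v , Vec.map (obs G v) (lookup Us (block v))

    item : Vec (Vec (Fin n) s) L → Fin n × Fin n → Item
    item Us (u , v) = pattern′ Us u , pattern′ Us v , obs G u v

    observed : Samples → Vec (Vec Item g) (b + b)
    observed (Us , Ws) = Vec.map (Vec.map (item Us)) Ws

    colouring : Vec (Vec (Fin n) s) L → Hypothesis → Fin n → Label N
    colouring Us H v = colour H (pattern′ Us v)

    colouring-valid : ∀ Us H v → Valid (relation (proj₁ H)) (colouring Us H v)
    colouring-valid Us (R , ℓs) v = greedy-valid (relation R) _ _

    event : Vec (Vec (Fin n) s) L → Hypothesis → Fin n × Fin n → ℕ
    event Us H p = 𝟙 (violated H (item Us p))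

    module Smp (Us : Vec (Vec (Fin n) s) L) (H : Hypothesis) =
      Sampling (pairs V V) (event Us H) (λ p → 𝟙≤1 (violated H (item Us p)))

    hypCost : Vec (Vec (Fin n) s) L → Hypothesis → ℕ
    hypCost Us H = cost (relation (proj₁ H)) G (colouring Us H)

    hypCost≡ : ∀ Us H → ∑ (pairs V V) (event Us H) ≡ hypCost Us H
    hypCost≡ Us H = ∑-pairs V V _

    hypCost≤M : ∀ Us H → hypCost Us H ≤ M
    hypCost≤M Us H = subst (_≤ M) (hypCost≡ Us H) (Smp.τ≤n Us H)

    violations≡ : ∀ Us H (W : Vec (Fin n × Fin n) g) → violations H (Vec.map (item Us) W) ≡ ∑ (toList W) (event Us H)
    violations≡ Us H W = trans (cong (λ l → ∑ l (𝟙 ∘ violated H)) (toList-map (item Us) W)) (∑-map (item Us) (toList W) _)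

    fails : Samples → Hypothesis → ℕ
    fails (Us , Ws) H = ∑ (toList Ws) (𝟙 ∘ Smp.deviant Us H e)

    accepted : Samples → ℕ → Hypothesis → ℕ
    accepted (Us , Ws) κ H = ∑ (toList Ws) (λ W → 𝟙 (accepts κ H (Vec.map (item Us) W)))

    accepted≡ : ∀ ω κ H → ∑ (toList (observed ω)) (𝟙 ∘ accepts κ H) ≡ accepted ω κ H
    accepted≡ (Us , Ws) κ H = trans (cong (λ l → ∑ l (𝟙 ∘ accepts κ H)) (toList-map (Vec.map (item Us)) Ws))
      (∑-map (Vec.map (item Us)) (toList Ws) _)

    accepts-sound : ∀ Us κ H W → Smp.deviant Us H e W ≡ false → accepts κ H (Vec.map (item Us) W) ≡ true →
                    .{{_ : NonZero g}} → e * hypCost Us H ≤ e * κ + 2 * M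
    accepts-sound Us κ H W nd acc = *-cancelˡ-≤ g (begin
      g * (e * hypCost Us H)               ≡⟨ cong (λ x → g * (e * x)) (hypCost≡ Us H) ⟨
      g * (e * τ)                          ≡⟨ lem₁ g e τ ⟩
      e * (g * τ)                          ≤⟨ *-monoʳ-≤ e (m≤n+∣n-m∣ (g * τ) (M * x)) ⟩
      e * (M * x + δ)                      ≡⟨ *-distribˡ-+ e (M * x) δ ⟩
      e * (M * x) + e * δ                  ≤⟨ +-mono-≤ acc′ (≮⇒≥ (does-false (g * M <? e * δ) nd)) ⟩
      e * (g * κ) + g * M + g * M          ≡⟨ lem₂ e g κ M ⟩
      g * (e * κ + 2 * M)                  ∎)
      where
      open ≤-Reasoning
      τ = ∑ (pairs V V) (event Us H)
      x = ∑ (toList W) (event Us H)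
      δ = Smp.deviation Us H W
      acc′ : e * (M * x) ≤ e * (g * κ) + g * M
      acc′ = subst (λ y → e * (M * y) ≤ e * (g * κ) + g * M) (violations≡ Us H W)
        (does⇒ (e * (M * violations H (Vec.map (item Us) W)) ≤? e * (g * κ) + g * M) acc)
      lem₁ : ∀ g e t → g * (e * t) ≡ e * (g * t)
      lem₁ = solve-∀
      lem₂ : ∀ e g k M → e * (g * k) + g * M + g * M ≡ g * (e * k + 2 * M)
      lem₂ = solve-∀

    accepts-complete : ∀ Us H W → Smp.deviant Us H e W ≡ false → accepts (hypCost Us H) H (Vec.map (item Us) W) ≡ true
    accepts-complete Us H W nd = dec-true (_ ≤? _) (begin
      e * (M * violations H (Vec.map (item Us) W))   ≡⟨ cong (λ y → e * (M * y)) (violations≡ Us H W) ⟩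
      e * (M * x)                                    ≤⟨ *-monoʳ-≤ e (m≤n+∣m-n∣ (M * x) (g * τ)) ⟩
      e * (g * τ + δ)                                ≡⟨ *-distribˡ-+ e (g * τ) δ ⟩
      e * (g * τ) + e * δ                            ≤⟨ +-monoʳ-≤ _ (≮⇒≥ (does-false (g * M <? e * δ) nd)) ⟩
      e * (g * τ) + g * M                            ≡⟨ cong (λ y → e * (g * y) + g * M) (hypCost≡ Us H) ⟩
      e * (g * hypCost Us H) + g * M                 ∎)
      where
      open ≤-Reasoning
      τ = ∑ (pairs V V) (event Us H)
      x = ∑ (toList W) (event Us H)
      δ = Smp.deviation Us H W

    Reliable : Samples → Set
    Reliable ω = ∀ H → H ∈ hypotheses → fails ω H < b

    -- At its true cost a hypothesis is accepted by every group that does not deviate, hence by more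
    -- than `b` of the 2b groups, so the search stops there at the latest.
    estimate-upper : ∀ Us Ws → Reliable (Us , Ws) → ∀ H → H ∈ hypotheses →
      does (acceptable? (observed (Us , Ws)) (estimate (observed (Us , Ws)))) ≡ true ×
      estimate (observed (Us , Ws)) ≤ hypCost Us H
    estimate-upper Us Ws rel H H∈ = searchFrom-correct _ (suc M) 0 (hypCost Us H) z≤n (s≤s (hypCost≤M Us H))
      (dec-true (acceptable? (observed (Us , Ws)) (hypCost Us H))
        (lose H∈ (subst (b <_) (sym (accepted≡ (Us , Ws) (hypCost Us H) H)) (+-cancelʳ-< b _ _ (begin-strict
          b + b                                            ≡⟨ length-toList Ws ⟨
          length (toList Ws)                               ≡⟨ length≡∑ (toList Ws) ⟩
          ∑ (toList Ws) (λ _ → 1)                          ≤⟨ ∑-mono (toList Ws) either ⟩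
          ∑ (toList Ws) (λ W → 𝟙 (accepts (hypCost Us H) H (Vec.map (item Us) W)) + 𝟙 (Smp.deviant Us H e W)) ≡⟨ ∑-+ (toList Ws) _ _ ⟩
          accepted (Us , Ws) (hypCost Us H) H + fails (Us , Ws) H <⟨ +-monoʳ-< (accepted (Us , Ws) (hypCost Us H) H) (rel H H∈) ⟩
          accepted (Us , Ws) (hypCost Us H) H + b          ∎)))))
      where
      open ≤-Reasoning
      either : ∀ W → 1 ≤ 𝟙 (accepts (hypCost Us H) H (Vec.map (item Us) W)) + 𝟙 (Smp.deviant Us H e W)
      either W with true-or-false (Smp.deviant Us H e W)
      ... | inj₁ t = ≤-trans (≤-reflexive (sym (𝟙≡1 t))) (m≤n+m _ _)
      ... | inj₂ f = ≤-trans (≤-reflexive (sym (𝟙≡1 (accepts-complete Us H W f)))) (m≤m+n _ _)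

    -- More than `b` groups accept and fewer than `b` deviate. If the bound failed, `accepts-sound`
    -- would make every accepting group deviant.
    estimate-lower : ∀ Us Ws → Reliable (Us , Ws) → .{{_ : NonZero g}} → ∀ κ → does (acceptable? (observed (Us , Ws)) κ) ≡ true →
      ∃ λ H → H ∈ hypotheses × e * hypCost Us H ≤ e * κ + 2 * M
    estimate-lower Us Ws rel κ acc with find (does⇒ (acceptable? (observed (Us , Ws)) κ) acc)
    ... | H , H∈ , b< = H , H∈ , decidable-stable (_ ≤? _) λ ¬p →
      <⇒≱ (<-trans (rel H H∈) (subst (b <_) (accepted≡ (Us , Ws) κ H) b<))
        (∑-mono (toList Ws) λ W → 𝟙-mono λ aW → deviates ¬p W aW (true-or-false (Smp.deviant Us H e W)))
      where
      deviates : ¬ (e * hypCost Us H ≤ e * κ + 2 * M) → ∀ W → accepts κ H (Vec.map (item Us) W) ≡ true →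
                 Smp.deviant Us H e W ≡ true ⊎ Smp.deviant Us H e W ≡ false → Smp.deviant Us H e W ≡ true
      deviates ¬p W aW (inj₁ t) = t
      deviates ¬p W aW (inj₂ f) = ⊥-elim (¬p (accepts-sound Us κ H W f aW))

    unreliable : Samples → Bool
    unreliable ω = does (any? (λ H → b ≤? fails ω H) hypotheses)

    reliable : ∀ ω → unreliable ω ≡ false → Reliable ω
    reliable ω f H H∈ = ≰⇒> λ le → does-false (any? (λ H → b ≤? fails ω H) hypotheses) f (lose H∈ le)

    -- Once `Us` is fixed, each hypothesis has a fixed cost and the groups are independent of it.
    -- One hypothesis fails with probability at most 2 ^ (- b), and there are at most 2 ^ b / 8 of
    -- them.
    unreliable-rare : .{{_ : NonZero e}} .{{_ : NonZero g}} .{{_ : NonZero M}} → g ≡ 64 * (e * e) →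
      8 * length hypotheses ≤ 2 ^ b → ∀ Us →
      8 * ∑ (vecs (vecs (pairs V V) g) (b + b)) (λ Ws → 𝟙 (unreliable (Us , Ws))) ≤ length (vecs (vecs (pairs V V) g) (b + b))
    unreliable-rare g≡ few Us = *-cancelˡ-≤ (2 ^ b) {{m^n≢0 2 b}} (begin
      2 ^ b * (8 * ∑ Ω (λ Ws → 𝟙 (unreliable (Us , Ws))))       ≤⟨ *-monoʳ-≤ (2 ^ b) (*-monoʳ-≤ 8 union) ⟩
      2 ^ b * (8 * ∑ hypotheses λ H → ∑ Ω λ Ws → 𝟙 (does (b ≤? fails (Us , Ws) H)))  ≡⟨ lem (2 ^ b) (∑ hypotheses λ H → ∑ Ω λ Ws → 𝟙 (does (b ≤? fails (Us , Ws) H))) ⟩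
      8 * ((∑ hypotheses λ H → ∑ Ω λ Ws → 𝟙 (does (b ≤? fails (Us , Ws) H))) * 2 ^ b) ≡⟨ cong (8 *_) (∑-*ʳ hypotheses (2 ^ b) _) ⟨
      8 * (∑ hypotheses λ H → (∑ Ω λ Ws → 𝟙 (does (b ≤? fails (Us , Ws) H))) * 2 ^ b) ≤⟨ *-monoʳ-≤ 8 (∑-≤const hypotheses (length Ω) single) ⟩
      8 * (length hypotheses * length Ω)                        ≡⟨ *-assoc 8 (length hypotheses) (length Ω) ⟨
      8 * length hypotheses * length Ω                          ≤⟨ *-monoˡ-≤ (length Ω) few ⟩
      2 ^ b * length Ω                                          ∎)
      where
      open ≤-Reasoning
      Ω = vecs (vecs (pairs V V) g) (b + b)
      lem : ∀ a x → a * (8 * x) ≡ 8 * (x * a)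
      lem = solve-∀
      union : ∑ Ω (λ Ws → 𝟙 (unreliable (Us , Ws))) ≤ ∑ hypotheses λ H → ∑ Ω λ Ws → 𝟙 (does (b ≤? fails (Us , Ws) H))
      union = #-union Ω hypotheses (λ Ws → unreliable (Us , Ws)) (λ H Ws → does (b ≤? fails (Us , Ws) H)) λ Ws u →
        let H , H∈ , p = find (does⇒ (any? (λ H → b ≤? fails (Us , Ws) H) hypotheses) u)
        in H , H∈ , dec-true (b ≤? fails (Us , Ws) H) p
      single : ∀ H → (∑ Ω λ Ws → 𝟙 (does (b ≤? fails (Us , Ws) H))) * 2 ^ b ≤ length Ω
      single H = ≤-trans (majorityBad (vecs (pairs V V) g) (Smp.deviant Us H e)
          (≤-trans (Smp.chebyshev Us H e g g≡) (≤-reflexive (sym (length-vecs (pairs V V) g)))) b)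
        (≤-reflexive (sym (length-vecs (vecs (pairs V V) g) (b + b))))

-- Probability of a wrong estimate

module Correctness (n N D Q m h L g b e : ℕ) {{n≢0 : NonZero n}} {{L≢0 : NonZero L}} {{h≢0 : NonZero h}}
  {{g≢0 : NonZero g}} {{e≢0 : NonZero e}}
  (D≡ : D ≡ 312 * e) (Q≡ : Q ≡ D * D * D) (m≡ : m ≡ Q * Q * (D * D)) (N≡ : N ≡ Q * m ^ Q)
  (h≡ : h ≡ 64 * e * suc (N + N)) (L≡ : L ≡ 48 * e) (g≡ : g ≡ 64 * (e * e))
  (few : 8 * length (Estimator.hypotheses n N h L g b e) ≤ 2 ^ b)
  (G : Graph n) (k : ℕ) (isMin : IsMinDistC4 G k) where

  open Estimator n N h L g b e
  open Observed G
  open ≤-Reasoning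

  M≡n² : M ≡ n * n
  M≡n² = trans (length-pairs V V) (cong₂ _*_ (length-allFin n) (length-allFin n))

  private instance
    M≢0 : NonZero M
    M≢0 = subst NonZero (sym M≡n²) (m*n≢0 n n)

  close : ℕ → Bool
  close κ = does (e * κ ≤? e * (2 * k) + 2 * M) ∧ does (e * (2 * k) ≤? e * κ + 2 * M)

  module WithTemplate (R : Vec (Vec Bool N) N) (t : Template (relation R)) (φ : Fin n → Label N)
    (valid : ∀ v → Valid (relation R) (φ v)) (good : 8 * e * cost (relation R) G φ ≤ 8 * e * (2 * k) + n * n) where

    open Recolouring G (relation R) t h L using (recolour; recolour-valid; recolour-rule; recolour-average; seenLabels; K; remaining)
    open Tests (relation R) using (tests; length-tests)

    Ω : List (Vec (Vec (Fin n) s) L)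
    Ω = vecs (vecs V s) L

    F : Vec (Vec (Fin n) s) L → ℕ
    F Us = cost (relation R) G (recolour 0 Us φ)

    -- `h` and `L` are chosen so that the sampling term and the block term of `K` contribute at most
    -- h n² each.
    K-small : 16 * e * (n * K) ≤ 2 * (h * (n * n))
    K-small = begin
      16 * e * (n * (4 * length tests * n + 3 * h * (n / L)))       ≡⟨ cong (λ x → 16 * e * (n * (4 * x * n + 3 * h * (n / L)))) length-tests ⟩
      16 * e * (n * (4 * suc (N + N) * n + 3 * h * (n / L)))        ≡⟨ lem e n (suc (N + N)) h (n / L) ⟩
      64 * e * suc (N + N) * (n * n) + h * n * (n / L * (48 * e))   ≡⟨ cong₂ (λ x y → x * (n * n) + h * n * (n / L * y)) h≡ L≡ ⟨
      h * (n * n) + h * n * (n / L * L)                             ≤⟨ +-monoʳ-≤ (h * (n * n)) (*-monoʳ-≤ (h * n) (m/n*n≤m n L)) ⟩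
      h * (n * n) + h * n * n                                       ≡⟨ lem′ h n ⟩
      2 * (h * (n * n)) ∎
      where
      lem : ∀ e n T h q → 16 * e * (n * (4 * T * n + 3 * h * q)) ≡ 64 * e * T * (n * n) + h * n * (q * (48 * e))
      lem = solve-∀
      lem′ : ∀ h n → h * (n * n) + h * n * n ≡ 2 * (h * (n * n))
      lem′ = solve-∀

    length-Ω : length Ω ≡ (n ^ s) ^ L
    length-Ω = trans (length-vecs (vecs V s) L) (cong (_^ L) (trans (length-vecs V s) (cong (_^ s) (length-allFin n))))

    F-average : 8 * e * ∑ Ω F ≤ length Ω * (8 * e * (2 * k) + 2 * (n * n))
    F-average = *-cancelˡ-≤ (2 * h) {{m*n≢0 2 h}} (begin
      2 * h * (8 * e * ∑ Ω F)                  ≡⟨ lem₁ h e (∑ Ω F) ⟩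
      16 * e * (h * ∑ Ω F)                     ≡⟨ cong (16 * e *_) (∑-*ˡ Ω h F) ⟨
      16 * e * ∑ Ω (λ Us → h * F Us)           ≤⟨ *-monoʳ-≤ (16 * e) (recolour-average L 0 φ valid) ⟩
      16 * e * ((n ^ s) ^ L * (h * cost (relation R) G φ + remaining 0 * K))
                                               ≡⟨ cong (λ x → 16 * e * (x * (h * cost (relation R) G φ + remaining 0 * K))) length-Ω ⟨
      16 * e * (length Ω * (h * cost (relation R) G φ + remaining 0 * K))
        ≤⟨ *-monoʳ-≤ (16 * e) (*-monoʳ-≤ (length Ω) (+-monoʳ-≤ (h * cost (relation R) G φ)
             (*-monoˡ-≤ K (≤-trans (#≤length V _) (≤-reflexive (length-allFin n)))))) ⟩
      16 * e * (length Ω * (h * cost (relation R) G φ + n * K))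
                                               ≡⟨ lem₂ e (length Ω) h (cost (relation R) G φ) (n * K) ⟩
      length Ω * (2 * h * (8 * e * cost (relation R) G φ) + 16 * e * (n * K))
        ≤⟨ *-monoʳ-≤ (length Ω) (+-mono-≤ (*-monoʳ-≤ (2 * h) good) K-small) ⟩
      length Ω * (2 * h * (8 * e * (2 * k) + n * n) + 2 * (h * (n * n)))
                                               ≡⟨ lem₃ (length Ω) h (8 * e * (2 * k)) (n * n) ⟩
      2 * h * (length Ω * (8 * e * (2 * k) + 2 * (n * n))) ∎)
      where
      lem₁ : ∀ h e x → 2 * h * (8 * e * x) ≡ 16 * e * (h * x)
      lem₁ = solve-∀
      lem₂ : ∀ e l h c x → 16 * e * (l * (h * c + x)) ≡ l * (2 * h * (8 * e * c) + 16 * e * x)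
      lem₂ = solve-∀
      lem₃ : ∀ l h a x → l * (2 * h * (a + x) + 2 * (h * x)) ≡ 2 * h * (l * (a + 2 * x))
      lem₃ = solve-∀

    atypical : Vec (Vec (Fin n) s) L → Bool
    atypical Us = does (e * (2 * k) + 2 * M <? e * F Us)

    2k≤F : ∀ Us → 2 * k ≤ F Us
    2k≤F Us = 2dist≤cost t G isMin (recolour 0 Us φ) (recolour-valid 0 Us φ valid)

    -- Markov's inequality for the excess of `F` over 2k, which is nonnegative by `2k≤F`; its mean
    -- is at most n²/(4e), an eighth of the threshold 2n²/e.
    atypical-rare : 8 * # Ω atypical ≤ length Ω
    atypical-rare = *-cancelˡ-≤ (2 * M) {{m*n≢0 2 M}} (+-cancelˡ-≤ (length Ω * (8 * e * (2 * k))) _ _ (begin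
      length Ω * (8 * e * (2 * k)) + 2 * M * (8 * # Ω atypical)     ≡⟨ lem₁ (length Ω) e k M (# Ω atypical) ⟩
      8 * (length Ω * (e * (2 * k)) + 2 * M * # Ω atypical)         ≡⟨ cong (8 *_) (cong₂ _+_ (∑-const Ω _) (∑-*ˡ Ω (2 * M) _)) ⟨
      8 * (∑ Ω (λ _ → e * (2 * k)) + ∑ Ω (λ Us → 2 * M * 𝟙 (atypical Us))) ≡⟨ cong (8 *_) (∑-+ Ω _ _) ⟨
      8 * ∑ Ω (λ Us → e * (2 * k) + 2 * M * 𝟙 (atypical Us))        ≤⟨ *-monoʳ-≤ 8 (∑-mono Ω pointwise) ⟩
      8 * ∑ Ω (λ Us → e * F Us)                                     ≡⟨ trans (cong (8 *_) (∑-*ˡ Ω e F)) (sym (*-assoc 8 e (∑ Ω F))) ⟩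
      8 * e * ∑ Ω F                                                 ≤⟨ F-average ⟩
      length Ω * (8 * e * (2 * k) + 2 * (n * n))                    ≡⟨ cong (λ x → length Ω * (8 * e * (2 * k) + 2 * x)) M≡n² ⟨
      length Ω * (8 * e * (2 * k) + 2 * M)                          ≡⟨ lem₂ (length Ω) (8 * e * (2 * k)) M ⟩
      length Ω * (8 * e * (2 * k)) + 2 * M * length Ω               ∎))
      where
      lem₁ : ∀ l e k M a → l * (8 * e * (2 * k)) + 2 * M * (8 * a) ≡ 8 * (l * (e * (2 * k)) + 2 * M * a)
      lem₁ = solve-∀
      lem₂ : ∀ l a M → l * (a + 2 * M) ≡ l * a + 2 * M * l
      lem₂ = solve-∀
      pointwise : ∀ Us → e * (2 * k) + 2 * M * 𝟙 (atypical Us) ≤ e * F Us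
      pointwise Us = cases (e * (2 * k) + 2 * M <? e * F Us)
        where
        cases : (d : Dec (e * (2 * k) + 2 * M < e * F Us)) → e * (2 * k) + 2 * M * 𝟙 (does d) ≤ e * F Us
        cases (yes p) = ≤-trans (≤-reflexive (cong (e * (2 * k) +_) (*-identityʳ (2 * M)))) (<⇒≤ p)
        cases (no _)  = ≤-trans (≤-reflexive (trans (cong (e * (2 * k) +_) (*-zeroʳ (2 * M))) (+-identityʳ _))) (*-monoʳ-≤ e (2k≤F Us))

    hypothesis : Vec (Vec (Fin n) s) L → Hypothesis
    hypothesis Us = R , seenLabels 0 Us φ

    hypothesis-∈ : ∀ Us → hypothesis Us ∈ hypotheses
    hypothesis-∈ Us = ∈-pairs (∈.∈-filter⁺ template? (∈-vecs R λ i → ∈-vecs (lookup R i) λ j → ∈-bools _) t)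
      (∈-vecs (seenLabels 0 Us φ) λ i → ∈-vecs (lookup (seenLabels 0 Us φ) i) λ j → ∈-allLabels _)

    hypCost≡F : ∀ Us → hypCost Us (hypothesis Us) ≡ F Us
    hypCost≡F Us = ∑-cong V λ u → ∑-cong V λ v →
      cong₂ (λ a c → 𝟙 (viol (relation R) a c (obs G u v))) (same u) (same v)
      where
      same : ∀ v → colouring Us (hypothesis Us) v ≡ recolour 0 Us φ v
      same v = sym (recolour-rule 0 Us φ v (block v) (sym (Fin.toℕ-fromℕ< _)))

    template-∈ : ∀ {H} → H ∈ hypotheses → Template (relation (proj₁ H))
    template-∈ H∈ = proj₂ (∈.∈-filter⁻ template? {xs = vecs (vecs bools N) N}
      (proj₁ (pairs-∈ (filter template? (vecs (vecs bools N) N)) H∈)))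

    close-intro : ∀ κ → e * κ ≤ e * (2 * k) + 2 * M → e * (2 * k) ≤ e * κ + 2 * M → close κ ≡ true
    close-intro κ p q = ∧-intro (dec-true (e * κ ≤? e * (2 * k) + 2 * M) p) (dec-true (e * (2 * k) ≤? e * κ + 2 * M) q)

    -- From above, the estimate competes with the labels that recolouring really produces. From
    -- below, whatever hypothesis is accepted yields a valid labelling, whose cost is at least 2k.
    close-if : ∀ Us Ws → atypical Us ≡ false → unreliable (Us , Ws) ≡ false → close (estimate (observed (Us , Ws))) ≡ true
    close-if Us Ws typical rel = close-intro κ (≤-trans (*-monoʳ-≤ e (≤-trans (proj₂ upper) (≤-reflexive (hypCost≡F Us))))
        (≮⇒≥ (does-false (e * (2 * k) + 2 * M <? e * F Us) typical)))
      (≤-trans (*-monoʳ-≤ e (2dist≤cost (template-∈ (proj₁ (proj₂ lower))) G isMin (colouring Us (proj₁ lower)) (colouring-valid Us (proj₁ lower))))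
        (proj₂ (proj₂ lower)))
      where
      κ : ℕ
      κ = estimate (observed (Us , Ws))
      upper : does (acceptable? (observed (Us , Ws)) κ) ≡ true × κ ≤ hypCost Us (hypothesis Us)
      upper = estimate-upper Us Ws (reliable (Us , Ws) rel) (hypothesis Us) (hypothesis-∈ Us)
      lower : ∃ λ H → H ∈ hypotheses × e * hypCost Us H ≤ e * κ + 2 * M
      lower = estimate-lower Us Ws (reliable (Us , Ws) rel) κ (proj₁ upper)

    mostly-close : 4 * ∑ samples (λ ω → 𝟙 (not (close (estimate (observed ω))))) ≤ length samples
    mostly-close = *-cancelˡ-≤ 2 (begin
      2 * (4 * ∑ samples (λ ω → 𝟙 (not (close (estimate (observed ω))))))
        ≡⟨ *-assoc 2 4 far ⟨
      8 * ∑ samples (λ ω → 𝟙 (not (close (estimate (observed ω)))))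
        ≡⟨ cong (8 *_) (∑-pairs Ω Ω′ _) ⟩
      8 * ∑ Ω (λ Us → ∑ Ω′ λ Ws → 𝟙 (not (close (estimate (observed (Us , Ws))))))
        ≤⟨ *-monoʳ-≤ 8 (∑-mono Ω λ Us → ∑-mono Ω′ λ Ws → either Us Ws) ⟩
      8 * ∑ Ω (λ Us → ∑ Ω′ λ Ws → 𝟙 (atypical Us) + 𝟙 (unreliable (Us , Ws)))
        ≡⟨ cong (8 *_) (trans (∑-cong Ω λ Us → trans (∑-+ Ω′ _ _) (cong (_+ _) (∑-const Ω′ _))) (∑-+ Ω _ _)) ⟩
      8 * (∑ Ω (λ Us → length Ω′ * 𝟙 (atypical Us)) + ∑ Ω (λ Us → ∑ Ω′ λ Ws → 𝟙 (unreliable (Us , Ws))))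
        ≡⟨ trans (*-distribˡ-+ 8 (∑ Ω (λ Us → length Ω′ * 𝟙 (atypical Us))) _)
             (cong₂ _+_ (trans (cong (8 *_) (∑-*ˡ Ω (length Ω′) _)) (lem (length Ω′) (# Ω atypical))) (sym (∑-*ˡ Ω 8 _))) ⟩
      length Ω′ * (8 * # Ω atypical) + ∑ Ω (λ Us → 8 * ∑ Ω′ λ Ws → 𝟙 (unreliable (Us , Ws)))
        ≤⟨ +-mono-≤ (*-monoʳ-≤ (length Ω′) atypical-rare) (∑-≤const Ω (length Ω′) (unreliable-rare g≡ few)) ⟩
      length Ω′ * length Ω + length Ω * length Ω′
        ≡⟨ lem′ (length Ω) (length Ω′) ⟩
      2 * (length Ω * length Ω′)
        ≡⟨ cong (2 *_) (length-pairs Ω Ω′) ⟨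
      2 * length samples ∎)
      where
      far : ℕ
      far = ∑ samples (λ ω → 𝟙 (not (close (estimate (observed ω)))))
      Ω′ : List (Vec (Vec (Fin n × Fin n) g) (b + b))
      Ω′ = vecs (vecs (pairs V V) g) (b + b)
      lem : ∀ a x → 8 * (a * x) ≡ a * (8 * x)
      lem = solve-∀
      lem′ : ∀ a b → b * a + a * b ≡ 2 * (a * b)
      lem′ = solve-∀
      either : ∀ Us Ws → 𝟙 (not (close (estimate (observed (Us , Ws))))) ≤ 𝟙 (atypical Us) + 𝟙 (unreliable (Us , Ws))
      either Us Ws = cases (true-or-false (atypical Us)) (true-or-false (unreliable (Us , Ws)))
        where
        cases : atypical Us ≡ true ⊎ atypical Us ≡ false → unreliable (Us , Ws) ≡ true ⊎ unreliable (Us , Ws) ≡ false →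
                𝟙 (not (close (estimate (observed (Us , Ws))))) ≤ 𝟙 (atypical Us) + 𝟙 (unreliable (Us , Ws))
        cases (inj₁ t) _ = ≤-trans (𝟙≤1 _) (≤-trans (≤-reflexive (sym (𝟙≡1 t))) (m≤m+n _ _))
        cases _ (inj₁ t) = ≤-trans (𝟙≤1 _) (≤-trans (≤-reflexive (sym (𝟙≡1 t))) (m≤n+m _ _))
        cases (inj₂ f) (inj₂ f′) = ≤-trans (≤-reflexive (cong (λ x → 𝟙 (not x)) (close-if Us Ws f f′))) z≤n

  module _ (r : Fin N → Fin N → Bool) where

    -- Hypotheses range over finite tables, whereas the approximation yields a function; the two
    -- agree only pointwise, so each property is transported.
    table : Vec (Vec Bool N) N
    table = tabulate λ p → tabulate (r p)

    table≡ : ∀ p q → relation table p q ≡ r p q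
    table≡ p q = trans (cong (λ v → lookup v q) (Vec.lookup∘tabulate _ p)) (Vec.lookup∘tabulate (r p) q)

    table-template : Template r → Template (relation table)
    table-template t = record
      { r-sym  = λ p q → trans (table≡ p q) (trans (Template.r-sym t p q) (sym (table≡ q p)))
      ; r-refl = λ p → trans (table≡ p p) (Template.r-refl t p)
      ; r-noC4 = λ a b c d ab bc cd da → [ (λ x → inj₁ (trans (table≡ a c) x)) , (λ x → inj₂ (trans (table≡ b d) x)) ]′
          (Template.r-noC4 t a b c d (trans (sym (table≡ a b)) ab) (trans (sym (table≡ b c)) bc)
            (trans (sym (table≡ c d)) cd) (trans (sym (table≡ d a)) da)) }

    table-valid : ∀ a → Valid r a → Valid (relation table) a
    table-valid (X p) v = tt
    table-valid (Y I) v = λ p q ip iq → trans (table≡ p q) (v p q ip iq)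

    table-viol : ∀ a c o → viol (relation table) a c o ≡ viol r a c o
    table-viol a     c     nothing  = refl
    table-viol (X p) (X q) (just x) = cong (xor x) (table≡ p q)
    table-viol (X p) (Y I) (just x) = refl
    table-viol (Y I) (X p) (just x) = refl
    table-viol (Y I) (Y J) (just x) = refl

  correct : 4 * ∑ samples (λ ω → 𝟙 (not (close (estimate (observed ω))))) ≤ length samples
  -- The template exists only under double negation, but the counting inequality to be proved is
  -- decidable.
  correct = decidable-stable (_ ≤? _) λ ¬c → approximation λ (r , φ , t , valid , small) →
    ¬c (WithTemplate.mostly-close (table r) (table-template r t) φ (λ v → table-valid r (φ v) (valid v)) (begin
      8 * e * cost (relation (table r)) G φ
        ≡⟨ cong (8 * e *_) (∑-cong V λ u → ∑-cong V λ v → cong 𝟙 (table-viol r (φ u) (φ v) (obs G u v))) ⟩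
      8 * e * cost r G φ                          ≤⟨ *-monoʳ-≤ (8 * e) (cost-edit r G H φ) ⟩
      8 * e * (2 * editCount G H + cost r H φ)    ≡⟨ *-distribˡ-+ (8 * e) _ _ ⟩
      8 * e * (2 * editCount G H) + 8 * e * cost r H φ
        ≤⟨ +-mono-≤ (≤-reflexive (cong (λ x → 8 * e * (2 * x)) (proj₂ (proj₂ (proj₁ isMin)))))
             -- D = 312 e = 39 · 8e turns the approximation error 39n²/D into n²/(8e).
             (*-cancelˡ-≤ 39 (≤-trans (≤-reflexive (trans (lem e (cost r H φ)) (cong (_* cost r H φ) (sym D≡)))) small)) ⟩
      8 * e * (2 * k) + n * n                     ∎))
    where
    H : Graph n
    H = proj₁ (proj₁ isMin)
    5≤D : 5 ≤ D
    5≤D = subst (5 ≤_) (sym D≡) (≤-trans (m≤m+n 5 307) (m≤m*n 312 e))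
    lem : ∀ e x → 39 * (8 * e * x) ≡ 312 * e * x
    lem = solve-∀
    open Approximation H (proj₁ (proj₂ (proj₁ isMin))) D Q m N 5≤D Q≡ m≡ N≡ using (approximation)

-- Rational arithmetic

∣-∣-bound : ∀ {x y z} → x ≤ y + z → y ≤ x + z → ∣ x - y ∣ ≤ z
∣-∣-bound {x} {y} {z} p q with ∣m-n∣≡[m∸n]∨[n∸m] x y
... | inj₁ e = ≤-trans (≤-reflexive e) (m≤n+o⇒m∸n≤o x y p)
... | inj₂ e = ≤-trans (≤-reflexive e) (m≤n+o⇒m∸n≤o y x q)

-- The hypothesis is the inequality with denominators cleared; unnormalised rationals keep gcds out
-- of the computation.
fractions-close : ∀ κ k p q a d .(c : Coprime (suc a) (suc d)) →
  ∣ κ * suc q - k * suc p ∣ * suc d ≤ suc a * (suc p * suc q) →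
  ℚ.∣ ((ℤ.+ κ) ℚ./ suc p) ℚ.- ((ℤ.+ k) ℚ./ suc q) ∣ ℚ.≤ ℚ.mkℚ (ℤ.+ suc a) d c
fractions-close κ k p q a d c h = ℚ.toℚᵘ-cancel-≤ (ℚᵘ.≤-respˡ-≃ (ℚᵘ.≃-sym to-ℚᵘ) (ℚᵘ.*≤* numerators))
  where
  x y : ℚ
  x = (ℤ.+ κ) ℚ./ suc p
  y = (ℤ.+ k) ℚ./ suc q
  u v : ℚᵘ
  u = mkℚᵘ (ℤ.+ κ) p
  v = mkℚᵘ (ℤ.+ k) q
  to-ℚᵘ : ℚ.toℚᵘ ℚ.∣ x ℚ.- y ∣ ℚᵘ.≃ ℚᵘ.∣ u ℚᵘ.- v ∣
  to-ℚᵘ = ℚᵘ.≃-trans (ℚ.toℚᵘ-homo-∣-∣ (x ℚ.- y)) (ℚᵘ.∣-∣-cong (ℚᵘ.≃-trans (ℚ.toℚᵘ-homo-+ x (ℚ.- y))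
    (ℚᵘ.+-cong (ℚ.toℚᵘ-fromℚᵘ u) (ℚᵘ.≃-trans (ℚ.toℚᵘ-homo‿- y) (ℚᵘ.-‿cong (ℚ.toℚᵘ-fromℚᵘ v))))))
  numerator : ℤ
  numerator = (ℤ.+ κ) ℤ.* (ℤ.+ suc q) ℤ.+ (ℤ.- (ℤ.+ k)) ℤ.* (ℤ.+ suc p)
  ∣numerator∣ : ℤ.∣ numerator ∣ ≡ ∣ κ * suc q - k * suc p ∣
  ∣numerator∣ = trans (cong ℤ.∣_∣ (trans (cong₂ ℤ._+_ (sym (ℤ.pos-* κ (suc q)))
      (trans (sym (ℤ.neg-distribˡ-* (ℤ.+ k) (ℤ.+ suc p))) (cong ℤ.-_ (sym (ℤ.pos-* k (suc p))))))
      (ℤ.m-n≡m⊖n (κ * suc q) (k * suc p)))) (∣⊖∣ (κ * suc q) (k * suc p))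
    where
    ∣⊖∣ : ∀ m n → ℤ.∣ m ℤ.⊖ n ∣ ≡ ∣ m - n ∣
    ∣⊖∣ m n with ≤-total m n
    ... | inj₁ m≤n = trans (ℤ.∣⊖∣-≤ m≤n) (sym (m≤n⇒∣m-n∣≡n∸m m≤n))
    ... | inj₂ n≤m = trans (cong ℤ.∣_∣ (ℤ.⊖-≥ n≤m)) (sym (m≤n⇒∣n-m∣≡n∸m n≤m))
  numerators : (ℤ.+ ℤ.∣ numerator ∣) ℤ.* (ℤ.+ suc d) ℤ.≤ (ℤ.+ suc a) ℤ.* (ℤ.+ (suc p * suc q))
  numerators = subst₂ ℤ._≤_ (trans (cong (λ t → ℤ.+ (t * suc d)) (sym ∣numerator∣)) (ℤ.pos-* ℤ.∣ numerator ∣ (suc d)))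
    (ℤ.pos-* (suc a) (suc p * suc q)) (ℤ.+≤+ h)

-- This is ⌊1/ε⌋ + 1, strictly above 1/ε for positive ε; other arguments get the nonzero default 1.
invCeil : ℚ → ℕ
invCeil (ℚ.mkℚ (ℤ.+ suc a) d _) = suc (suc d / suc a)
invCeil _                       = 1

invCeil≢0 : ∀ ε → NonZero (invCeil ε)
invCeil≢0 (ℚ.mkℚ (ℤ.+ suc a) d _)  = _
invCeil≢0 (ℚ.mkℚ (ℤ.+ zero) d _)   = _
invCeil≢0 (ℚ.mkℚ ℤ.-[1+ _ ] d _)   = _

-- From 1/ε ≤ m follows ⌊1/ε⌋ ≤ m, and 1 ≤ m pays for the added 1.
invCeil-≤ : ∀ ε → ℚ.0ℚ ℚ.< ε → ∀ m → ℚ.1ℚ ℚ.≤ ε ℚ.* ((ℤ.+ m) ℚ./ 1) → invCeil ε ≤ 2 * m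
invCeil-≤ (ℚ.mkℚ (ℤ.+ zero) d c) (ℚ.*<* (ℤ.+<+ ()))
invCeil-≤ (ℚ.mkℚ ℤ.-[1+ _ ] d c) (ℚ.*<* ())
invCeil-≤ ε@(ℚ.mkℚ (ℤ.+ suc a) d c) _ m 1≤εm = begin
  suc (suc d / suc a)    ≤⟨ +-mono-≤ 1≤m quotient≤m ⟩
  m + m                  ≡⟨ cong (m +_) (+-identityʳ m) ⟨
  2 * m                  ∎
  where
  open ≤-Reasoning
  to-ℚᵘ : ℚ.toℚᵘ (ε ℚ.* ((ℤ.+ m) ℚ./ 1)) ℚᵘ.≃ mkℚᵘ (ℤ.+ suc a) d ℚᵘ.* mkℚᵘ (ℤ.+ m) 0
  to-ℚᵘ = ℚᵘ.≃-trans (ℚ.toℚᵘ-homo-* ε ((ℤ.+ m) ℚ./ 1)) (ℚᵘ.*-cong (ℚᵘ.≃-refl {mkℚᵘ (ℤ.+ suc a) d}) (ℚ.toℚᵘ-fromℚᵘ (mkℚᵘ (ℤ.+ m) 0)))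
  cross : ℚᵘ.1ℚᵘ ℚᵘ.≤ mkℚᵘ (ℤ.+ suc a) d ℚᵘ.* mkℚᵘ (ℤ.+ m) 0
  cross = ℚᵘ.≤-respʳ-≃ to-ℚᵘ (ℚ.toℚᵘ-mono-≤ 1≤εm)
  drop : ∀ {x y} → ℤ.+ x ℤ.≤ ℤ.+ y → x ≤ y
  drop (ℤ.+≤+ le) = le
  d≤am : suc d ≤ suc a * m
  d≤am = drop (subst₂ ℤ._≤_ (trans (ℤ.*-identityˡ _) (cong ℤ.+_ (*-identityʳ (suc d))))
    (trans (ℤ.*-identityʳ _) (sym (ℤ.pos-* (suc a) m))) (ℚᵘ.drop-*≤* cross))
  1≤m : 1 ≤ m
  1≤m = n≢0⇒n>0 λ { refl → <⇒≱ (s≤s z≤n) (≤-trans d≤am (≤-reflexive (*-zeroʳ (suc a)))) }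
  quotient≤m : suc d / suc a ≤ m
  quotient≤m = ≤-trans (/-monoˡ-≤ (suc a) d≤am) (≤-reflexive (trans (cong (_/ suc a) (*-comm (suc a) m)) (m*n/n≡m m (suc a))))

-- The 2 undoes the double counting of ordered pairs in costs.
value : ℕ → ℕ → ℚ
value m κ = (ℤ.+ κ) ℚ./ (2 * (suc m * suc m))

value-close : ∀ ε → ℚ.0ℚ ℚ.< ε → ∀ m κ k → let e = invCeil ε ; n² = suc m * suc m in
  e * κ ≤ e * (2 * k) + 2 * n² → e * (2 * k) ≤ e * κ + 2 * n² →
  ℚ.∣ value m κ ℚ.- ((ℤ.+ k) ℚ./ n²) ∣ ℚ.≤ ε
value-close (ℚ.mkℚ (ℤ.+ zero) d c) (ℚ.*<* (ℤ.+<+ ()))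
value-close (ℚ.mkℚ ℤ.-[1+ _ ] d c) (ℚ.*<* ())
value-close ε@(ℚ.mkℚ (ℤ.+ suc a) d c) _ m κ k upper lower =
  fractions-close κ k (pred (2 * P)) (pred P) a d c (*-cancelˡ-≤ e (begin
    e * (∣ κ * P - k * (2 * P) ∣ * suc d)          ≡⟨ lem₁ e ∣ κ * P - k * (2 * P) ∣ (suc d) ⟩
    e * ∣ κ * P - k * (2 * P) ∣ * suc d            ≡⟨ cong (_* suc d) (*-distribˡ-∣-∣ e (κ * P) (k * (2 * P))) ⟩
    ∣ e * (κ * P) - e * (k * (2 * P)) ∣ * suc d    ≤⟨ *-monoˡ-≤ (suc d) (∣-∣-bound upper′ lower′) ⟩
    2 * P * P * suc d                              ≤⟨ *-monoʳ-≤ (2 * P * P) d≤ae ⟩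
    2 * P * P * (suc a * e)                        ≡⟨ lem₂ P (suc a) e ⟩
    e * (suc a * (2 * P * P))                      ∎))
  where
  open ≤-Reasoning
  e P : ℕ
  e = suc (suc d / suc a)
  P = suc m * suc m
  lem₁ : ∀ e x d → e * (x * d) ≡ e * x * d
  lem₁ = solve-∀
  lem₂ : ∀ P a e → 2 * P * P * (a * e) ≡ e * (a * (2 * P * P))
  lem₂ = solve-∀
  lem₃ : ∀ e k P → (e * (2 * k) + 2 * P) * P ≡ e * (k * (2 * P)) + 2 * P * P
  lem₃ = solve-∀
  lem₄ : ∀ e k P → e * (2 * k) * P ≡ e * (k * (2 * P))
  lem₄ = solve-∀
  lem₅ : ∀ e κ P → (e * κ + 2 * P) * P ≡ e * (κ * P) + 2 * P * P
  lem₅ = solve-∀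
  upper′ : e * (κ * P) ≤ e * (k * (2 * P)) + 2 * P * P
  upper′ = subst₂ _≤_ (*-assoc e κ P) (lem₃ e k P) (*-monoˡ-≤ P upper)
  lower′ : e * (k * (2 * P)) ≤ e * (κ * P) + 2 * P * P
  lower′ = subst₂ _≤_ (lem₄ e k P) (lem₅ e κ P) (*-monoˡ-≤ P lower)
  d≤ae : suc d ≤ suc a * e
  d≤ae = <⇒≤ (m<n*[1+m/n] (suc d) (suc a))

-- Seeds and query plans

∑< : ℕ → (ℕ → ℕ) → ℕ
∑< zero    f = 0
∑< (suc k) f = f 0 + ∑< k (f ∘ suc)

∑<-cong : ∀ k {f g : ℕ → ℕ} → (∀ i → i < k → f i ≡ g i) → ∑< k f ≡ ∑< k g
∑<-cong zero    h = refl
∑<-cong (suc k) h = cong₂ _+_ (h 0 (s≤s z≤n)) (∑<-cong k λ i i<k → h (suc i) (s≤s i<k))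

∑<-+ : ∀ a b f → ∑< (a + b) f ≡ ∑< a f + ∑< b (λ k → f (a + k))
∑<-+ zero    b f = refl
∑<-+ (suc a) b f = trans (cong (f 0 +_) (∑<-+ a b (f ∘ suc))) (sym (+-assoc (f 0) _ _))

∑<-double : ∀ k f → ∑< k (λ i → f (i + i) + f (suc (i + i))) ≡ ∑< (k + k) f
∑<-double zero    f = refl
∑<-double (suc k) f rewrite +-suc k k = trans (cong (f 0 + f 1 +_)
    (trans (∑<-cong k λ i _ → cong (λ j → f (suc j) + f (suc (suc j))) (+-suc i i)) (∑<-double k (λ i → f (suc (suc i))))))
  (+-assoc (f 0) (f 1) _)

∑<-periodic : ∀ c M .{{_ : NonZero M}} f → ∑< (c * M) (λ k → f (k % M)) ≡ c * ∑< M f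
∑<-periodic zero    M f = refl
∑<-periodic (suc c) M f = trans (∑<-+ M (c * M) _) (cong₂ _+_
  (∑<-cong M λ i i<M → cong f (m<n⇒m%n≡m i<M))
  (trans (∑<-cong (c * M) λ i _ → cong f (trans (cong (_% M) (+-comm M i)) ([m+n]%n≡m%n i M))) (∑<-periodic c M f)))

∑<-mono : ∀ {a b} f → a ≤ b → ∑< a f ≤ ∑< b f
∑<-mono f z≤n     = z≤n
∑<-mono f (s≤s h) = +-monoʳ-≤ (f 0) (∑<-mono (f ∘ suc) h)

-- Binary, lowest digit first, with `true` as digit 0: `seeds` lists `true` before `false`, so this
-- is the position in that list.
number : ∀ {r} → Vec Bool r → ℕ
number []          = 0
number (true ∷ s)  = number s + number s
number (false ∷ s) = suc (number s + number s)

∑-seeds : ∀ r f → ∑ (seeds r) (f ∘ number) ≡ ∑< (2 ^ r) f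
∑-seeds zero    f = refl
∑-seeds (suc r) f = begin
  ∑ (seeds (suc r)) (f ∘ number)     ≡⟨ ∑-concatMap _ (seeds r) (f ∘ number) ⟩
  ∑ (seeds r) (λ s → f (number s + number s) + (f (suc (number s + number s)) + 0))
    ≡⟨ ∑-cong (seeds r) (λ s → cong (f (number s + number s) +_) (+-identityʳ _)) ⟩
  ∑ (seeds r) (λ s → f (number s + number s) + f (suc (number s + number s)))
    ≡⟨ ∑-seeds r (λ i → f (i + i) + f (suc (i + i))) ⟩
  ∑< (2 ^ r) (λ i → f (i + i) + f (suc (i + i)))  ≡⟨ ∑<-double (2 ^ r) f ⟩
  ∑< (2 ^ r + 2 ^ r) f                            ≡⟨ cong (λ x → ∑< (2 ^ r + x) f) (+-identityʳ (2 ^ r)) ⟨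
  ∑< (2 ^ suc r) f ∎
  where open ≡-Reasoning

length-seeds : ∀ r → length (seeds r) ≡ 2 ^ r
length-seeds r = trans (length≡∑ (seeds r)) (trans (∑-seeds r (λ _ → 1)) (count (2 ^ r)))
  where
  count : ∀ k → ∑< k (λ _ → 1) ≡ k
  count zero    = refl
  count (suc k) = cong suc (count k)

module _ {A : Set} where

  at : A → List A → ℕ → A
  at d []       k       = d
  at d (x ∷ xs) zero    = x
  at d (x ∷ xs) (suc k) = at d xs k

  ∑-at : ∀ d xs f → ∑< (length xs) (f ∘ at d xs) ≡ ∑ xs f
  ∑-at d []       f = refl
  ∑-at d (x ∷ xs) f = cong (f x +_) (∑-at d xs f)

  pick : A → List A → ℕ → A
  pick d []       k = d
  pick d (x ∷ xs) k = at d (x ∷ xs) (k % suc (length xs))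

  -- Reducing a large random number modulo the length is almost uniform: each entry is hit at most
  -- 2 ^ r / length + 1 times.
  seeds-rare : ∀ d (Ω : List A) (f : A → ℕ) r → d ∈ Ω → 3 * length Ω ≤ 2 ^ r → 4 * ∑ Ω f ≤ length Ω →
               3 * ∑ (seeds r) (λ s → f (pick d Ω (number s))) ≤ 2 ^ r
  seeds-rare d Ω@(x ∷ xs) f r _ large rare = *-cancelˡ-≤ 4 (begin
    4 * (3 * ∑ (seeds r) (λ s → f (pick d Ω (number s))))     ≡⟨ cong (λ z → 4 * (3 * z)) (∑-seeds r (f ∘ pick d Ω)) ⟩
    4 * (3 * ∑< (2 ^ r) (λ k → f (at d Ω (k % M))))           ≤⟨ *-monoʳ-≤ 4 (*-monoʳ-≤ 3 (∑<-mono _ (<⇒≤ enough))) ⟩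
    4 * (3 * ∑< (suc c * M) (λ k → f (at d Ω (k % M))))       ≡⟨ cong (λ z → 4 * (3 * z)) (∑<-periodic (suc c) M (f ∘ at d Ω)) ⟩
    4 * (3 * (suc c * ∑< M (f ∘ at d Ω)))                     ≡⟨ cong (λ z → 4 * (3 * (suc c * z))) (∑-at d Ω f) ⟩
    4 * (3 * (suc c * ∑ Ω f))                                 ≡⟨ lem (suc c) (∑ Ω f) ⟩
    3 * (suc c * (4 * ∑ Ω f))                                 ≤⟨ *-monoʳ-≤ 3 (*-monoʳ-≤ (suc c) rare) ⟩
    3 * (M + c * M)                                           ≡⟨ *-distribˡ-+ 3 M (c * M) ⟩
    -- Rounding up to whole periods adds at most M ≤ 2 ^ r / 3, a factor 4/3, which turns the
    -- failure probability 1/4 into 1/3.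
    3 * M + 3 * (c * M)                                       ≤⟨ +-mono-≤ large (*-monoʳ-≤ 3 (m/n*n≤m (2 ^ r) M)) ⟩
    4 * 2 ^ r                                                 ∎)
    where
    open ≤-Reasoning
    M c : ℕ
    M = suc (length xs)
    c = 2 ^ r / M
    enough : 2 ^ r < suc c * M
    enough = subst (2 ^ r <_) (*-comm M (suc c)) (m<n*[1+m/n] (2 ^ r) M)
    lem : ∀ a x → 4 * (3 * (a * x)) ≡ 3 * (a * (4 * x))
    lem = solve-∀

majority : ∀ {A : Set} (xs : List A) (good : A → Bool) (far : A → ℕ) → (∀ x → 1 ≤ 𝟙 (good x) + far x) →
           3 * ∑ xs far ≤ length xs → 2 * length xs ≤ 3 * ∑ xs (𝟙 ∘ good)
majority xs good far either rare = +-cancelʳ-≤ (length xs) (2 * length xs) (3 * ∑ xs (𝟙 ∘ good)) (begin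
  2 * length xs + length xs              ≡⟨ lem (length xs) ⟩
  3 * length xs                          ≡⟨ cong (3 *_) (length≡∑ xs) ⟩
  3 * ∑ xs (λ _ → 1)                     ≤⟨ *-monoʳ-≤ 3 (∑-mono xs either) ⟩
  3 * ∑ xs (λ x → 𝟙 (good x) + far x)    ≡⟨ trans (cong (3 *_) (∑-+ xs (𝟙 ∘ good) far)) (*-distribˡ-+ 3 (∑ xs (𝟙 ∘ good)) (∑ xs far)) ⟩
  3 * ∑ xs (𝟙 ∘ good) + 3 * ∑ xs far     ≤⟨ +-monoʳ-≤ (3 * ∑ xs (𝟙 ∘ good)) rare ⟩
  3 * ∑ xs (𝟙 ∘ good) + length xs        ∎)
  where
  open ≤-Reasoning
  lem : ∀ x → 2 * x + x ≡ 3 * x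
  lem = solve-∀

-- A non-adaptive batch of queries in continuation-passing form. `answer` specifies what the tree
-- reads, so that correctness can be argued without decision trees.
record Query (n : ℕ) (A : Set) : Set where
  field
    go         : (A → QTree n) → QTree n
    answer     : Graph n → A
    price      : ℕ
    run-go     : ∀ k G → run (go k) G ≡ run (k (answer G)) G
    queries-go : ∀ k G → queries (go k) G ≤ price + queries (k (answer G)) G
open Query

module _ {n : ℕ} where

  ask : Fin n → Fin n → Query n (Maybe Bool)
  -- Diagonal entries are queried too, and the reply is discarded to agree with `obs`; the price is
  -- then always 1.
  go         (ask u v) k = query u v λ b → k (if does (u Fin.≟ v) then nothing else just b)
  answer     (ask u v) G = obs G u v
  price      (ask u v)   = 1
  run-go     (ask u v) k G = refl
  queries-go (ask u v) k G = ≤-refl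

  mapQ : ∀ {A B} → (A → B) → Query n A → Query n B
  go         (mapQ f q) k = go q (k ∘ f)
  answer     (mapQ f q) G = f (answer q G)
  price      (mapQ f q)   = price q
  run-go     (mapQ f q) k = run-go q (k ∘ f)
  queries-go (mapQ f q) k = queries-go q (k ∘ f)

  pairQ : ∀ {A B} → Query n A → Query n B → Query n (A × B)
  go         (pairQ p q) k = go p λ a → go q λ b → k (a , b)
  answer     (pairQ p q) G = answer p G , answer q G
  price      (pairQ p q)   = price p + price q
  run-go     (pairQ p q) k G = trans (run-go p _ G) (run-go q _ G)
  queries-go (pairQ p q) k G = ≤-trans (queries-go p _ G) (≤-trans (+-monoʳ-≤ (price p) (queries-go q _ G))
    (≤-reflexive (sym (+-assoc (price p) (price q) _))))

  module _ {A B : Set} (c : ℕ) (f : A → Query n B) (f≤ : ∀ a → price (f a) ≤ c) where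

    vec-go : ∀ {k} → Vec A k → (Vec B k → QTree n) → QTree n
    vec-go []      k = k []
    vec-go (a ∷ v) k = go (f a) λ b → vec-go v λ bs → k (b ∷ bs)

    vec-run-go : ∀ {k} (v : Vec A k) κ G → run (vec-go v κ) G ≡ run (κ (Vec.map (λ a → answer (f a) G) v)) G
    vec-run-go []      κ G = refl
    vec-run-go (a ∷ v) κ G = trans (run-go (f a) _ G) (vec-run-go v _ G)

    vec-queries-go : ∀ {k} (v : Vec A k) κ G →
      queries (vec-go v κ) G ≤ k * c + queries (κ (Vec.map (λ a → answer (f a) G) v)) G
    vec-queries-go []      κ G = ≤-refl
    vec-queries-go (a ∷ v) κ G = ≤-trans (queries-go (f a) _ G) (≤-trans (+-mono-≤ (f≤ a) (vec-queries-go v _ G))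
      (≤-reflexive (sym (+-assoc c _ _))))

    vecQ : ∀ {k} → Vec A k → Query n (Vec B k)
    go         (vecQ v)     = vec-go v
    answer     (vecQ v) G   = Vec.map (λ a → answer (f a) G) v
    price      (vecQ {k} v) = k * c
    run-go     (vecQ v)     = vec-run-go v
    queries-go (vecQ v)     = vec-queries-go v

module QueryPlan (n N h L g b e : ℕ) {{n≢0 : NonZero n}} {{L≢0 : NonZero L}} where

  open Estimator n N h L g b e

  patternQ : Vec (Vec (Fin n) s) L → Fin n → Query n Pattern
  patternQ Us v = mapQ (block v ,_) (vecQ 1 (ask v) (λ _ → ≤-refl) (lookup Us (block v)))

  itemQ : Vec (Vec (Fin n) s) L → Fin n × Fin n → Query n Item
  itemQ Us (u , v) = pairQ (patternQ Us u) (pairQ (patternQ Us v) (ask u v))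

  itemPrice : ℕ
  itemPrice = s * 1 + (s * 1 + 1)

  observeQ : Samples → Query n (Vec (Vec Item g) (b + b))
  observeQ (Us , Ws) = vecQ (g * itemPrice) (vecQ itemPrice (itemQ Us) (λ _ → ≤-refl)) (λ _ → ≤-refl) Ws

-- Asymptotics in 1/ε

ExpPoly Poly : (ℕ → ℕ) → Set
ExpPoly f = ∃ λ c → ∃ λ d → ∀ e → .{{NonZero e}} → f e ≤ 2 ^ (c * e ^ d)
Poly    f = ∃ λ c → ∃ λ d → ∀ e → .{{NonZero e}} → f e ≤ c * e ^ d

n≤2^n : ∀ n → n ≤ 2 ^ n
n≤2^n zero    = z≤n
n≤2^n (suc n) = ≤-trans (+-mono-≤ (m^n>0 2 n) (n≤2^n n)) (≤-reflexive (cong (2 ^ n +_) (sym (+-identityʳ (2 ^ n)))))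

poly-const : ∀ k → Poly (λ _ → k)
poly-const k = k , 0 , λ e → ≤-reflexive (sym (*-identityʳ k))

poly-id : Poly (λ e → e)
poly-id = 1 , 1 , λ e → ≤-reflexive (sym (trans (*-identityˡ (e ^ 1)) (^-identityʳ e)))

poly-* : ∀ {f g} → Poly f → Poly g → Poly (λ e → f e * g e)
poly-* (c , d , p) (c′ , d′ , q) = c * c′ , d + d′ , λ e → ≤-trans (*-mono-≤ (p e) (q e))
  (≤-reflexive (trans (lem c (e ^ d) c′ (e ^ d′)) (cong (c * c′ *_) (sym (^-distribˡ-+-* e d d′)))))
  where
  lem : ∀ a b c d → a * b * (c * d) ≡ a * c * (b * d)
  lem = solve-∀

exp-poly : ∀ {f} → Poly f → ExpPoly f
exp-poly (c , d , p) = c , d , λ e → ≤-trans (p e) (n≤2^n _)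

exponents-+ : ∀ e .{{_ : NonZero e}} c d c′ d′ → c * e ^ d + c′ * e ^ d′ ≤ (c + c′) * e ^ (d + d′)
exponents-+ e c d c′ d′ = ≤-trans (+-mono-≤ (*-monoʳ-≤ c (^-monoʳ-≤ e (m≤m+n d d′))) (*-monoʳ-≤ c′ (^-monoʳ-≤ e (m≤n+m d′ d))))
  (≤-reflexive (sym (*-distribʳ-+ (e ^ (d + d′)) c c′)))

exp-* : ∀ {f g} → ExpPoly f → ExpPoly g → ExpPoly (λ e → f e * g e)
exp-* (c , d , p) (c′ , d′ , q) = c + c′ , d + d′ , λ e → ≤-trans (*-mono-≤ (p e) (q e))
  (≤-trans (≤-reflexive (sym (^-distribˡ-+-* 2 (c * e ^ d) (c′ * e ^ d′)))) (^-monoʳ-≤ 2 (exponents-+ e c d c′ d′)))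

-- Both bounds are at least 1, so their sum is at most twice their product.
exp-+ : ∀ {f g} → ExpPoly f → ExpPoly g → ExpPoly (λ e → f e + g e)
exp-+ {f} {g} (c , d , p) (c′ , d′ , q) = let c″ , d″ , r = product in
  c″ , d″ , λ e → ≤-trans (sum≤ (f e) (g e) (2 ^ (c * e ^ d)) (2 ^ (c′ * e ^ d′)) (p e) (q e) (m^n>0 2 (c * e ^ d)) (m^n>0 2 (c′ * e ^ d′))) (r e)
  where
  product : ExpPoly (λ e → 2 * (2 ^ (c * e ^ d) * 2 ^ (c′ * e ^ d′)))
  product = exp-* (exp-poly (poly-const 2)) (exp-* (c , d , λ e → ≤-refl) (c′ , d′ , λ e → ≤-refl))
  sum≤ : ∀ a b x y → a ≤ x → b ≤ y → 1 ≤ x → 1 ≤ y → a + b ≤ 2 * (x * y)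
  sum≤ a b x y a≤ b≤ 1≤x 1≤y = ≤-trans (+-mono-≤ (≤-trans a≤ (≤-trans (≤-reflexive (sym (*-identityʳ x))) (*-monoʳ-≤ x 1≤y)))
      (≤-trans b≤ (≤-trans (≤-reflexive (sym (*-identityˡ y))) (*-monoˡ-≤ y 1≤x))))
    (≤-reflexive (cong (x * y +_) (sym (+-identityʳ (x * y)))))

exp-^ : ∀ {f g} → ExpPoly f → Poly g → ExpPoly (λ e → f e ^ g e)
exp-^ {f} {g} (c , d , p) (c′ , d′ , q) = c * c′ , d + d′ , λ e → ≤-trans (^-monoˡ-≤ (g e) (p e))
  (≤-trans (≤-reflexive (^-*-assoc 2 (c * e ^ d) (g e)))
    (^-monoʳ-≤ 2 (≤-trans (*-monoʳ-≤ (c * e ^ d) (q e))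
      (≤-reflexive (trans (lem c (e ^ d) c′ (e ^ d′)) (cong (c * c′ *_) (sym (^-distribˡ-+-* e d d′))))))))
  where
  lem : ∀ a b c d → a * b * (c * d) ≡ a * c * (b * d)
  lem = solve-∀

-- With e ≥ 1/ε: pQ cliques, each cut by every other one into pm layers, make pN pieces; blocks (pL of
-- them) are recoloured from samples of ph² vertices, and 2 pb groups of pg pairs estimate the costs.
-- Abstract, so that the type checker never unfolds these large numbers.
abstract

  pD pQ pm pN ph pL pg pb pq : ℕ → ℕ
  pD e = 312 * e
  pQ e = pD e * pD e * pD e
  pm e = pQ e * pQ e * (pD e * pD e)
  pN e = pQ e * pm e ^ pQ e
  ph e = 64 * e * suc (pN e + pN e)
  pL e = 48 * e
  pg e = 64 * (e * e)
  pb e = 3 + (pN e * pN e + suc (pN e) * (ph e * ph e) * pL e)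
  pq e = (pb e + pb e) * (pg e * (ph e * ph e * 1 + (ph e * ph e * 1 + 1)))

  pD≡ : ∀ e → pD e ≡ 312 * e
  pD≡ e = refl
  pQ≡ : ∀ e → pQ e ≡ pD e * pD e * pD e
  pQ≡ e = refl
  pm≡ : ∀ e → pm e ≡ pQ e * pQ e * (pD e * pD e)
  pm≡ e = refl
  pN≡ : ∀ e → pN e ≡ pQ e * pm e ^ pQ e
  pN≡ e = refl
  ph≡ : ∀ e → ph e ≡ 64 * e * suc (pN e + pN e)
  ph≡ e = refl
  pL≡ : ∀ e → pL e ≡ 48 * e
  pL≡ e = refl
  pg≡ : ∀ e → pg e ≡ 64 * (e * e)
  pg≡ e = refl
  pb≡ : ∀ e → pb e ≡ 3 + (pN e * pN e + suc (pN e) * (ph e * ph e) * pL e)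
  pb≡ e = refl
  pq≡ : ∀ e → pq e ≡ (pb e + pb e) * (pg e * (ph e * ph e * 1 + (ph e * ph e * 1 + 1)))
  pq≡ e = refl

  pq-expPoly : ExpPoly pq
  pq-expPoly = exp-* (exp-+ bE bE) (exp-* gE (exp-+ sE (exp-+ sE one)))
    where
    DP : Poly pD
    DP = poly-* (poly-const 312) poly-id
    QP : Poly pQ
    QP = poly-* (poly-* DP DP) DP
    one : ExpPoly (λ _ → 1)
    one = exp-poly (poly-const 1)
    NE : ExpPoly pN
    NE = exp-* (exp-poly QP) (exp-^ (exp-poly (poly-* (poly-* QP QP) (poly-* DP DP))) QP)
    hE : ExpPoly ph
    hE = exp-* (exp-poly (poly-* (poly-const 64) poly-id)) (exp-+ one (exp-+ NE NE))
    sE : ExpPoly (λ e → ph e * ph e * 1)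
    sE = exp-* (exp-* hE hE) one
    gE : ExpPoly pg
    gE = exp-poly (poly-* (poly-const 64) (poly-* poly-id poly-id))
    bE : ExpPoly pb
    bE = exp-+ (exp-poly (poly-const 3)) (exp-+ (exp-* NE NE)
      (exp-* (exp-* (exp-+ one NE) (exp-* hE hE)) (exp-poly (poly-* (poly-const 48) poly-id))))

-- There are at most 2 ^ (N²) tables and N + 2 ^ N ≤ 2 ^ (N + 1) labels for each of the h² L sampled
-- vertices; the 3 in `b` pays for the factor 8.
hypotheses-few : ∀ n N h L g b e {{_ : NonZero n}} {{_ : NonZero L}} →
  b ≡ 3 + (N * N + suc N * (h * h) * L) → 8 * length (Estimator.hypotheses n N h L g b e) ≤ 2 ^ b
hypotheses-few n N h L g b e b≡ = begin
  8 * length (pairs (filter template? (vecs (vecs bools N) N)) (vecs (vecs allLabels (h * h)) L))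
    ≡⟨ cong (8 *_) (length-pairs (filter template? (vecs (vecs bools N) N)) _) ⟩
  8 * (length (filter template? (vecs (vecs bools N) N)) * length (vecs (vecs (allLabels {N}) (h * h)) L))
    ≤⟨ *-monoʳ-≤ 8 (*-mono-≤ tables labellings) ⟩
  8 * (2 ^ (N * N) * 2 ^ (suc N * (h * h) * L))
    ≡⟨ cong (8 *_) (^-distribˡ-+-* 2 (N * N) _) ⟨
  2 ^ 3 * 2 ^ (N * N + suc N * (h * h) * L)
    ≡⟨ ^-distribˡ-+-* 2 3 (N * N + suc N * (h * h) * L) ⟨
  2 ^ (3 + (N * N + suc N * (h * h) * L))
    ≡⟨ cong (2 ^_) b≡ ⟨
  2 ^ b ∎
  where
  open ≤-Reasoning
  tables : length (filter template? (vecs (vecs bools N) N)) ≤ 2 ^ (N * N)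
  tables = ≤-trans (List.length-filter template? (vecs (vecs bools N) N)) (≤-reflexive
    (trans (length-vecs (vecs bools N) N) (trans (cong (_^ N) (length-vecs bools N)) (^-*-assoc 2 N N))))
  labellings : length (vecs (vecs (allLabels {N}) (h * h)) L) ≤ 2 ^ (suc N * (h * h) * L)
  labellings = begin
    length (vecs (vecs (allLabels {N}) (h * h)) L)
      ≡⟨ trans (length-vecs (vecs allLabels (h * h)) L) (cong (_^ L) (trans (length-vecs allLabels (h * h)) (cong (_^ (h * h)) (length-allLabels {N})))) ⟩
    ((N + 2 ^ N) ^ (h * h)) ^ L
      ≤⟨ ^-monoˡ-≤ L (^-monoˡ-≤ (h * h) (≤-trans (+-monoˡ-≤ (2 ^ N) (n≤2^n N)) (≤-reflexive (cong (2 ^ N +_) (sym (+-identityʳ (2 ^ N))))))) ⟩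
    ((2 ^ suc N) ^ (h * h)) ^ L
      ≡⟨ trans (cong (_^ L) (^-*-assoc 2 (suc N) (h * h))) (^-*-assoc 2 (suc N * (h * h)) L) ⟩
    2 ^ (suc N * (h * h) * L) ∎

-- The algorithm and its guarantees

module Algorithm (e m : ℕ) {{e≢0 : NonZero e}} where

  private instance
    pL≢0 : NonZero (pL e)
    pL≢0 = subst NonZero (sym (pL≡ e)) (m*n≢0 48 e)
    pg≢0 : NonZero (pg e)
    pg≢0 = subst NonZero (sym (pg≡ e)) (m*n≢0 64 (e * e) {{_}} {{m*n≢0 e e}})
    ph≢0 : NonZero (ph e)
    ph≢0 = subst NonZero (sym (ph≡ e)) (m*n≢0 (64 * e) (suc (pN e + pN e)) {{m*n≢0 64 e}})

  open Estimator (suc m) (pN e) (ph e) (pL e) (pg e) (pb e) e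
  open QueryPlan (suc m) (pN e) (ph e) (pL e) (pg e) (pb e) e

  someSample : Samples
  someSample = Vec.replicate (pL e) (Vec.replicate s zero) , Vec.replicate (pb e + pb e) (Vec.replicate (pg e) (zero , zero))

  someSample-∈ : someSample ∈ samples
  someSample-∈ = ∈-pairs
    (∈-replicate (∈-replicate (∈.∈-allFin zero)))
    (∈-replicate (∈-replicate (∈-pairs (∈.∈-allFin zero) (∈.∈-allFin zero))))
    where
    ∈-replicate : ∀ {A : Set} {xs : List A} {x k} → x ∈ xs → Vec.replicate k x ∈ vecs xs k
    ∈-replicate {xs = xs} {x} {k} x∈ = ∈-vecs (Vec.replicate k x) λ i → subst (_∈ xs) (sym (Vec.lookup-replicate i x)) x∈

  abstract
    -- Only queries are counted, so the crude bound `n≤2^n` on the number of samples is good enough.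
    randomBits : ℕ
    randomBits = 2 + length samples

    enough-bits : 3 * length samples ≤ 2 ^ randomBits
    enough-bits = begin
      3 * length samples          ≤⟨ *-monoˡ-≤ (length samples) (m≤m+n 3 1) ⟩
      2 ^ 2 * length samples      ≤⟨ *-monoʳ-≤ (2 ^ 2) (n≤2^n (length samples)) ⟩
      2 ^ 2 * 2 ^ length samples  ≡⟨ ^-distribˡ-+-* 2 2 (length samples) ⟨
      2 ^ randomBits              ∎
      where open ≤-Reasoning

  sampleOf : Vec Bool randomBits → Samples
  sampleOf s = pick someSample samples (number s)

  decisionTree : Vec Bool randomBits → QTree (suc m)
  decisionTree s = go (observeQ (sampleOf s)) λ D → output (value m (estimate D))

  decisionTree-run : ∀ s G → run (decisionTree s) G ≡ value m (estimate (Observed.observed G (sampleOf s)))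
  decisionTree-run s G = run-go (observeQ (sampleOf s)) _ G

  decisionTree-queries : ∀ s G → queries (decisionTree s) G ≤ pq e
  decisionTree-queries s G = ≤-trans (queries-go (observeQ (sampleOf s)) _ G)
    (≤-reflexive (trans (+-identityʳ _) (sym (pq≡ e))))

  module _ (G : Graph (suc m)) (k : ℕ) (isMin : IsMinDistC4 G k) where

    open Correctness (suc m) (pN e) (pD e) (pQ e) (pm e) (ph e) (pL e) (pg e) (pb e) e
      (pD≡ e) (pQ≡ e) (pm≡ e) (pN≡ e) (ph≡ e) (pL≡ e) (pg≡ e) (hypotheses-few (suc m) (pN e) (ph e) (pL e) (pg e) (pb e) e (pb≡ e))
      G k isMin using (close; correct; M≡n²)

    far : Samples → ℕ
    far ω = 𝟙 (not (close (estimate (Observed.observed G ω))))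

    rarely-far : 3 * ∑ (seeds randomBits) (λ s → far (sampleOf s)) ≤ 2 ^ randomBits
    rarely-far = seeds-rare someSample samples far randomBits someSample-∈ enough-bits correct

    close-elim : ∀ κ → close κ ≡ true → let n² = suc m * suc m in
                 e * κ ≤ e * (2 * k) + 2 * n² × e * (2 * k) ≤ e * κ + 2 * n²
    close-elim κ c = subst (λ x → e * κ ≤ e * (2 * k) + 2 * x) M≡n² (does⇒ (e * κ ≤? e * (2 * k) + 2 * M) (∧-fst c)) ,
      subst (λ x → e * (2 * k) ≤ e * κ + 2 * x) M≡n²
        (does⇒ (e * (2 * k) ≤? e * κ + 2 * M) (∧-snd {does (e * κ ≤? e * (2 * k) + 2 * M)} c))

    -- Stated for any test implied by the two integer inequalities, so that rational arithmetic
    -- stays outside the counting.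
    mostly-good : ∀ (good : ℚ → Bool) →
      (∀ κ → let n² = suc m * suc m in e * κ ≤ e * (2 * k) + 2 * n² → e * (2 * k) ≤ e * κ + 2 * n² → good (value m κ) ≡ true) →
      2 * 2 ^ randomBits ≤ 3 * ∑ (seeds randomBits) (λ s → 𝟙 (good (run (decisionTree s) G)))
    mostly-good good close⇒good = subst (λ x → 2 * x ≤ 3 * ∑ (seeds randomBits) (λ s → 𝟙 (good (run (decisionTree s) G))))
      (length-seeds randomBits)
      (majority (seeds randomBits) (λ s → good (run (decisionTree s) G)) (λ s → far (sampleOf s)) either
        (subst (3 * ∑ (seeds randomBits) (λ s → far (sampleOf s)) ≤_) (sym (length-seeds randomBits)) rarely-far))
      where
      either : ∀ s → 1 ≤ 𝟙 (good (run (decisionTree s) G)) + far (sampleOf s)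
      either s = cases (true-or-false (close κ))
        where
        κ : ℕ
        κ = estimate (Observed.observed G (sampleOf s))
        cases : close κ ≡ true ⊎ close κ ≡ false → 1 ≤ 𝟙 (good (run (decisionTree s) G)) + far (sampleOf s)
        cases (inj₁ c) = ≤-trans (≤-reflexive (sym (𝟙≡1 (trans (cong good (decisionTree-run s G))
          (close⇒good κ (proj₁ (close-elim κ c)) (proj₂ (close-elim κ c))))))) (m≤m+n _ _)
        cases (inj₂ f) = ≤-trans (≤-reflexive (sym (𝟙≡1 (cong not f)))) (m≤n+m _ _)

algorithm : RandAlg
bits algorithm ε zero    = 0
bits algorithm ε (suc m) = Algorithm.randomBits (invCeil ε) m {{invCeil≢0 ε}}
tree algorithm ε zero    s = output ℚ.0ℚ
tree algorithm ε (suc m) s = Algorithm.decisionTree (invCeil ε) m {{invCeil≢0 ε}} s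

theorem1p5 : Σ RandAlg λ A → Σ (ℚ → ℕ) λ q → IsDistApproxC4 A × QueryBound A q × ExpPolyBound q
theorem1p5 = algorithm , pq ∘ invCeil , approximates , bounded , expPoly
  where
  approximates : IsDistApproxC4 algorithm
  approximates ε 0<ε _ m G k isMin = ≤-trans
    (Algorithm.mostly-good (invCeil ε) m {{invCeil≢0 ε}} G k isMin (λ x → does (ℚ.∣ x ℚ.- v ∣ ℚ.≤? ε))
      (λ κ upper lower → dec-true (ℚ.∣ value m κ ℚ.- v ∣ ℚ.≤? ε) (value-close ε 0<ε m κ k upper lower)))
    (≤-reflexive (cong (3 *_) (sym (length-filter≡∑ (λ s → ℚ.∣ run (tree algorithm ε (suc m) s) G ℚ.- v ∣ ℚ.≤? ε)
      (seeds (bits algorithm ε (suc m)))))))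
    where
    v : ℚ
    v = (ℤ.+ k) ℚ./ (suc m * suc m)
  bounded : QueryBound algorithm (pq ∘ invCeil)
  bounded ε _ _ zero    G s = z≤n
  bounded ε _ _ (suc m) G s = Algorithm.decisionTree-queries (invCeil ε) m {{invCeil≢0 ε}} s G
  expPoly : ExpPolyBound (pq ∘ invCeil)
  -- `invCeil ε` is at most 2m, and (2m) ^ d accounts for the factor 2 ^ d.
  expPoly = let c , d , p = pq-expPoly in c * 2 ^ d , d , λ ε 0<ε _ m 1≤εm →
    ≤-trans (p (invCeil ε) {{invCeil≢0 ε}}) (^-monoʳ-≤ 2 (≤-trans (*-monoʳ-≤ c (^-monoˡ-≤ d (invCeil-≤ ε 0<ε m 1≤εm)))
      (≤-reflexive (trans (cong (c *_) (^-distribʳ-* d 2 m)) (sym (*-assoc c (2 ^ d) (m ^ d)))))))
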